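{- Let $d\ge 2$ be an integer, $q$ a prime power, $h(x)=ax^d+c\in \mathbb{F}_q[x]$ with $a\neq 0$, and $\beta\in\mathbb{F}_q$. Suppose $q\equiv 1 \pmod r$ for each prime $r\mid d$ and, if $4\mid d$, suppose also $q\equiv 1 \pmod 4$. Then the pair $(h,\beta)$ is dynamically irreducible over $\mathbb{F}_q$ if and only if, for every prime $r\mid d$, - $\frac{ -(c-\beta)}{a}$ is not an $r$-th power in $\mathbb{F}_q$, and - $\frac{h^{n-1}(c)-\beta}{a}$ is not an $r$-th power in $\mathbb{F}_q$ for all $n>1$, and, if $4\mid d$, - $\frac{c-\beta}{4a}$ is not a $4$-th power in $\mathbb{F}_q$, and - $\frac{h^{n-1}(c)-\beta}{a}$ is not a $4$-th power in $\mathbb{F}_q$ for all $n>1$.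
   Context: $\mathbb{F}_q$ is the finite field with $q$ elements. For a polynomial $h$, $h^n$ denotes the $n$-fold composition of $h$ with itself. For a polynomial $h\in K[x]$ of degree at least $2$ over a field $K$ and $\beta\in K$, the pair $(h,\beta)$ is dynamically irreducible over $K$ if $h^n(x)-\beta$ is irreducible over $K$ for all positive integers $n$. An $m$-th power in $\mathbb{F}_q$ is an element of the form $y^m$ with $y\in\mathbb{F}_q$ (so $0$ is an $m$-th power). -}

module Defs where

open import Algebra.Apartness.Bundles using (HeytingField; HeytingCommutativeRing)
open import Algebra.Bundles using (CommutativeRing; Semiring)
open import Algebra.Bundles.Raw using (RawSemiring)
import Algebra.Definitions.RawSemiring as RawSemiringDefinitions
open import Data.Fin.Base using (Fin)
open import Data.List.Base using (List; []; _∷_; map)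
open import Data.Nat.Base as ℕ using (ℕ; zero; suc; _≤_; _<_; ∣_-_∣)
open import Data.Nat.Divisibility using (_∣_)
open import Data.Nat.Primality using (Prime)
open import Data.Product.Base using (∃-syntax; _×_; proj₁)
open import Function.Bundles using (Inverse)
open import Level using (_⊔_) renaming (suc to lsuc)
open import Relation.Binary.Definitions using (Decidable)
open import Relation.Binary.PropositionalEquality using (_≡_) renaming (setoid to ≡-setoid)
open import Relation.Nullary using (yes; no)

IsPrimePower : ℕ → Set
IsPrimePower q = ∃[ p ] ∃[ k ] Prime p × 1 ≤ k × q ≡ p ℕ.^ k

infix 4 _≡_[mod_]
_≡_[mod_] : ℕ → ℕ → ℕ → Set
a ≡ b [mod m ] = m ∣ ∣ a - b ∣

-- A field in the classical sense: for a finite carrier the decidability of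
-- apartness is no restriction, since x # y means that x - y is invertible.
record DiscreteField c ℓ₁ ℓ₂ : Set (lsuc (c ⊔ ℓ₁ ⊔ ℓ₂)) where
  field
    heytingField : HeytingField c ℓ₁ ℓ₂

  open HeytingField heytingField public

  field
    _#?_ : Decidable _#_

  commutativeRing : CommutativeRing c ℓ₁
  commutativeRing = HeytingCommutativeRing.commutativeRing heytingCommutativeRing

  open Semiring (CommutativeRing.semiring commutativeRing) public using (rawSemiring)
  open RawSemiringDefinitions rawSemiring public
    using (_^_) renaming (_×_ to infixr 8 _·_)

  -- Total, with the convention 0 ⁻¹ = 0.
  infix 9 _⁻¹
  _⁻¹ : Carrier → Carrier
  y ⁻¹ with y #? 0#
  ... | yes y#0 = proj₁ (#⇒invertible y#0)
  ... | no  _   = 0#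

  infixl 7 _/_
  _/_ : Carrier → Carrier → Carrier
  x / y = x * y ⁻¹

  IsPower : ℕ → Carrier → Set (c ⊔ ℓ₁)
  IsPower m x = ∃[ y ] x ≈ y ^ m

  HasOrder : ℕ → Set (c ⊔ ℓ₁)
  HasOrder q = Inverse setoid (≡-setoid (Fin q))

module Polynomials {c ℓ₁ ℓ₂} (K : DiscreteField c ℓ₁ ℓ₂) where

  open DiscreteField K

  -- Coefficient lists, constant term first. Trailing zeros are allowed, so
  -- polynomials are compared by _≈ₚ_.
  Poly : Set c
  Poly = List Carrier

  coeff : Poly → ℕ → Carrier
  coeff []      _       = 0#
  coeff (a ∷ _) zero    = a
  coeff (_ ∷ p) (suc i) = coeff p i

  infix 4 _≈ₚ_
  _≈ₚ_ : Poly → Poly → Set ℓ₁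
  p ≈ₚ q = ∀ i → coeff p i ≈ coeff q i

  const : Carrier → Poly
  const a = a ∷ []

  X : Poly
  X = 0# ∷ 1# ∷ []

  infixl 6 _+ₚ_ _-ₚ_
  infixl 7 _*ₚ_

  _+ₚ_ : Poly → Poly → Poly
  []      +ₚ q       = q
  (a ∷ p) +ₚ []      = a ∷ p
  (a ∷ p) +ₚ (b ∷ q) = (a + b) ∷ (p +ₚ q)

  _-ₚ_ : Poly → Poly → Poly
  p -ₚ q = p +ₚ map -_ q

  _*ₚ_ : Poly → Poly → Poly
  []      *ₚ q = []
  (a ∷ p) *ₚ q = map (a *_) q +ₚ (0# ∷ (p *ₚ q))

  polyRawSemiring : RawSemiring c ℓ₁
  polyRawSemiring = record
    { Carrier = Poly
    ; _≈_     = _≈ₚ_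
    ; _+_     = _+ₚ_
    ; _*_     = _*ₚ_
    ; 0#      = []
    ; 1#      = const 1#
    }

  open RawSemiringDefinitions polyRawSemiring public
    using (Irreducible) renaming (_^_ to infixr 8 _^ₚ_)

  eval : Poly → Carrier → Carrier
  eval []      x = 0#
  eval (a ∷ p) x = a + x * eval p x

  infixr 9 _∘ₚ_
  _∘ₚ_ : Poly → Poly → Poly
  []      ∘ₚ q = []
  (a ∷ p) ∘ₚ q = const a +ₚ q *ₚ (p ∘ₚ q)

  infixr 8 _^∘_
  _^∘_ : Poly → ℕ → Poly
  h ^∘ zero  = X
  h ^∘ suc n = h ∘ₚ (h ^∘ n)

  DegreeAtLeast : ℕ → Poly → Set ℓ₂
  DegreeAtLeast m p = ∃[ i ] m ≤ i × coeff p i # 0#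

  DynamicallyIrreducible : Poly → Carrier → Set (c ⊔ ℓ₁ ⊔ ℓ₂)
  DynamicallyIrreducible h β =
    DegreeAtLeast 2 h × (∀ n → 1 ≤ n → Irreducible ((h ^∘ n) -ₚ const β))

{-# OPTIONS --safe #-}

-- Put R = F[x]/u for a divisor u of h^n - β and let θ be the class of x, so that
-- β = h^n(θ). Reach θ from β by successive extraction of r-th roots, r prime.
-- If t has D conjugates under y ↦ y^q and t = a w^r + c, then w^(q^D) = ζ w with
-- ζ = N^((q-1)/r), where N ∈ F is the norm of (t - c)/a; since r ∣ q - 1, ζ is a
-- primitive r-th root of unity, and w has r D conjugates, precisely when N is not
-- an r-th power. The norms of all steps inside one application of h agree up to
-- r-th powers (the sign is harmless because -1 is a square when 4 ∣ d), so they
-- are the values in the statement. The quartic conditions follow from the quadratic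
-- ones, -4 being minus a square.
-- If none of them is an r-th power, the d^n conjugates of θ are roots of u with
-- unit differences, hence deg u = d^n. Conversely, at the first norm which is an
-- r-th power, θ has fewer than d^n conjugates although F[x]/(h^n - β) would be a
-- field with q^(d^n) elements, each a root of y^(q^M) - y with M < d^n.

module Submission where

open import Defs
open import Algebra.Bundles using (CommutativeRing; RawSemiring)
import Algebra.Definitions.RawMagma as RawMagmaDefinitions
import Algebra.Morphism.Construct.Identity as Identity
open import Algebra.Morphism.Structures using (IsRingHomomorphism)
open import Algebra.Solver.Ring.AlmostCommutativeRing
  using (fromCommutativeRing; _-Raw-AlmostCommutative⟶_)
open import Data.Fin.Base using (Fin; zero; suc; toℕ; inject≤; fromℕ; inject₁; finToFun; funToFin; combine)
open import Data.Fin.Permutation using (Permutation; permutation)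
open import Data.Fin.Properties
  using (inject≤-injective; suc-injective; toℕ-fromℕ; toℕ-inject₁; toℕ<n; toℕ-injective; funToFin-finToFin)
open import Data.Integer.Base as ℤ using (ℤ; +_; -[1+_]; _⊖_)
import Data.Integer.Properties as ℤ
open import Data.List.Base using ([]; _∷_; map; length; tabulate)
open import Data.List.Relation.Unary.All using (All; []; _∷_)
open import Data.Maybe.Base using (Maybe; just; nothing)
open import Data.Nat.Base as ℕ using (ℕ; zero; suc; _≤_; _<_; _∸_; z≤n; s≤s; _!)
open import Data.Nat.Combinatorics using (_C_; nCn≡1; nCk≡nC[n∸k]; nCk≡n!/k![n-k]!; k![n∸k]!∣n!)
open import Data.Nat.Coprimality using (Coprime; coprime-Bézout)
open import Data.Nat.Divisibility as ℕ using (_∣_; divides; _∣?_)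
import Data.Nat.DivMod as ℕ
open import Data.Nat.GCD using (module Bézout)
open import Data.Nat.GeneralisedArithmetic using (fold; iterate; iterate-is-fold)
open import Data.Nat.ListAction using (product)
open import Data.Nat.Primality
  using (Prime; prime[2]; euclidsLemma; prime⇒irreducible; prime⇒nonTrivial)
open import Data.Nat.Primality.Factorisation using (PrimeFactorisation; factorise)
import Data.Nat.Properties as ℕ
open import Data.Nat.Solver using (module +-*-Solver)
open import Data.Product.Base using (∃-syntax; _×_; _,_; proj₁; proj₂)
import Data.Sign.Base as Sign
open import Data.Sum.Base using (_⊎_; inj₁; inj₂)
open import Data.Vec.Functional using (replicate)
open import Function.Base using (_∘_; id)
open import Function.Bundles using (Inverse; _⇔_; mk⇔)
open import Level using (_⊔_)
open import Relation.Binary.Definitions using (Decidable; tri<; tri≈; tri>)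
open import Relation.Binary.PropositionalEquality.Core as ≡ using (_≡_; _≢_; _≗_)
open import Relation.Binary.PropositionalEquality.Properties using (module ≡-Reasoning)
open import Relation.Binary.Structures using (IsEquivalence)
open import Relation.Nullary using (¬_; yes; no; contradiction)

-- Two encodings get around this. Conjugates count as distinct when their differences are units,
-- which is what counting roots requires in such a ring. Norms are plain powers: the product of the
-- D conjugates of y is y ^ (1 + q + ... + q ^ (D - 1)), so statements about norms become arithmetic
-- of exponents. Each stage carries the function G giving the norm of x - t for every x in F;
-- extracting an r-th root replaces G(x) by b ^ D G(a x ^ r + c) with b = 1 / a. In the converse,
-- the period of θ has to be bounded. With e = d / r and Q = q ^ (d ^ m), every prime factor of e
-- divides Q - 1, hence e (Q - 1) divides Q ^ e - 1, and an e-th root of an element fixed by y ↦ y ^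
-- Q is fixed by its e-th iterate. Being an r-th power is never decided. Euler's criterion only
-- refutes that an element is a nonpower, whence the double negations.

-- Commutative rings: units, regular elements and roots of polynomial functions.

module RingTheory {c ℓ} (R : CommutativeRing c ℓ) where

  open CommutativeRing R public hiding (zero)
  open import Algebra.Properties.Ring ring public
    using (-‿involutive; -0#≈0#; -‿distribˡ-*; -‿distribʳ-*; -1*x≈-x; x∙y⁻¹≈ε⇒x≈y; -‿+-comm)
  open import Algebra.Properties.Semiring.Mult.TCOptimised semiring
    using (×-homo-+; ×1-homo-*; 1+×) renaming (_×_ to infixr 8 _·′_)
  open import Algebra.Properties.CommutativeMonoid.Sum *-commutativeMonoid public
    using () renaming (sum to ∏)
  open import Algebra.Properties.CommutativeSemiring.Exp commutativeSemiring public
    using (_^_; ^-congˡ; ^-congʳ; ^-homo-*; ^-assocʳ; ^-distrib-*)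
  open import Relation.Binary.Reasoning.Setoid setoid

  -- With the optimised multiple, `1 ·′ 1#` reduces to `1#`, so the constants 0 and 1 of the solver
  -- are those of the ring by `refl`.
  fromℤ : ℤ → Carrier
  fromℤ (+ n)    = n ·′ 1#
  fromℤ -[1+ n ] = - (suc n ·′ 1#)

  private
    cancel-suc : ∀ x y → (1# + x) + - (1# + y) ≈ x + - y
    cancel-suc x y = begin
      (1# + x) + - (1# + y)     ≈⟨ +-cong (+-comm 1# x) (sym (-‿+-comm 1# y)) ⟩
      (x + 1#) + (- 1# + - y)   ≈⟨ +-assoc _ _ _ ⟩
      x + (1# + (- 1# + - y))   ≈⟨ +-congˡ (+-assoc _ _ _) ⟨
      x + ((1# + - 1#) + - y)   ≈⟨ +-congˡ (+-congʳ (-‿inverseʳ 1#)) ⟩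
      x + (0# + - y)            ≈⟨ +-congˡ (+-identityˡ _) ⟩
      x + - y                   ∎

    fromℤ-⊖ : ∀ m n → fromℤ (m ⊖ n) ≈ m ·′ 1# + - (n ·′ 1#)
    fromℤ-⊖ m       zero    = sym (trans (+-congˡ -0#≈0#) (+-identityʳ _))
    fromℤ-⊖ zero    (suc n) = sym (+-identityˡ _)
    fromℤ-⊖ (suc m) (suc n) = begin
      fromℤ (suc m ⊖ suc n)  ≡⟨ ≡.cong fromℤ (ℤ.[1+m]⊖[1+n]≡m⊖n m n) ⟩
      fromℤ (m ⊖ n)          ≈⟨ fromℤ-⊖ m n ⟩
      m ·′ 1# + - (n ·′ 1#)    ≈⟨ cancel-suc _ _ ⟨
      (1# + m ·′ 1#) + - (1# + n ·′ 1#) ≈⟨ +-cong (1+× m 1#) (-‿cong (1+× n 1#)) ⟨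
      suc m ·′ 1# + - (suc n ·′ 1#) ∎

    fromℤ-+ : ∀ i j → fromℤ (i ℤ.+ j) ≈ fromℤ i + fromℤ j
    fromℤ-+ (+ m)    (+ n)    = ×-homo-+ 1# m n
    fromℤ-+ (+ m)    -[1+ n ] = fromℤ-⊖ m (suc n)
    fromℤ-+ -[1+ m ] (+ n)    = trans (fromℤ-⊖ n (suc m)) (+-comm _ _)
    fromℤ-+ -[1+ m ] -[1+ n ] = begin
      - (suc (suc (m ℕ.+ n)) ·′ 1#)        ≡⟨ ≡.cong (λ k → - (suc k ·′ 1#)) (ℕ.+-suc m n) ⟨
      - ((suc m ℕ.+ suc n) ·′ 1#)          ≈⟨ -‿cong (×-homo-+ 1# (suc m) (suc n)) ⟩
      - (suc m ·′ 1# + suc n ·′ 1#)         ≈⟨ -‿+-comm _ _ ⟨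
      - (suc m ·′ 1#) + - (suc n ·′ 1#)     ∎

    fromℤ-neg : ∀ i → fromℤ (ℤ.- i) ≈ - fromℤ i
    fromℤ-neg (+ zero)  = sym -0#≈0#
    fromℤ-neg (+ suc n) = refl
    fromℤ-neg -[1+ n ]  = sym (-‿involutive _)

    fromℤ-neg◃ : ∀ n → fromℤ (Sign.- ℤ.◃ n) ≈ - (n ·′ 1#)
    fromℤ-neg◃ zero    = sym -0#≈0#
    fromℤ-neg◃ (suc n) = refl

    fromℤ-+◃ : ∀ n → fromℤ (Sign.+ ℤ.◃ n) ≈ n ·′ 1#
    fromℤ-+◃ zero    = refl
    fromℤ-+◃ (suc n) = refl

    fromℤ-* : ∀ i j → fromℤ (i ℤ.* j) ≈ fromℤ i * fromℤ j
    fromℤ-* (+ m)    (+ n)    = trans (fromℤ-+◃ (m ℕ.* n)) (×1-homo-* m n)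
    fromℤ-* (+ m)    -[1+ n ] = begin
      fromℤ (Sign.- ℤ.◃ (m ℕ.* suc n)) ≈⟨ fromℤ-neg◃ (m ℕ.* suc n) ⟩
      - ((m ℕ.* suc n) ·′ 1#)           ≈⟨ -‿cong (×1-homo-* m (suc n)) ⟩
      - (m ·′ 1# * (suc n ·′ 1#))        ≈⟨ -‿distribʳ-* _ _ ⟩
      m ·′ 1# * - (suc n ·′ 1#)          ∎
    fromℤ-* -[1+ m ] (+ n)    = begin
      fromℤ (Sign.- ℤ.◃ (suc m ℕ.* n)) ≈⟨ fromℤ-neg◃ (suc m ℕ.* n) ⟩
      - ((suc m ℕ.* n) ·′ 1#)           ≈⟨ -‿cong (×1-homo-* (suc m) n) ⟩
      - (suc m ·′ 1# * (n ·′ 1#))        ≈⟨ -‿distribˡ-* _ _ ⟩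
      - (suc m ·′ 1#) * (n ·′ 1#)        ∎
    fromℤ-* -[1+ m ] -[1+ n ] = begin
      fromℤ (Sign.+ ℤ.◃ (suc m ℕ.* suc n)) ≈⟨ fromℤ-+◃ (suc m ℕ.* suc n) ⟩
      (suc m ℕ.* suc n) ·′ 1#               ≈⟨ ×1-homo-* (suc m) (suc n) ⟩
      suc m ·′ 1# * (suc n ·′ 1#)            ≈⟨ -‿involutive _ ⟨
      - - (suc m ·′ 1# * (suc n ·′ 1#))      ≈⟨ -‿cong (-‿distribʳ-* _ _) ⟩
      - (suc m ·′ 1# * - (suc n ·′ 1#))      ≈⟨ -‿distribˡ-* _ _ ⟩
      - (suc m ·′ 1#) * - (suc n ·′ 1#)      ∎

    fromℤ-homomorphism : ℤ.+-*-rawRing -Raw-AlmostCommutative⟶ fromCommutativeRing R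
    fromℤ-homomorphism = record
      { ⟦_⟧    = fromℤ
      ; +-homo = fromℤ-+
      ; *-homo = fromℤ-*
      ; -‿homo = fromℤ-neg
      ; 0-homo = refl
      ; 1-homo = refl
      }

    fromℤ-≟ : ∀ i j → Maybe (fromℤ i ≈ fromℤ j)
    fromℤ-≟ i j with i ℤ.≟ j
    ... | yes i≡j = just (reflexive (≡.cong fromℤ i≡j))
    ... | no  _   = nothing

  -- Ring solver with integer coefficients, so that x - x is normalised to 0
  -- without deciding equality in R.
  open import Algebra.Solver.Ring ℤ.+-*-rawRing (fromCommutativeRing R)
    fromℤ-homomorphism fromℤ-≟ public
    using (solve; _:=_; _:+_; _:*_; _:-_; :-_; con)


  Unit : Carrier → Set (c ⊔ ℓ)
  Unit x = ∃[ y ] x * y ≈ 1#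

  Regular : Carrier → Set (c ⊔ ℓ)
  Regular x = ∀ y → x * y ≈ 0# → y ≈ 0#

  unit-1 : Unit 1#
  unit-1 = 1# , *-identityˡ 1#

  unit-resp : ∀ {x y} → x ≈ y → Unit x → Unit y
  unit-resp x≈y (z , xz≈1) = z , trans (*-congʳ (sym x≈y)) xz≈1

  unit-* : ∀ {x y} → Unit x → Unit y → Unit (x * y)
  unit-* {x} {y} (x′ , xx′≈1) (y′ , yy′≈1) = x′ * y′ , (begin
    (x * y) * (x′ * y′)  ≈⟨ solve 4 (λ x y x′ y′ → (x :* y) :* (x′ :* y′) := (x :* x′) :* (y :* y′)) refl x y x′ y′ ⟩
    (x * x′) * (y * y′)  ≈⟨ *-cong xx′≈1 yy′≈1 ⟩
    1# * 1#              ≈⟨ *-identityˡ 1# ⟩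
    1#                   ∎)

  unit-factor : ∀ {x y} → Unit (x * y) → Unit x
  unit-factor {x} {y} (z , xyz≈1) = y * z , trans (sym (*-assoc x y z)) xyz≈1

  unit-^ : ∀ {x} n → Unit x → Unit (x ^ n)
  unit-^ zero    u = unit-1
  unit-^ (suc n) u = unit-* u (unit-^ n u)

  unit-neg : ∀ {x} → Unit x → Unit (- x)
  unit-neg {x} (y , xy≈1) = - y ,
    trans (solve 2 (λ x y → (:- x) :* (:- y) := x :* y) refl x y) xy≈1

  unit⇒regular : ∀ {x} → Unit x → Regular x
  unit⇒regular {x} (z , xz≈1) y xy≈0 = begin
    y            ≈⟨ *-identityˡ y ⟨
    1# * y       ≈⟨ *-congʳ xz≈1 ⟨
    (x * z) * y  ≈⟨ solve 3 (λ x z y → (x :* z) :* y := z :* (x :* y)) refl x z y ⟩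
    z * (x * y)  ≈⟨ *-congˡ xy≈0 ⟩
    z * 0#       ≈⟨ zeroʳ z ⟩
    0#           ∎

  unit-cancelˡ : ∀ {x y z} → Unit x → x * y ≈ x * z → y ≈ z
  unit-cancelˡ {x} {y} {z} ux xy≈xz = x∙y⁻¹≈ε⇒x≈y y z (unit⇒regular ux (y - z) (begin
    x * (y - z)    ≈⟨ solve 3 (λ x y z → x :* (y :- z) := x :* y :- x :* z) refl x y z ⟩
    x * y - x * z  ≈⟨ +-congʳ xy≈xz ⟩
    x * z - x * z  ≈⟨ -‿inverseʳ _ ⟩
    0#             ∎))

  1^n≈1 : ∀ n → 1# ^ n ≈ 1#
  1^n≈1 zero    = refl
  1^n≈1 (suc n) = trans (*-identityˡ _) (1^n≈1 n)

  0^n≈0 : ∀ {n} → 1 ≤ n → 0# ^ n ≈ 0#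
  0^n≈0 (s≤s _) = zeroˡ _

  ^-swap : ∀ x m n → (x ^ m) ^ n ≈ (x ^ n) ^ m
  ^-swap x m n = begin
    (x ^ m) ^ n    ≈⟨ ^-assocʳ x m n ⟩
    x ^ (m ℕ.* n)  ≡⟨ ≡.cong (x ^_) (ℕ.*-comm m n) ⟩
    x ^ (n ℕ.* m)  ≈⟨ ^-assocʳ x n m ⟨
    (x ^ n) ^ m    ∎

  -‿square : ∀ x → - x * - x ≈ x * x
  -‿square = solve 1 (λ x → (:- x) :* (:- x) := x :* x) refl

  -- Polynomial functions in Horner form; the leading coefficient l may be zero.
  data HasDegree : ℕ → Carrier → (Carrier → Carrier) → Set (c ⊔ ℓ) where
    constant : ∀ {l f} → (∀ y → f y ≈ l) → HasDegree 0 l f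
    horner   : ∀ {k l f g} a → HasDegree k l g → (∀ y → f y ≈ a + y * g y) →
               HasDegree (suc k) l f

  -- Synthetic division by y - x. The quotient keeps the leading coefficient `l`, so repeated
  -- division ends in the constant `l`.
  divide : ∀ {k l f} → HasDegree (suc k) l f → ∀ x →
           ∃[ g ] HasDegree k l g × (∀ y → f y ≈ (y - x) * g y + f x)
  divide {l = l} {f} (horner {g = g} a (constant g≈l) f≈) x =
    (λ _ → l) , constant (λ _ → refl) , λ y → begin
      f y                        ≈⟨ f≈ y ⟩
      a + y * g y                ≈⟨ +-congˡ (*-congˡ (g≈l y)) ⟩
      a + y * l                  ≈⟨ solve 4 (λ a x y l → a :+ y :* l := (y :- x) :* l :+ (a :+ x :* l)) refl a x y l ⟩
      (y - x) * l + (a + x * l)  ≈⟨ +-congˡ (trans (f≈ x) (+-congˡ (*-congˡ (g≈l x)))) ⟨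
      (y - x) * l + f x          ∎
  divide {f = f} (horner {g = g} a d@(horner _ _ _) f≈) x =
    let (h , dh , g≈) = divide d x in
    (λ y → g x + y * h y) , horner (g x) dh (λ _ → refl) , λ y → begin
      f y                                      ≈⟨ f≈ y ⟩
      a + y * g y                              ≈⟨ +-congˡ (*-congˡ (g≈ y)) ⟩
      a + y * ((y - x) * h y + g x)            ≈⟨ solve 5 (λ a x y h g → a :+ y :* ((y :- x) :* h :+ g)
                                                             := (y :- x) :* (g :+ y :* h) :+ (a :+ x :* g)) refl a x y (h y) (g x) ⟩
      (y - x) * (g x + y * h y) + (a + x * g x)  ≈⟨ +-congˡ (f≈ x) ⟨
      (y - x) * (g x + y * h y) + f x          ∎

  -- Inequality would not do in a ring with zero divisors: splitting off one root leaves the others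
  -- as roots of the quotient only if their differences cancel.
  Separated : ∀ {k} → (Fin k → Carrier) → Set (c ⊔ ℓ)
  Separated ρ = ∀ i j → i ≢ j → Regular (ρ i - ρ j)

  -- Serves twice: to bound the number of roots, and to evaluate the product of the conjugates of x
  -- - w.
  factor-through-roots : ∀ {k l f} → HasDegree k l f → (ρ : Fin k → Carrier) → Separated ρ →
              (∀ i → f (ρ i) ≈ 0#) → ∀ y → f y ≈ l * ∏ (λ i → y - ρ i)
  factor-through-roots {zero}  (constant f≈l) ρ sep root y = trans (f≈l y) (sym (*-identityʳ _))
  factor-through-roots {suc k} {l} {f} d ρ sep root y =
    let (g , dg , f≈) = divide d (ρ zero)
        g-root : ∀ i → g (ρ (suc i)) ≈ 0#
        g-root i = sep (suc i) zero (λ ()) _ (begin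
          (ρ (suc i) - ρ zero) * g (ρ (suc i))               ≈⟨ +-identityʳ _ ⟨
          (ρ (suc i) - ρ zero) * g (ρ (suc i)) + 0#          ≈⟨ +-congˡ (root zero) ⟨
          (ρ (suc i) - ρ zero) * g (ρ (suc i)) + f (ρ zero)  ≈⟨ f≈ (ρ (suc i)) ⟨
          f (ρ (suc i))                                      ≈⟨ root (suc i) ⟩
          0#                                                 ∎)
        sep′ : Separated (ρ ∘ suc)
        sep′ i j i≢j = sep (suc i) (suc j) (λ { ≡.refl → i≢j ≡.refl })
        P = ∏ (λ i → y - ρ (suc i))
    in begin
      f y                               ≈⟨ f≈ y ⟩
      (y - ρ zero) * g y + f (ρ zero)   ≈⟨ +-cong (*-congˡ (factor-through-roots dg (ρ ∘ suc) sep′ g-root y)) (root zero) ⟩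
      (y - ρ zero) * (l * P) + 0#       ≈⟨ +-identityʳ _ ⟩
      (y - ρ zero) * (l * P)            ≈⟨ solve 3 (λ d l P → d :* (l :* P) := l :* (d :* P)) refl (y - ρ zero) l P ⟩
      l * ((y - ρ zero) * P)            ∎

  ∏-regular : ∀ {k} (g : Fin k → Carrier) → (∀ i → Regular (g i)) → Regular (∏ g)
  ∏-regular {zero}  g reg y eq = trans (sym (*-identityˡ y)) eq
  ∏-regular {suc k} g reg y eq =
    ∏-regular (g ∘ suc) (reg ∘ suc) y (reg zero _ (trans (sym (*-assoc _ _ _)) eq))

  too-many-roots : ∀ {k m l f} → HasDegree k l f → k < m → (ρ : Fin m → Carrier) →
                   Separated ρ → (∀ i → f (ρ i) ≈ 0#) → l ≈ 0#
  too-many-roots {k} {suc m} {l} {f} d (s≤s k≤m) ρ sep root =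
    -- Factor `f` through `k` of the roots other than `ρ zero` and evaluate at `ρ zero`: there `l`
    -- times a product of regular differences is zero.
    ∏-regular _ (λ i → sep zero (suc (inject≤ i k≤m)) (λ ())) l (begin
      ∏ (λ i → ρ zero - ρ (suc (inject≤ i k≤m))) * l  ≈⟨ *-comm _ l ⟩
      l * ∏ (λ i → ρ zero - ρ (suc (inject≤ i k≤m)))  ≈⟨ factor-through-roots d (λ i → ρ (suc (inject≤ i k≤m)))
                                                           (λ i j i≢j → sep _ _ λ eq → i≢j (inject≤-injective k≤m k≤m i j (suc-injective eq)))
                                                           (λ i → root _) (ρ zero) ⟨
      f (ρ zero)                                      ≈⟨ root zero ⟩
      0#                                              ∎)

  monomial : ∀ k → HasDegree k 1# (_^ k)
  monomial zero    = constant (λ _ → refl)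
  monomial (suc k) = horner 0# (monomial k) (λ y → sym (+-identityˡ _))

  horner-mul : ∀ k {n l f g} → HasDegree n l f → (∀ y → g y ≈ y ^ k * f y) →
               HasDegree (k ℕ.+ n) l g
  horner-mul zero {f = f} d eq = resp d (λ y → trans (eq y) (*-identityˡ _))
    where
    resp : ∀ {k l f g} → HasDegree k l f → (∀ y → g y ≈ f y) → HasDegree k l g
    resp (constant f≈)   g≈ = constant (λ y → trans (g≈ y) (f≈ y))
    resp (horner a d f≈) g≈ = horner a d (λ y → trans (g≈ y) (f≈ y))
  horner-mul (suc k) d eq = horner 0# (horner-mul k d (λ _ → refl))
    (λ y → trans (eq y) (trans (*-assoc _ _ _) (sym (+-identityˡ _))))

-- Binomial coefficients and the Frobenius map in characteristic p.

prime>1 : ∀ {p} → Prime p → 1 < p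
prime>1 pr = ℕ.nonTrivial⇒n>1 _ {{prime⇒nonTrivial pr}}

prime∣n!⇒p≤n : ∀ {p} → Prime p → ∀ n → p ∣ n ! → p ≤ n
prime∣n!⇒p≤n pr zero    p∣1 = contradiction (ℕ.∣⇒≤ p∣1) (ℕ.<⇒≱ (prime>1 pr))
prime∣n!⇒p≤n pr (suc n) p∣n! with euclidsLemma (suc n) (n !) pr p∣n!
... | inj₁ p∣1+n = ℕ.∣⇒≤ p∣1+n
... | inj₂ p∣n!  = ℕ.m≤n⇒m≤1+n (prime∣n!⇒p≤n pr n p∣n!)

-- In p ! = (p C k) * (k ! * (p ∸ k) !) the prime divides the left side but neither factorial on the
-- right.
prime∣pCk : ∀ {p} → Prime p → ∀ k → 1 ≤ k → k < p → p ∣ p C k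
prime∣pCk {p} pr k 1≤k k<p
  with euclidsLemma (p C k) (k ! ℕ.* (p ∸ k) !) pr (≡.subst (p ∣_) (≡.sym eq) (p∣p! (ℕ.<-trans (s≤s z≤n) (prime>1 pr))))
  where
  instance _ = k ℕ.!* (p ∸ k) !≢0
  eq : (p C k) ℕ.* (k ! ℕ.* (p ∸ k) !) ≡ p !
  eq = ≡.trans (≡.cong (ℕ._* (k ! ℕ.* (p ∸ k) !)) (nCk≡n!/k![n-k]! (ℕ.<⇒≤ k<p)))
               (ℕ.m/n*n≡m (k![n∸k]!∣n! (ℕ.<⇒≤ k<p)))
  p∣p! : ∀ {n} → 0 < n → n ∣ n !
  p∣p! {suc n} _ = ℕ.m∣m*n (n !)
... | inj₁ p∣C = p∣C
... | inj₂ p∣k![p-k]! with euclidsLemma (k !) ((p ∸ k) !) pr p∣k![p-k]!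
...   | inj₁ p∣k!     = contradiction (prime∣n!⇒p≤n pr k p∣k!) (ℕ.<⇒≱ k<p)
...   | inj₂ p∣[p-k]! = contradiction (prime∣n!⇒p≤n pr (p ∸ k) p∣[p-k]!)
                          (ℕ.<⇒≱ (ℕ.∸-monoʳ-< 1≤k (ℕ.<⇒≤ k<p)))

module Frobenius {c ℓ} (R : CommutativeRing c ℓ) where

  open RingTheory R
  open import Algebra.Properties.Semiring.Mult semiring
    using (×-homo-1; ×-assoc-*; ×-congʳ; ×1-homo-*) renaming (_×_ to infixr 8 _·_)
  open import Algebra.Properties.CommutativeMonoid.Sum +-commutativeMonoid
    using (sum; sum-init-last; sum-cong-≋; sum-replicate-zero)
  open import Algebra.Properties.CommutativeSemiring.Binomial commutativeSemiring
    using (binomialTerm; theorem)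
  open import Relation.Binary.Reasoning.Setoid setoid

  n·x≈n·1*x : ∀ n x → n · x ≈ (n · 1#) * x
  n·x≈n·1*x n x = sym (trans (×-assoc-* n 1# x) (×-congʳ n (*-identityˡ x)))

  multiple-of-char : ∀ {p n} → p · 1# ≈ 0# → p ∣ n → ∀ x → n · x ≈ 0#
  multiple-of-char {p} p·1≈0 (divides k ≡.refl) x = begin
    (k ℕ.* p) · x             ≈⟨ n·x≈n·1*x (k ℕ.* p) x ⟩
    (k ℕ.* p) · 1# * x        ≈⟨ *-congʳ (×1-homo-* k p) ⟩
    (k · 1#) * (p · 1#) * x   ≈⟨ *-congʳ (*-congˡ p·1≈0) ⟩
    (k · 1#) * 0# * x         ≈⟨ *-congʳ (zeroʳ _) ⟩
    0# * x                    ≈⟨ zeroˡ x ⟩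
    0#                        ∎

  module _ {p} (pr : Prime p) (p·1≈0 : p · 1# ≈ 0#) where

    ^p-+ : ∀ x y → (x + y) ^ p ≈ x ^ p + y ^ p
    ^p-+ x y = go p ≡.refl
      where
      module _ (m : ℕ) (p≡1+m : p ≡ suc m) where
        t : Fin (suc (suc m)) → Carrier
        t = binomialTerm x y (suc m)

        first : t zero ≈ y ^ suc m
        first = begin
          (suc m C 0) · (1# * y ^ suc m)  ≡⟨ ≡.cong (_· (1# * y ^ suc m)) (≡.trans (nCk≡nC[n∸k] {0} {suc m} z≤n) (nCn≡1 (suc m))) ⟩
          1 · (1# * y ^ suc m)            ≈⟨ ×-homo-1 _ ⟩
          1# * y ^ suc m                  ≈⟨ *-identityˡ _ ⟩
          y ^ suc m                       ∎

        last : t (suc (fromℕ m)) ≈ x ^ suc m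
        last rewrite toℕ-fromℕ m | nCn≡1 (suc m) | ℕ.n∸n≡0 m = trans (×-homo-1 _) (*-identityʳ _)

        middle : ∀ i → t (suc (inject₁ i)) ≈ 0#
        middle i = multiple-of-char p·1≈0 (≡.subst (λ n → p ∣ n C toℕ (suc (inject₁ i))) p≡1+m
          (prime∣pCk pr (suc (toℕ (inject₁ i))) (s≤s z≤n)
            (≡.subst (toℕ (suc (inject₁ i)) <_) (≡.sym p≡1+m) (s≤s (≡.subst (_< m) (≡.sym (toℕ-inject₁ i)) (toℕ<n i)))))) _

      -- The successor comes from an equation instead of matching on `p`, so the hypotheses about
      -- `p` keep their form.
      go : ∀ n → p ≡ n → (x + y) ^ n ≈ x ^ n + y ^ n
      go zero    p≡0   = contradiction (≡.subst (1 <_) p≡0 (prime>1 pr)) λ ()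
      go (suc m) p≡1+m = begin
        (x + y) ^ suc m                             ≈⟨ theorem (suc m) x y ⟩
        t m p≡1+m zero + sum (t m p≡1+m ∘ suc)      ≈⟨ +-cong (first m p≡1+m) (sum-init-last (t m p≡1+m ∘ suc)) ⟩
        y ^ suc m + (sum (t m p≡1+m ∘ suc ∘ inject₁) + t m p≡1+m (suc (fromℕ m)))
          ≈⟨ +-congˡ (+-cong (trans (sum-cong-≋ (middle m p≡1+m)) (sum-replicate-zero m)) (last m p≡1+m)) ⟩
        y ^ suc m + (0# + x ^ suc m)                ≈⟨ +-congˡ (+-identityˡ _) ⟩
        y ^ suc m + x ^ suc m                       ≈⟨ +-comm _ _ ⟩
        x ^ suc m + y ^ suc m                       ∎

    ^p^k-+ : ∀ k x y → (x + y) ^ (p ℕ.^ k) ≈ x ^ (p ℕ.^ k) + y ^ (p ℕ.^ k)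
    ^p^k-+ zero    x y = trans (*-identityʳ _) (sym (+-cong (*-identityʳ _) (*-identityʳ _)))
    ^p^k-+ (suc k) x y = begin
      (x + y) ^ (p ℕ.* p ℕ.^ k)                          ≈⟨ ^-assocʳ (x + y) p (p ℕ.^ k) ⟨
      ((x + y) ^ p) ^ (p ℕ.^ k)                          ≈⟨ ^-congˡ (p ℕ.^ k) (^p-+ x y) ⟩
      (x ^ p + y ^ p) ^ (p ℕ.^ k)                        ≈⟨ ^p^k-+ k _ _ ⟩
      (x ^ p) ^ (p ℕ.^ k) + (y ^ p) ^ (p ℕ.^ k)          ≈⟨ +-cong (^-assocʳ x p (p ℕ.^ k)) (^-assocʳ y p (p ℕ.^ k)) ⟩
      x ^ (p ℕ.* p ℕ.^ k) + y ^ (p ℕ.* p ℕ.^ k)          ∎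

-- Finite fields: Fermat's theorem and Euler's criterion.

module FieldTheory {c ℓ₁ ℓ₂} (F : DiscreteField c ℓ₁ ℓ₂) where

  open DiscreteField F public
    using (_#_; _#?_; #⇒invertible; invertible⇒#; tight; commutativeRing; _⁻¹; _/_; IsPower)
  open RingTheory commutativeRing public
  open import Relation.Binary.Reasoning.Setoid setoid

  infix 4 _≟_

  #⇒≉ : ∀ {x y} → x # y → ¬ x ≈ y
  #⇒≉ x#y x≈y = proj₂ (tight _ _) x≈y x#y

  ≉⇒# : ∀ {x y} → ¬ x ≈ y → x # y
  ≉⇒# {x} {y} x≉y with x #? y
  ... | yes x#y = x#y
  ... | no ¬x#y = contradiction (proj₁ (tight _ _) ¬x#y) x≉y

  _≟_ : Decidable _≈_
  x ≟ y with x #? y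
  ... | yes x#y = no (#⇒≉ x#y)
  ... | no ¬x#y = yes (proj₁ (tight _ _) ¬x#y)

  x-0≈x : ∀ x → x - 0# ≈ x
  x-0≈x x = trans (+-congˡ -0#≈0#) (+-identityʳ x)

  ≉⇒unit : ∀ {x} → ¬ x ≈ 0# → Unit x
  ≉⇒unit {x} x≉0 =
    let (y , _ , xy≈1) = #⇒invertible (≉⇒# x≉0) in y , trans (*-congʳ (sym (x-0≈x x))) xy≈1

  1≉0 : ¬ 1# ≈ 0#
  1≉0 = #⇒≉ (invertible⇒# (1# , trans (*-identityˡ _) (x-0≈x 1#) , trans (*-identityʳ _) (x-0≈x 1#)))

  unit⇒≉ : ∀ {x} → Unit x → ¬ x ≈ 0#
  unit⇒≉ (y , xy≈1) x≈0 = 1≉0 (trans (sym xy≈1) (trans (*-congʳ x≈0) (zeroˡ y)))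

  ⁻¹-inverseʳ : ∀ {x} → ¬ x ≈ 0# → x * x ⁻¹ ≈ 1#
  ⁻¹-inverseʳ {x} x≉0 with x #? 0#
  ... | yes x#0 = trans (*-congʳ (sym (x-0≈x x))) (proj₂ (proj₂ (#⇒invertible x#0)))
  ... | no ¬x#0 = contradiction (≉⇒# x≉0) ¬x#0

  IsPower-resp : ∀ {m x y} → x ≈ y → IsPower m x → IsPower m y
  IsPower-resp x≈y (z , x≈z^m) = z , trans (sym x≈y) x≈z^m

  IsPower-* : ∀ {m x y} → IsPower m x → IsPower m y → IsPower m (x * y)
  IsPower-* {m} (x′ , x≈) (y′ , y≈) = x′ * y′ , trans (*-cong x≈ y≈) (sym (^-distrib-* x′ y′ m))

  IsPower-∣ : ∀ {m x} k → IsPower (m ℕ.* k) x → IsPower m x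
  IsPower-∣ {m} k (y , x≈) = y ^ k , trans x≈ (trans (reflexive (≡.cong (y ^_) (ℕ.*-comm m k))) (sym (^-assocʳ y k m)))

  IsPower-cancel : ∀ {m x y} → Unit y → IsPower m (x * y ^ m) → IsPower m x
  IsPower-cancel {m} {x} {y} (y′ , yy′≈1) pow = IsPower-resp {m} (begin
    (x * y ^ m) * y′ ^ m  ≈⟨ *-assoc _ _ _ ⟩
    x * (y ^ m * y′ ^ m)  ≈⟨ *-congˡ (^-distrib-* y y′ m) ⟨
    x * (y * y′) ^ m      ≈⟨ *-congˡ (^-congˡ m yy′≈1) ⟩
    x * 1# ^ m            ≈⟨ *-congˡ (1^n≈1 m) ⟩
    x * 1#                ≈⟨ *-identityʳ x ⟩
    x                     ∎) (IsPower-* {m} pow (y′ , refl))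

  separated : ∀ {k} (ρ : Fin k → Carrier) → (∀ i j → ρ i ≈ ρ j → i ≡ j) → Separated ρ
  separated ρ inj i j i≢j = unit⇒regular (≉⇒unit (λ eq → i≢j (inj i j (x∙y⁻¹≈ε⇒x≈y _ _ eq))))

module FiniteField {c ℓ₁ ℓ₂} (F : DiscreteField c ℓ₁ ℓ₂) {q} (order : DiscreteField.HasOrder F q) where

  open FieldTheory F public
  open import Algebra.Properties.Semiring.Mult semiring
    using (×-homo-1; ×1-homo-*) renaming (_×_ to infixr 8 _·_)
  import Algebra.Properties.CommutativeMonoid.Sum as Sum
  open Sum +-commutativeMonoid using (sum; sum-permute; sum-cong-≋; ∑-distrib-+; sum-replicate)
  module Prod = Sum *-commutativeMonoid
  open import Relation.Binary.Reasoning.Setoid setoid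

  elem : Fin q → Carrier
  elem = Inverse.from order

  index : Carrier → Fin q
  index = Inverse.to order

  elem-index : ∀ x → elem (index x) ≈ x
  elem-index x = Inverse.inverseʳ order ≡.refl

  index-elem : ∀ i → index (elem i) ≡ i
  index-elem i = Inverse.inverseˡ order refl

  elem-injective : ∀ i j → elem i ≈ elem j → i ≡ j
  elem-injective i j eq = ≡.trans (≡.sym (index-elem i)) (≡.trans (Inverse.to-cong order eq) (index-elem j))

  permute : (f g : Carrier → Carrier) → (∀ {x y} → x ≈ y → f x ≈ f y) → (∀ {x y} → x ≈ y → g x ≈ g y) →
            (∀ x → f (g x) ≈ x) → (∀ x → g (f x) ≈ x) → Permutation q q
  permute f g f-cong g-cong fg gf = permutation (index ∘ f ∘ elem) (index ∘ g ∘ elem)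
    (λ i → ≡.trans (Inverse.to-cong order (trans (f-cong (elem-index _)) (fg _))) (index-elem i))
    (λ i → ≡.trans (Inverse.to-cong order (trans (g-cong (elem-index _)) (gf _))) (index-elem i))

  -- Translation by 1 permutes the field, so the sum s of all elements equals s + q · 1.
  q·1≈0 : q · 1# ≈ 0#
  q·1≈0 = begin
    q · 1#                                      ≈⟨ solve 2 (λ s t → t := (s :+ t) :- s) refl s (q · 1#) ⟩
    (s + q · 1#) - s                            ≈⟨ +-congʳ (+-congˡ (sum-replicate q)) ⟨
    (s + sum {q} (replicate q 1#)) - s          ≈⟨ +-congʳ (∑-distrib-+ {q} elem (replicate q 1#)) ⟨
    sum {q} (λ i → elem i + 1#) - s             ≈⟨ +-congʳ (sum-cong-≋ {q} (λ i → elem-index _)) ⟨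
    sum {q} (λ i → elem (index (elem i + 1#))) - s ≈⟨ +-congʳ (sum-permute elem translation) ⟨
    s - s                                       ≈⟨ -‿inverseʳ s ⟩
    0#                                          ∎
    where
    s = sum {q} elem
    translation = permute (_+ 1#) (_- 1#) +-congʳ +-congʳ
      (λ x → solve 2 (λ x y → (x :- y) :+ y := x) refl x 1#)
      (λ x → solve 2 (λ x y → (x :+ y) :- y := x) refl x 1#)

  -- Otherwise p · 1 would be a unit, and with it (p · 1) ^ k = q · 1, which is zero.
  characteristic : ∀ {p} k → q ≡ p ℕ.^ k → p · 1# ≈ 0#
  characteristic {p} k q≡p^k with (p · 1#) ≟ 0#
  ... | yes p·1≈0 = p·1≈0
  ... | no  p·1≉0 = contradiction
    (trans (sym (trans (reflexive (≡.cong (_· 1#) q≡p^k)) (lemma k))) q·1≈0)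
    (unit⇒≉ (unit-^ k (≉⇒unit p·1≉0)))
    where
    lemma : ∀ k → (p ℕ.^ k) · 1# ≈ (p · 1#) ^ k
    lemma zero    = ×-homo-1 1#
    lemma (suc k) = trans (×1-homo-* p (p ℕ.^ k)) (*-congˡ (lemma k))

  private
    -- Lets a product over the nonzero elements run over all of `Fin q`, where permutations act:
    -- zero contributes the factor `u`, which is 1.
    pad : Carrier → Carrier → Carrier
    pad u x with x ≟ 0#
    ... | yes _ = u
    ... | no  _ = x

    pad-cong : ∀ {u x y} → x ≈ y → pad u x ≈ pad u y
    pad-cong {u} {x} {y} x≈y with x ≟ 0# | y ≟ 0#
    ... | yes _   | yes _   = refl
    ... | no  _   | no  _   = x≈y
    ... | yes x≈0 | no  y≉0 = contradiction (trans (sym x≈y) x≈0) y≉0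
    ... | no  x≉0 | yes y≈0 = contradiction (trans x≈y y≈0) x≉0

    pad-unit : ∀ x → Unit (pad 1# x)
    pad-unit x with x ≟ 0#
    ... | yes _   = unit-1
    ... | no  x≉0 = ≉⇒unit x≉0

    at-0 : Carrier → Carrier → Carrier
    at-0 u x with x ≟ 0#
    ... | yes _ = u
    ... | no  _ = 1#

    ∏-unit : ∀ {n} (g : Fin n → Carrier) → (∀ i → Unit (g i)) → Unit (∏ g)
    ∏-unit {zero}  g u = unit-1
    ∏-unit {suc n} g u = unit-* (u zero) (∏-unit (g ∘ suc) (u ∘ suc))

    at-0-≉ : ∀ {u x} → ¬ x ≈ 0# → at-0 u x ≈ 1#
    at-0-≉ {u} {x} x≉0 with x ≟ 0#
    ... | yes x≈0 = contradiction x≈0 x≉0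
    ... | no  _   = refl

    at-0-≈ : ∀ {u x} → x ≈ 0# → at-0 u x ≈ u
    at-0-≈ {u} {x} x≈0 with x ≟ 0#
    ... | yes _   = refl
    ... | no  x≉0 = contradiction x≈0 x≉0

    ∏-single : ∀ {n} (g : Fin n → Carrier) i → (∀ j → j ≢ i → g j ≈ 1#) → ∏ g ≈ g i
    ∏-single {suc n} g zero    h = trans (*-congˡ (trans (Prod.sum-cong-≋ {n} (λ j → h (suc j) λ ())) (Prod.sum-replicate-zero n))) (*-identityʳ _)
    ∏-single {suc n} g (suc i) h = trans (*-cong (h zero λ ()) (∏-single (g ∘ suc) i (λ j j≢i → h (suc j) λ { ≡.refl → j≢i ≡.refl }))) (*-identityˡ _)

    ∏-at-0 : ∀ u → ∏ {q} (λ i → at-0 u (elem i)) ≈ u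
    ∏-at-0 u = trans (∏-single _ (index 0#) (λ j j≢ → at-0-≉ (λ ej≈0 → j≢
        (≡.trans (≡.sym (index-elem j)) (Inverse.to-cong order ej≈0)))))
      (at-0-≈ (elem-index 0#))

    -- Multiplication by u permutes the nonzero elements; the factor u at 0 is
    -- made up for on the left.
    pad-scale : ∀ {u} → ¬ u ≈ 0# → ∀ x → at-0 u x * pad 1# (u * x) ≈ u * pad 1# x
    pad-scale {u} u≉0 x with x ≟ 0# | (u * x) ≟ 0#
    ... | yes _   | yes _    = refl
    ... | no  _   | no  _    = *-identityˡ _
    ... | yes x≈0 | no ux≉0  = contradiction (trans (*-congˡ x≈0) (zeroʳ u)) ux≉0
    ... | no  x≉0 | yes ux≈0 = contradiction (unit⇒regular (≉⇒unit u≉0) x ux≈0) x≉0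

  -- For nonzero `x`, scaling by `x` preserves the product P of the nonzero elements. Counting one
  -- more factor `x` at the element 0 gives x P = x ^ q P, and P is a unit.
  fermat : ∀ x → x ^ q ≈ x
  fermat x with x ≟ 0#
  ... | yes x≈0 = trans (^-congˡ q x≈0) (trans (0^n≈0 (nonempty (index 0#))) (sym x≈0))
    where
    nonempty : ∀ {n} → Fin n → 1 ≤ n
    nonempty {suc n} _ = s≤s z≤n
  ... | no  x≉0 = sym (unit-cancelˡ (∏-unit _ (λ i → pad-unit (elem i))) (begin
    P * x                                                              ≈⟨ *-comm P x ⟩
    x * P                                                              ≈⟨ *-cong (∏-at-0 x) (∏-permuted) ⟨
    ∏ {q} (λ i → at-0 x (elem i)) * ∏ {q} (λ i → pad 1# (x * elem i))  ≈⟨ Prod.∑-distrib-+ {q} _ _ ⟨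
    ∏ {q} (λ i → at-0 x (elem i) * pad 1# (x * elem i))                ≈⟨ Prod.sum-cong-≋ {q} (λ i → pad-scale x≉0 (elem i)) ⟩
    ∏ {q} (λ i → x * pad 1# (elem i))                                  ≈⟨ Prod.∑-distrib-+ {q} _ _ ⟩
    ∏ {q} (replicate q x) * P                                          ≈⟨ *-congʳ (Prod.sum-replicate q) ⟩
    x ^ q * P                                                          ≈⟨ *-comm _ _ ⟩
    P * x ^ q                                                          ∎))
    where
    P = ∏ {q} (λ i → pad 1# (elem i))
    x⁻¹ = proj₁ (≉⇒unit x≉0)
    xx⁻¹≈1 = proj₂ (≉⇒unit x≉0)
    scaling = permute (x *_) (x⁻¹ *_) *-congˡ *-congˡ
      (λ y → trans (sym (*-assoc _ _ _)) (trans (*-congʳ xx⁻¹≈1) (*-identityˡ y)))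
      (λ y → trans (sym (*-assoc _ _ _)) (trans (*-congʳ (trans (*-comm _ _) xx⁻¹≈1)) (*-identityˡ y)))
    ∏-permuted : ∏ {q} (λ i → pad 1# (x * elem i)) ≈ P
    ∏-permuted = trans (Prod.sum-cong-≋ {q} (λ i → pad-cong (sym (elem-index _))))
                       (sym (Prod.sum-permute {q} (λ i → pad 1# (elem i)) scaling))

  fermat-unit : ∀ {m} → q ≡ suc m → ∀ {x} → Unit x → x ^ m ≈ 1#
  fermat-unit {m} q≡1+m {x} ux = unit-cancelˡ ux
    (trans (trans (reflexive (≡.cong (x ^_) (≡.sym q≡1+m))) (fermat x)) (sym (*-identityʳ x)))

  private
    -- The sum of the z ^ i n ^ (k - i), that is, (z ^ (k + 1) - n ^ (k + 1)) / (z - n) in Horner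
    -- form in `z`.
    geometric : Carrier → ℕ → Carrier → Carrier
    geometric n zero    z = 1#
    geometric n (suc k) z = n ^ suc k + z * geometric n k z

    geometric-identity : ∀ n k z → (z - n) * geometric n k z ≈ z ^ suc k - n ^ suc k
    geometric-identity n zero    z = solve 3 (λ z n o → (z :- n) :* o := z :* o :- n :* o) refl z n 1#
    geometric-identity n (suc k) z = begin
      (z - n) * (n ^ suc k + z * g)                ≈⟨ solve 4 (λ z n p g → (z :- n) :* (p :+ z :* g) := (z :- n) :* p :+ z :* ((z :- n) :* g)) refl z n (n ^ suc k) g ⟩
      (z - n) * n ^ suc k + z * ((z - n) * g)      ≈⟨ +-congˡ (*-congˡ (geometric-identity n k z)) ⟩
      (z - n) * n ^ suc k + z * (z ^ suc k - n ^ suc k) ≈⟨ solve 4 (λ z n p g → (z :- n) :* p :+ z :* (g :- p) := z :* g :- n :* p) refl z n (n ^ suc k) (z ^ suc k) ⟩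
      z * z ^ suc k - n * n ^ suc k                ∎
      where g = geometric n k z

    add-constant : ∀ {k l f g} a → HasDegree (suc k) l f → (∀ y → g y ≈ a + f y) → HasDegree (suc k) l g
    add-constant a (horner b d f≈) g≈ = horner (a + b) d (λ y → trans (g≈ y) (trans (+-congˡ (f≈ y)) (sym (+-assoc _ _ _))))

    geometric-degree : ∀ n r k → HasDegree (k ℕ.* suc r) 1# (λ y → geometric n k (y ^ suc r))
    geometric-degree n r zero    = constant (λ _ → refl)
    geometric-degree n r (suc k) = add-constant (n ^ suc k) (horner-mul (suc r) (geometric-degree n r k) (λ _ → refl)) (λ _ → refl)

  -- If n were no r-th power, y * geometric n (s - 1) (y ^ r) would vanish on the
  -- whole field, although its degree is q - r.
  euler-criterion : ∀ {r s} → 1 ≤ r → 1 ≤ s → q ≡ suc (s ℕ.* r) → ∀ {n} → n ^ s ≈ 1# → ¬ ¬ IsPower r n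
  euler-criterion {suc r} {suc s} _ _ q≡ {n} n^s≈1 nonpower = 1≉0 (too-many-roots
    (horner 0# (geometric-degree n r s) (λ y → sym (+-identityˡ _)))
    (≡.subst (suc (s ℕ.* suc r) <_) (≡.sym q≡) (s≤s (s≤s (ℕ.m≤n+m _ _)))) elem (separated elem elem-injective) (root ∘ elem))
    where
    root : ∀ y → y * geometric n s (y ^ suc r) ≈ 0#
    root y with y ≟ 0#
    ... | yes y≈0 = trans (*-congʳ y≈0) (zeroˡ _)
    ... | no  y≉0 = trans (*-congˡ (unit⇒regular (≉⇒unit z-n≉0) _ (begin
        (z - n) * geometric n s z  ≈⟨ geometric-identity n s z ⟩
        z ^ suc s - n ^ suc s      ≈⟨ +-cong z^s≈1 (-‿cong n^s≈1) ⟩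
        1# - 1#                    ≈⟨ -‿inverseʳ 1# ⟩
        0#                         ∎))) (zeroʳ y)
      where
      z = y ^ suc r
      z-n≉0 : ¬ z - n ≈ 0#
      z-n≉0 eq = nonpower (y , sym (x∙y⁻¹≈ε⇒x≈y _ _ eq))
      z^s≈1 : z ^ suc s ≈ 1#
      z^s≈1 = trans (^-swap y (suc r) (suc s)) (trans (^-assocʳ y (suc s) (suc r)) (fermat-unit q≡ (≉⇒unit y≉0)))

-- Geometric sums as exponents, and orders of elements.

-- 1 + Q + ... + Q ^ (r - 1), the exponent of the norm in an extension of degree `r` of a field with
-- `Q` elements.
geom : ℕ → ℕ → ℕ
geom Q zero    = 0
geom Q (suc r) = suc (Q ℕ.* geom Q r)

geom>0 : ∀ Q {r} → 1 ≤ r → 1 ≤ geom Q r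
geom>0 Q (s≤s _) = s≤s z≤n

geom-+ : ∀ Q m n → geom Q (m ℕ.+ n) ≡ geom Q m ℕ.+ Q ℕ.^ m ℕ.* geom Q n
geom-+ Q zero    n = ≡.sym (ℕ.*-identityˡ _)
geom-+ Q (suc m) n = ≡.cong suc (≡.trans (≡.cong (Q ℕ.*_) (geom-+ Q m n))
  (+-*-Solver.solve 4 (λ Q g p h → Q :* (g :+ p :* h) := Q :* g :+ Q :* p :* h) ≡.refl Q (geom Q m) (Q ℕ.^ m) (geom Q n)))
  where open +-*-Solver

-- Transitivity of the norm on the level of exponents: first down by degree `r` over Q ^ D, then by
-- degree `D` over `Q`.
geom-* : ∀ Q r D → geom Q (r ℕ.* D) ≡ geom (Q ℕ.^ D) r ℕ.* geom Q D
geom-* Q zero    D = ≡.refl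
geom-* Q (suc r) D = ≡.trans (geom-+ Q D (r ℕ.* D)) (≡.trans (≡.cong (λ x → geom Q D ℕ.+ Q ℕ.^ D ℕ.* x) (geom-* Q r D))
  (+-*-Solver.solve 3 (λ g P h → g :+ P :* (h :* g) := (con 1 :+ P :* h) :* g) ≡.refl (geom Q D) (Q ℕ.^ D) (geom (Q ℕ.^ D) r)))
  where open +-*-Solver

^≡1+geom : ∀ m r → suc m ℕ.^ r ≡ suc (m ℕ.* geom (suc m) r)
^≡1+geom m zero    = ≡.cong suc (≡.sym (ℕ.*-zeroʳ m))
^≡1+geom m (suc r) = ≡.trans (≡.cong (suc m ℕ.*_) (^≡1+geom m r))
  (+-*-Solver.solve 2 (λ m g → (con 1 :+ m) :* (con 1 :+ m :* g) := con 1 :+ m :* (con 1 :+ (con 1 :+ m) :* g)) ≡.refl m (geom (suc m) r))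
  where open +-*-Solver

geom-≡-mod : ∀ m r → ∃[ k ] geom (suc m) r ≡ r ℕ.+ m ℕ.* k
geom-≡-mod m zero    = 0 , ≡.sym (ℕ.*-zeroʳ m)
geom-≡-mod m (suc r) with geom-≡-mod m r
... | k , eq = k ℕ.+ (r ℕ.+ m ℕ.* k) , ≡.cong suc (≡.trans (≡.cong (λ g → g ℕ.+ m ℕ.* g) eq)
  (+-*-Solver.solve 3 (λ r m k → r :+ m :* k :+ m :* (r :+ m :* k) := r :+ m :* (k :+ (r :+ m :* k))) ≡.refl r m k))
  where open +-*-Solver

-- Lifting the exponent. If (1 + m) ^ P = 1 + x with x divisible by P m, then (1 + x) ^ r = 1 + x *
-- geom (1 + x) r. The geometric sum is r modulo x, and r divides m and hence x, so one more factor
-- r is gained.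
radical-order : ∀ {m rs} → All (_∣ m) rs → ∃[ k ] suc m ℕ.^ product rs ≡ suc (product rs ℕ.* m ℕ.* k)
radical-order {m} [] = 1 , ≡.cong suc (+-*-Solver.solve 1 (λ m → m :* con 1 := (con 1 :* m) :* con 1) ≡.refl m)
  where open +-*-Solver
radical-order {m} {r ∷ rs} (divides i m≡ir ∷ rs∣m) with radical-order rs∣m
... | k , eq with geom-≡-mod (product rs ℕ.* m ℕ.* k) r
-- With m = i r the geometric sum is r + P m k l = r (1 + P i k l); its cofactor goes into the new
-- witness.
...   | l , geom≡ = k ℕ.* (1 ℕ.+ product rs ℕ.* i ℕ.* k ℕ.* l) , (begin
  suc m ℕ.^ (r ℕ.* P)                     ≡⟨ ≡.cong (suc m ℕ.^_) (ℕ.*-comm r P) ⟩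
  suc m ℕ.^ (P ℕ.* r)                     ≡⟨ ℕ.^-*-assoc (suc m) P r ⟨
  (suc m ℕ.^ P) ℕ.^ r                     ≡⟨ ≡.cong (ℕ._^ r) eq ⟩
  suc (P ℕ.* m ℕ.* k) ℕ.^ r               ≡⟨ ^≡1+geom (P ℕ.* m ℕ.* k) r ⟩
  suc (P ℕ.* m ℕ.* k ℕ.* geom (suc (P ℕ.* m ℕ.* k)) r) ≡⟨ ≡.cong (λ g → suc (P ℕ.* m ℕ.* k ℕ.* g)) geom≡ ⟩
  suc (P ℕ.* m ℕ.* k ℕ.* (r ℕ.+ P ℕ.* m ℕ.* k ℕ.* l))  ≡⟨ ≡.cong (λ x → suc (P ℕ.* m ℕ.* k ℕ.* (r ℕ.+ P ℕ.* x ℕ.* k ℕ.* l))) m≡ir ⟩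
  suc (P ℕ.* m ℕ.* k ℕ.* (r ℕ.+ P ℕ.* (i ℕ.* r) ℕ.* k ℕ.* l))
    ≡⟨ ≡.cong suc (+-*-Solver.solve 6 (λ P m k r i l → P :* m :* k :* (r :+ P :* (i :* r) :* k :* l) := (r :* P) :* m :* (k :* (con 1 :+ P :* i :* k :* l))) ≡.refl P m k r i l) ⟩
  suc (r ℕ.* P ℕ.* m ℕ.* (k ℕ.* (1 ℕ.+ P ℕ.* i ℕ.* k ℕ.* l)))    ∎)
  where
  open +-*-Solver
  open ≡-Reasoning
  P = product rs

prime∤⇒coprime : ∀ {r j} → Prime r → ¬ r ∣ j → Coprime j r
prime∤⇒coprime pr r∤j (i∣j , i∣r) with prime⇒irreducible pr i∣r
... | inj₁ i≡1    = i≡1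
... | inj₂ ≡.refl = contradiction i∣j r∤j

module PowerLemmas {c ℓ} (R : CommutativeRing c ℓ) where

  open RingTheory R
  open import Relation.Binary.Reasoning.Setoid setoid

  ^-≡1 : ∀ {x m} k → x ^ m ≈ 1# → x ^ (m ℕ.* k) ≈ 1#
  ^-≡1 {x} {m} k x^m≈1 = trans (sym (^-assocʳ x m k)) (trans (^-congˡ k x^m≈1) (1^n≈1 k))

  coprime-orders : ∀ {x m n} → Coprime m n → x ^ m ≈ 1# → x ^ n ≈ 1# → x ≈ 1#
  coprime-orders {x} {m} {n} cop x^m≈1 x^n≈1 with coprime-Bézout cop
  ... | Bézout.+- i j 1+jn≡im = begin
    x                     ≈⟨ *-identityʳ x ⟨
    x * 1#                ≈⟨ *-congˡ (^-≡1 {x} {n} j x^n≈1) ⟨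
    x * x ^ (n ℕ.* j)     ≡⟨ ≡.cong (x ^_) (≡.trans (≡.cong suc (ℕ.*-comm n j)) (≡.trans 1+jn≡im (ℕ.*-comm i m))) ⟩
    x ^ (m ℕ.* i)         ≈⟨ ^-≡1 {x} {m} i x^m≈1 ⟩
    1#                    ∎
  ... | Bézout.-+ i j 1+im≡jn = begin
    x                     ≈⟨ *-identityʳ x ⟨
    x * 1#                ≈⟨ *-congˡ (^-≡1 {x} {m} i x^m≈1) ⟨
    x * x ^ (m ℕ.* i)     ≡⟨ ≡.cong (x ^_) (≡.trans (≡.cong suc (ℕ.*-comm m i)) (≡.trans 1+im≡jn (ℕ.*-comm j n))) ⟩
    x ^ (n ℕ.* j)         ≈⟨ ^-≡1 {x} {n} j x^n≈1 ⟩
    1#                    ∎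

  difference-of-powers : ∀ n x y → ∃[ z ] x ^ n - y ^ n ≈ (x - y) * z
  difference-of-powers zero    x y = 0# , trans (-‿inverseʳ 1#) (sym (zeroʳ _))
  difference-of-powers (suc n) x y =
    let (z , eq) = difference-of-powers n x y in
    x ^ n + y * z , (begin
      x * x ^ n - y * y ^ n                 ≈⟨ solve 4 (λ x y X Y → x :* X :- y :* Y := (x :- y) :* X :+ y :* (X :- Y)) refl x y (x ^ n) (y ^ n) ⟩
      (x - y) * x ^ n + y * (x ^ n - y ^ n) ≈⟨ +-congˡ (*-congˡ eq) ⟩
      (x - y) * x ^ n + y * ((x - y) * z)   ≈⟨ solve 4 (λ x y X z → (x :- y) :* X :+ y :* ((x :- y) :* z) := (x :- y) :* (X :+ y :* z)) refl x y (x ^ n) z ⟩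
      (x - y) * (x ^ n + y * z)             ∎)

  unit-root : ∀ {x n} → 1 ≤ n → Unit (x ^ n) → Unit x
  unit-root (s≤s _) u = unit-factor u

  -- What makes this power a norm: for `Q` a power of q, the factors are the iterates of Frobenius
  -- at `x`.
  ^-geom : ∀ x Q r → x ^ geom Q r ≈ ∏ {r} (λ i → x ^ (Q ℕ.^ toℕ i))
  ^-geom x Q zero    = refl
  ^-geom x Q (suc r) = *-cong (sym (*-identityʳ x)) (begin
    x ^ (Q ℕ.* geom Q r)                        ≈⟨ ^-assocʳ x Q (geom Q r) ⟨
    (x ^ Q) ^ geom Q r                          ≈⟨ ^-geom (x ^ Q) Q r ⟩
    ∏ {r} (λ i → (x ^ Q) ^ (Q ℕ.^ toℕ i))        ≈⟨ ∏-cong {r} (λ i → ^-assocʳ x Q _) ⟩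
    ∏ {r} (λ i → x ^ (Q ℕ.^ toℕ (suc i)))        ∎)
    where open import Algebra.Properties.CommutativeMonoid.Sum *-commutativeMonoid using () renaming (sum-cong-≋ to ∏-cong)

  NoZeroDivisors : Set (c ⊔ ℓ)
  NoZeroDivisors = ∀ u v → u * v ≈ 0# → u ≈ 0# ⊎ v ≈ 0#

  power-zero : NoZeroDivisors → ∀ n x → x ^ n ≈ 0# → x ≈ 0# ⊎ 1# ≈ 0#
  power-zero nzd zero    x 1≈0 = inj₂ 1≈0
  power-zero nzd (suc n) x eq with nzd x (x ^ n) eq
  ... | inj₁ x≈0 = inj₁ x≈0
  ... | inj₂ eq′ = power-zero nzd n x eq′

  -- If x ^ e is nonzero, cancelling it gives x ^ (e M) = 1, and e M divides Q ^ e - 1. If x ^ e is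
  -- zero, so is `x`.
  root-fixed : NoZeroDivisors → ¬ 1# ≈ 0# → ∀ x {Q M e k} → Q ≡ suc M → Q ℕ.^ e ≡ suc (e ℕ.* M ℕ.* k) →
               (x ^ e) ^ Q ≈ x ^ e → x ^ (Q ℕ.^ e) ≈ x
  root-fixed nzd 1≉0 x {Q} {M} {e} {k} ≡.refl Q^e≡ fixed with nzd (x ^ e) ((x ^ e) ^ M - 1#) (begin
      x ^ e * ((x ^ e) ^ M - 1#)         ≈⟨ solve 3 (λ w v o → w :* (v :- o) := w :* v :- w :* o) refl (x ^ e) ((x ^ e) ^ M) 1# ⟩
      (x ^ e) ^ suc M - x ^ e * 1#       ≈⟨ +-cong fixed (-‿cong (*-identityʳ (x ^ e))) ⟩
      x ^ e - x ^ e                      ≈⟨ -‿inverseʳ (x ^ e) ⟩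
      0#                                 ∎)
  ... | inj₂ eq = begin
      x ^ (suc M ℕ.^ e)                  ≡⟨ ≡.cong (x ^_) (≡.trans Q^e≡ (≡.cong suc (ℕ.*-assoc e M k))) ⟩
      x * x ^ (e ℕ.* (M ℕ.* k))          ≈⟨ *-congˡ {x} (trans (sym (^-assocʳ x e (M ℕ.* k))) (sym (^-assocʳ (x ^ e) M k))) ⟩
      x * ((x ^ e) ^ M) ^ k              ≈⟨ *-congˡ {x} (^-congˡ k (x∙y⁻¹≈ε⇒x≈y ((x ^ e) ^ M) 1# eq)) ⟩
      x * 1# ^ k                         ≈⟨ *-congˡ {x} (1^n≈1 k) ⟩
      x * 1#                             ≈⟨ *-identityʳ x ⟩
      x                                  ∎
  ... | inj₁ x^e≈0 with power-zero nzd e x x^e≈0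
  ...   | inj₁ x≈0 = trans (^-congˡ (suc M ℕ.^ e) x≈0) (trans (0^n≈0 (≡.subst (1 ≤_) (≡.sym Q^e≡) (s≤s z≤n))) (sym x≈0))
  ...   | inj₂ 1≈0 = contradiction 1≈0 1≉0

  artin-schreier : ∀ {n} → 2 ≤ n → HasDegree n 1# (λ y → y ^ n - y)
  artin-schreier {suc (suc n)} _ = horner 0# (horner (- 1#) (monomial n) (λ _ → refl))
    (λ y → trans (+-congˡ (-‿cong (sym (*-identityʳ y)))) (solve 3 (λ y z o → y :* (y :* z) :- y :* o := con (+ 0) :+ y :* ((:- o) :+ y :* z)) refl y (y ^ n) 1#))
  artin-schreier {suc zero} (s≤s ())

-- Frobenius conjugates and norms in a ring over the finite field.

module Extension
  {c ℓ₁ ℓ₂} (F : DiscreteField c ℓ₁ ℓ₂) {q} (order : DiscreteField.HasOrder F q) (q-pp : IsPrimePower q)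
  {c′ ℓ′} (R : CommutativeRing c′ ℓ′) (ι : DiscreteField.Carrier F → CommutativeRing.Carrier R)
  (ι-hom : IsRingHomomorphism (CommutativeRing.rawRing (DiscreteField.commutativeRing F)) (CommutativeRing.rawRing R) ι)
  where

  module K = FiniteField F order
  module KP = PowerLemmas K.commutativeRing
  open RingTheory R
  open PowerLemmas R
  open Frobenius R using (^p^k-+)
  open import Algebra.Properties.Semiring.Mult semiring using () renaming (_×_ to infixr 8 _·_)
  open import Algebra.Properties.CommutativeMonoid.Sum *-commutativeMonoid using () renaming (sum-cong-≋ to ∏-cong)
  open import Algebra.Properties.Semiring.Mult K.semiring using () renaming (_×_ to infixr 8 _·ᴷ_)
  open import Relation.Binary.Reasoning.Setoid setoid
  open IsRingHomomorphism ι-hom public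
    using () renaming (⟦⟧-cong to ι-cong; +-homo to ι-+; *-homo to ι-*; 0#-homo to ι-0; 1#-homo to ι-1; -‿homo to ι-neg)

  private
    p k : ℕ
    p = proj₁ q-pp
    k = proj₁ (proj₂ q-pp)
    q≡p^k : q ≡ p ℕ.^ k
    q≡p^k = proj₂ (proj₂ (proj₂ (proj₂ q-pp)))
    p-prime : Prime p
    p-prime = proj₁ (proj₂ (proj₂ q-pp))

  q^n>0 : ∀ n → 1 ≤ q ℕ.^ n
  q^n>0 n = ≡.subst (λ x → 1 ≤ x ℕ.^ n) (≡.sym q≡p^k) (ℕ.m^n>0 (p ℕ.^ k) {{ℕ.>-nonZero (ℕ.m^n>0 p {{ℕ.>-nonZero (ℕ.<-trans (s≤s z≤n) (prime>1 p-prime))}} k)}} n)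

  ι-· : ∀ n → ι (n ·ᴷ K.1#) ≈ n · 1#
  ι-· zero    = ι-0
  ι-· (suc n) = trans (ι-+ _ _) (+-cong ι-1 (ι-· n))

  ι-^ : ∀ x n → ι (x K.^ n) ≈ ι x ^ n
  ι-^ x zero    = ι-1
  ι-^ x (suc n) = trans (ι-* _ _) (*-congˡ (ι-^ x n))

  ι-sub : ∀ x y → ι (x K.- y) ≈ ι x - ι y
  ι-sub x y = trans (ι-+ _ _) (+-congˡ (ι-neg y))

  ι-unit : ∀ {x} → K.Unit x → Unit (ι x)
  ι-unit (y , xy≈1) = ι y , trans (sym (ι-* _ _)) (trans (ι-cong xy≈1) ι-1)

  frobenius-+ : ∀ n x y → (x + y) ^ (q ℕ.^ n) ≈ x ^ (q ℕ.^ n) + y ^ (q ℕ.^ n)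
  frobenius-+ n x y = ≡.subst (λ Q → (x + y) ^ Q ≈ x ^ Q + y ^ Q)
    (≡.sym (≡.trans (≡.cong (ℕ._^ n) q≡p^k) (ℕ.^-*-assoc p k n)))
    (^p^k-+ p-prime (trans (sym (ι-· p)) (trans (ι-cong (K.characteristic k q≡p^k)) ι-0)) (k ℕ.* n) x y)

  -- Obtained from additivity, as q ^ n may be even.
  frobenius-neg : ∀ n x → (- x) ^ (q ℕ.^ n) ≈ - (x ^ (q ℕ.^ n))
  frobenius-neg n x = begin
    (- x) ^ Q                      ≈⟨ solve 2 (λ x y → y := (x :+ y) :- x) refl (x ^ Q) ((- x) ^ Q) ⟩
    (x ^ Q + (- x) ^ Q) - x ^ Q    ≈⟨ +-congʳ (frobenius-+ n x (- x)) ⟨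
    (x - x) ^ Q - x ^ Q            ≈⟨ +-congʳ (trans (^-congˡ Q (-‿inverseʳ x)) (0^n≈0 (q^n>0 n))) ⟩
    0# - x ^ Q                     ≈⟨ +-identityˡ _ ⟩
    - (x ^ Q)                      ∎
    where Q = q ℕ.^ n

  frobenius-sub : ∀ n x y → (x - y) ^ (q ℕ.^ n) ≈ x ^ (q ℕ.^ n) - y ^ (q ℕ.^ n)
  frobenius-sub n x y = trans (frobenius-+ n x (- y)) (+-congˡ (frobenius-neg n y))

  frobeniusᴷ : ∀ n x → x K.^ (q ℕ.^ n) K.≈ x
  frobeniusᴷ zero    x = K.*-identityʳ x
  frobeniusᴷ (suc n) x = K.trans (K.sym (K.^-assocʳ x q (q ℕ.^ n))) (K.trans (K.^-congˡ (q ℕ.^ n) (K.fermat x)) (frobeniusᴷ n x))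

  frobenius-ι : ∀ n x → ι x ^ (q ℕ.^ n) ≈ ι x
  frobenius-ι n x = trans (sym (ι-^ x (q ℕ.^ n))) (ι-cong (frobeniusᴷ n x))

  -- Frobenius fixes scalars, so all `D` factors of the norm coincide.
  norm-scalar : ∀ x D → x K.^ geom q D K.≈ x K.^ D
  norm-scalar x zero    = K.refl
  norm-scalar x (suc D) = K.*-congˡ (K.trans (K.sym (K.^-assocʳ x q (geom q D))) (K.trans (K.^-congˡ (geom q D) (K.fermat x)) (norm-scalar x D)))

  -- t has exactly D conjugates under Frobenius, and G is the characteristic
  -- function of t: the norm of c - t is the product of its D conjugates.
  record HasConjugates (t : Carrier) (D : ℕ) (G : K.Carrier → K.Carrier) : Set (c ⊔ ℓ₁ ⊔ c′ ⊔ ℓ′) where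
    field
      D>0      : 1 ≤ D
      G-cong   : ∀ {x y} → x K.≈ y → G x K.≈ G y
      periodic : t ^ (q ℕ.^ D) ≈ t
      distinct : ∀ n → ¬ D ∣ n → Unit (t ^ (q ℕ.^ n) - t)
      norm     : ∀ c → (ι c - t) ^ geom q D ≈ ι (G c)

  open HasConjugates

  conjugates-resp : ∀ {t t′ D D′ G G′} → t ≈ t′ → D ≡ D′ → (∀ x → G x K.≈ G′ x) →
                    HasConjugates t D G → HasConjugates t′ D′ G′
  conjugates-resp {D = D} t≈t′ ≡.refl G≈G′ h = record
    { D>0      = D>0 h
    ; G-cong   = λ x≈y → K.trans (K.sym (G≈G′ _)) (K.trans (G-cong h x≈y) (G≈G′ _))
    ; periodic = trans (^-congˡ (q ℕ.^ D) (sym t≈t′)) (trans (periodic h) t≈t′)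
    ; distinct = λ n D∤n → unit-resp (+-cong (^-congˡ (q ℕ.^ n) t≈t′) (-‿cong t≈t′)) (distinct h n D∤n)
    ; norm     = λ c → trans (^-congˡ (geom q D) (+-congˡ (-‿cong (sym t≈t′)))) (trans (norm h c) (ι-cong (G≈G′ c)))
    }

  rational-conjugates : ∀ β → HasConjugates (ι β) 1 (λ x → x K.- β)
  rational-conjugates β = record
    { D>0      = s≤s z≤n
    ; G-cong   = K.+-congʳ
    ; periodic = frobenius-ι 1 β
    ; distinct = λ n 1∤n → contradiction (ℕ.1∣ n) 1∤n
    ; norm     = λ c → begin
        (ι c - ι β) ^ suc (q ℕ.* 0)   ≡⟨ ≡.cong (λ n → (ι c - ι β) ^ suc n) (ℕ.*-zeroʳ q) ⟩
        (ι c - ι β) * 1#              ≈⟨ *-identityʳ _ ⟩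
        ι c - ι β                     ≈⟨ ι-sub c β ⟨
        ι (c K.- β)                   ∎
    }

  -- The part common to both directions: how Frobenius moves an r-th root `w` of (t - c) / a.
  -- Whether ζ is primitive or 1 depends on `N` and is settled separately.
  module Radical {r s} (q≡ : q ≡ suc (s ℕ.* r)) {a b} (ab≈1 : a K.* b K.≈ K.1#) {c : K.Carrier}
    {t w D G} (t≈ : t ≈ ι a * w ^ r + ι c) (h : HasConjugates t D G) where

    Q g : ℕ
    Q = q ℕ.^ D
    g = geom q D

    -- `G` yields the norm of c - t and not of t - c; the base `- b` corrects the sign, so `N` is
    -- the norm of w ^ r = (t - c) / a.
    N ζ : K.Carrier
    N = (K.- b) K.^ D K.* G c
    ζ = N K.^ s

    ba≈1 : ι b * ι a ≈ 1#
    ba≈1 = trans (sym (ι-* b a)) (trans (ι-cong (K.trans (K.*-comm b a) ab≈1)) ι-1)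

    w^r≈ : w ^ r ≈ ι (K.- b) * (ι c - t)
    w^r≈ = sym (begin
      ι (K.- b) * (ι c - t)                        ≈⟨ *-cong (ι-neg b) (+-congˡ (-‿cong t≈)) ⟩
      - ι b * (ι c - (ι a * w ^ r + ι c))          ≈⟨ solve 4 (λ a b c w → (:- b) :* (c :- (a :* w :+ c)) := (b :* a) :* w) refl (ι a) (ι b) (ι c) (w ^ r) ⟩
      (ι b * ι a) * w ^ r                          ≈⟨ *-congʳ ba≈1 ⟩
      1# * w ^ r                                   ≈⟨ *-identityˡ _ ⟩
      w ^ r                                        ∎)

    norm-w^r : (w ^ r) ^ g ≈ ι N
    norm-w^r = begin
      (w ^ r) ^ g                              ≈⟨ ^-congˡ g w^r≈ ⟩
      (ι (K.- b) * (ι c - t)) ^ g              ≈⟨ ^-distrib-* _ _ g ⟩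
      ι (K.- b) ^ g * (ι c - t) ^ g            ≈⟨ *-cong (sym (ι-^ (K.- b) g)) (norm h c) ⟩
      ι ((K.- b) K.^ g) * ι (G c)              ≈⟨ *-congʳ (ι-cong (norm-scalar (K.- b) D)) ⟩
      ι ((K.- b) K.^ D) * ι (G c)              ≈⟨ ι-* _ _ ⟨
      ι N                                      ∎

    -- Q - 1 = (q - 1) g = r g s, so w ^ (Q - 1) is the s-th power of the norm of w ^ r.
    w^Q≈ : w ^ Q ≈ w * ι ζ
    w^Q≈ = begin
      w ^ Q                              ≡⟨ ≡.cong (w ^_) Q≡ ⟩
      w * w ^ (r ℕ.* (g ℕ.* s))          ≈⟨ *-congˡ (^-assocʳ w r (g ℕ.* s)) ⟨
      w * (w ^ r) ^ (g ℕ.* s)            ≈⟨ *-congˡ (^-assocʳ (w ^ r) g s) ⟨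
      w * ((w ^ r) ^ g) ^ s              ≈⟨ *-congˡ (^-congˡ s norm-w^r) ⟩
      w * ι N ^ s                        ≈⟨ *-congˡ (ι-^ N s) ⟨
      w * ι ζ                            ∎
      where
      open +-*-Solver using () renaming (solve to solveℕ; _:*_ to _⊗_; _:=_ to _⊜_)
      Q≡ : Q ≡ suc (r ℕ.* (g ℕ.* s))
      Q≡ = ≡.trans (≡.cong (ℕ._^ D) q≡) (≡.trans (^≡1+geom (s ℕ.* r) D)
             (≡.cong suc (≡.trans (≡.cong (λ x → (s ℕ.* r) ℕ.* geom x D) (≡.sym q≡))
               (solveℕ 3 (λ r g s → (s ⊗ r) ⊗ g ⊜ r ⊗ (g ⊗ s)) ≡.refl r g s))))

  module RadicalStep {r s} (r-prime : Prime r) (q≡ : q ≡ suc (s ℕ.* r)) (s>0 : 1 ≤ s)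
    {a b} (ab≈1 : a K.* b K.≈ K.1#) {c : K.Carrier}
    {t w D G} (t≈ : t ≈ ι a * w ^ r + ι c) (h : HasConjugates t D G)
    (nonpower : ¬ K.IsPower r ((K.- b) K.^ D K.* G c)) where

    open Radical {r} {s} q≡ {a} {b} ab≈1 {c} {t} {w} {D} {G} t≈ h

    private
      r>0 : 1 ≤ r
      r>0 = ℕ.<-trans (s≤s z≤n) (prime>1 r-prime)

      N-unit : K.Unit N
      -- Zero counts as an r-th power, so a nonpower is invertible.
      N-unit = K.≉⇒unit (λ N≈0 → nonpower (K.0# , K.trans N≈0 (K.sym (K.0^n≈0 r>0))))

      ζ^r≈1 : ζ K.^ r K.≈ K.1#
      ζ^r≈1 = K.trans (K.^-assocʳ N s r) (K.fermat-unit q≡ N-unit)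

      -- Since `r` is prime, ζ ^ j = 1 = ζ ^ r would give ζ = N ^ s = 1, which Euler's criterion
      -- excludes for a nonpower.
      ζ^j≉1 : ∀ {j} → ¬ r ∣ j → ¬ ζ K.^ j K.≈ K.1#
      ζ^j≉1 r∤j ζ^j≈1 = K.euler-criterion r>0 s>0 q≡
        (KP.coprime-orders (prime∤⇒coprime r-prime r∤j) ζ^j≈1 ζ^r≈1) nonpower

      ζ-unit : K.Unit ζ
      ζ-unit = K.unit-^ s N-unit

      w-unit : Unit w
      w-unit = unit-root r>0 (unit-root (geom>0 q (D>0 h)) (unit-resp (sym norm-w^r) (ι-unit N-unit)))

      -- ζ lies in F and is fixed by Frobenius, so each application of y ↦ y ^ Q contributes one
      -- factor ζ.
      w^Q^k≈ : ∀ k → w ^ (Q ℕ.^ k) ≈ w * ι (ζ K.^ k)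
      w^Q^k≈ zero    = *-congˡ (sym ι-1)
      w^Q^k≈ (suc k) = begin
        w ^ (Q ℕ.* Q ℕ.^ k)                       ≈⟨ ^-assocʳ w Q (Q ℕ.^ k) ⟨
        (w ^ Q) ^ (Q ℕ.^ k)                       ≈⟨ ^-congˡ (Q ℕ.^ k) w^Q≈ ⟩
        (w * ι ζ) ^ (Q ℕ.^ k)                     ≈⟨ ^-distrib-* w (ι ζ) (Q ℕ.^ k) ⟩
        w ^ (Q ℕ.^ k) * ι ζ ^ (Q ℕ.^ k)           ≡⟨ ≡.cong (λ n → w ^ (Q ℕ.^ k) * ι ζ ^ n) (ℕ.^-*-assoc q D k) ⟩
        w ^ (Q ℕ.^ k) * ι ζ ^ (q ℕ.^ (D ℕ.* k))   ≈⟨ *-cong (w^Q^k≈ k) (frobenius-ι (D ℕ.* k) ζ) ⟩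
        w * ι (ζ K.^ k) * ι ζ                     ≈⟨ solve 3 (λ w x y → w :* x :* y := w :* (y :* x)) refl w (ι (ζ K.^ k)) (ι ζ) ⟩
        w * (ι ζ * ι (ζ K.^ k))                   ≈⟨ *-congˡ (ι-* _ _) ⟨
        w * ι (ζ K.^ suc k)                       ∎

      ζ-powers-distinct : ∀ {i j} → i < j → j < r → ¬ ζ K.^ i K.≈ ζ K.^ j
      ζ-powers-distinct {i} {j} i<j j<r ζ^i≈ζ^j = ζ^j≉1 r∤j-i (K.unit-cancelˡ (K.unit-^ i ζ-unit)
        (K.trans (K.sym (K.^-homo-* ζ i (j ∸ i))) (K.trans (K.reflexive (≡.cong (ζ K.^_) (ℕ.m+[n∸m]≡n (ℕ.<⇒≤ i<j))))
          (K.trans (K.sym ζ^i≈ζ^j) (K.sym (K.*-identityʳ _))))))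
        where
        r∤j-i : ¬ r ∣ j ∸ i
        r∤j-i r∣j-i = ℕ.<⇒≱ (ℕ.≤-<-trans (ℕ.m∸n≤m j i) j<r)
          (ℕ.∣⇒≤ {{ℕ.>-nonZero (ℕ.m<n⇒0<n∸m i<j)}} r∣j-i)

      ζ-injective : ∀ (i j : Fin r) → ζ K.^ toℕ i K.≈ ζ K.^ toℕ j → i ≡ j
      ζ-injective i j eq with ℕ.<-cmp (toℕ i) (toℕ j)
      ... | tri< i<j _ _ = contradiction eq (ζ-powers-distinct i<j (toℕ<n j))
      ... | tri≈ _ i≡j _ = toℕ-injective i≡j
      ... | tri> _ _ j<i = contradiction (K.sym eq) (ζ-powers-distinct j<i (toℕ<n i))

      -- The conjugates of `w` over `t`, and at the same time the roots of y ^ r - w ^ r.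
      ρ : Fin r → Carrier
      ρ i = w * ι (ζ K.^ toℕ i)

      ρ-separated : Separated ρ
      ρ-separated i j i≢j = unit⇒regular (unit-resp
        (trans (*-congˡ (ι-sub _ _)) (solve 3 (λ w x y → w :* (x :- y) := w :* x :- w :* y) refl w _ _))
        (unit-* w-unit (ι-unit (K.≉⇒unit λ eq → i≢j (ζ-injective i j (K.x∙y⁻¹≈ε⇒x≈y _ _ eq))))))

      ρ-root : ∀ i → ρ i ^ r - w ^ r ≈ 0#
      ρ-root i = trans (+-congʳ (begin
        (w * ι (ζ K.^ toℕ i)) ^ r        ≈⟨ ^-distrib-* _ _ r ⟩
        w ^ r * ι (ζ K.^ toℕ i) ^ r      ≈⟨ *-congˡ (ι-^ _ r) ⟨
        w ^ r * ι ((ζ K.^ toℕ i) K.^ r)  ≈⟨ *-congˡ (ι-cong (K.trans (K.^-swap ζ (toℕ i) r) (K.trans (K.^-congˡ (toℕ i) ζ^r≈1) (K.1^n≈1 (toℕ i))))) ⟩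
        w ^ r * ι K.1#                   ≈⟨ *-congˡ ι-1 ⟩
        w ^ r * 1#                       ≈⟨ *-identityʳ _ ⟩
        w ^ r                            ∎)) (-‿inverseʳ _)

      radical-degree : ∀ {n} v → 1 ≤ n → HasDegree n 1# (λ y → y ^ n - v)
      radical-degree {suc n} v _ = horner (- v) (monomial n) (λ y → +-comm _ _)

      -- The relative norm of x - w: the conjugates ζ ^ i w are separated roots of y ^ r - w ^ r,
      -- and as many as its degree, so the product of the x - ζ ^ i w is this polynomial at x.
      norm-to-w^r : ∀ x → (ι x - w) ^ geom Q r ≈ ι x ^ r - w ^ r
      norm-to-w^r x = begin
        (ι x - w) ^ geom Q r                          ≈⟨ ^-geom (ι x - w) Q r ⟩
        ∏ {r} (λ i → (ι x - w) ^ (Q ℕ.^ toℕ i))       ≈⟨ ∏-cong {r} (λ i → conjugate (toℕ i)) ⟩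
        ∏ {r} (λ i → ι x - ρ i)                       ≈⟨ *-identityˡ _ ⟨
        1# * ∏ {r} (λ i → ι x - ρ i)                  ≈⟨ factor-through-roots (radical-degree (w ^ r) r>0) ρ ρ-separated ρ-root (ι x) ⟨
        ι x ^ r - w ^ r                               ∎
        where
        conjugate : ∀ k → (ι x - w) ^ (Q ℕ.^ k) ≈ ι x - w * ι (ζ K.^ k)
        conjugate k = begin
          (ι x - w) ^ (Q ℕ.^ k)                                   ≡⟨ ≡.cong ((ι x - w) ^_) (ℕ.^-*-assoc q D k) ⟩
          (ι x - w) ^ (q ℕ.^ (D ℕ.* k))                           ≈⟨ frobenius-sub (D ℕ.* k) _ _ ⟩
          ι x ^ (q ℕ.^ (D ℕ.* k)) - w ^ (q ℕ.^ (D ℕ.* k))         ≈⟨ +-cong (frobenius-ι (D ℕ.* k) x) (-‿cong (reflexive (≡.cong (w ^_) (≡.sym (ℕ.^-*-assoc q D k))))) ⟩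
          ι x - w ^ (Q ℕ.^ k)                                     ≈⟨ +-congˡ (-‿cong (w^Q^k≈ k)) ⟩
          ι x - w * ι (ζ K.^ k)                                   ∎

      -- w ^ P - w divides a ((w ^ P) ^ r - w ^ r) = t ^ P - t, and divisors of units are units.
      distinct-t⇒w : ∀ n → Unit (t ^ (q ℕ.^ n) - t) → Unit (w ^ (q ℕ.^ n) - w)
      distinct-t⇒w n u =
        let (z , eq) = difference-of-powers r (w ^ P) w in
        unit-factor (unit-resp (begin
          t ^ P - t                                          ≈⟨ +-cong (^-congˡ P t≈) (-‿cong t≈) ⟩
          (ι a * w ^ r + ι c) ^ P - (ι a * w ^ r + ι c)      ≈⟨ +-congʳ (frobenius-+ n _ _) ⟩
          (ι a * w ^ r) ^ P + ι c ^ P - (ι a * w ^ r + ι c)  ≈⟨ +-congʳ (+-cong (trans (^-distrib-* _ _ P) (*-cong (frobenius-ι n a) (^-swap w r P))) (frobenius-ι n c)) ⟩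
          ι a * (w ^ P) ^ r + ι c - (ι a * w ^ r + ι c)      ≈⟨ solve 4 (λ a x y c → a :* x :+ c :- (a :* y :+ c) := a :* (x :- y)) refl (ι a) ((w ^ P) ^ r) (w ^ r) (ι c) ⟩
          ι a * ((w ^ P) ^ r - w ^ r)                        ≈⟨ *-congˡ eq ⟩
          ι a * ((w ^ P - w) * z)                            ≈⟨ solve 3 (λ a x z → a :* (x :* z) := x :* (a :* z)) refl (ι a) (w ^ P - w) z ⟩
          (w ^ P - w) * (ι a * z)                            ∎) u)
        where P = q ℕ.^ n

      -- Outside the multiples of `D` already `t` is moved. At n = j D the difference is w (ζ ^ j -
      -- 1), a unit because `r` does not divide j.
      distinct-w : ∀ n → ¬ r ℕ.* D ∣ n → Unit (w ^ (q ℕ.^ n) - w)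
      distinct-w n rD∤n with D ∣? n
      ... | no  D∤n = distinct-t⇒w n (distinct h n D∤n)
      ... | yes (divides j ≡.refl) = unit-resp (begin
          w * ι (ζ K.^ j K.- K.1#)             ≈⟨ *-congˡ (trans (ι-sub _ _) (+-congˡ (-‿cong ι-1))) ⟩
          w * (ι (ζ K.^ j) - 1#)               ≈⟨ solve 3 (λ w x o → w :* (x :- o) := w :* x :- w :* o) refl w _ 1# ⟩
          w * ι (ζ K.^ j) - w * 1#             ≈⟨ +-cong (sym (w^Q^k≈ j)) (-‿cong (*-identityʳ w)) ⟩
          w ^ (Q ℕ.^ j) - w                    ≡⟨ ≡.cong (λ n → w ^ n - w) (≡.trans (ℕ.^-*-assoc q D j) (≡.cong (q ℕ.^_) (ℕ.*-comm D j))) ⟩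
          w ^ (q ℕ.^ (j ℕ.* D)) - w            ∎)
        (unit-* w-unit (ι-unit (K.≉⇒unit λ eq →
          ζ^j≉1 {j} (λ { (divides i ≡.refl) → rD∤n (divides i (ℕ.*-assoc i r D)) }) (K.x∙y⁻¹≈ε⇒x≈y _ _ eq))))

    -- The norm is taken in two stages: the relative norm x ^ r - w ^ r equals b (a x ^ r + c - t),
    -- and `G` supplies the norm of the last factor.
    conjugates : HasConjugates w (r ℕ.* D) (λ x → b K.^ D K.* G (a K.* x K.^ r K.+ c))
    conjugates = record
      { D>0      = ℕ.*-mono-≤ r>0 (D>0 h)
      ; G-cong   = λ x≈y → K.*-congˡ (G-cong h (K.+-congʳ (K.*-congˡ (K.^-congˡ r x≈y))))
      ; periodic = begin
          w ^ (q ℕ.^ (r ℕ.* D))   ≡⟨ ≡.cong (w ^_) (≡.trans (≡.cong (q ℕ.^_) (ℕ.*-comm r D)) (≡.sym (ℕ.^-*-assoc q D r))) ⟩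
          w ^ (Q ℕ.^ r)           ≈⟨ w^Q^k≈ r ⟩
          w * ι (ζ K.^ r)         ≈⟨ *-congˡ (trans (ι-cong ζ^r≈1) ι-1) ⟩
          w * 1#                  ≈⟨ *-identityʳ w ⟩
          w                       ∎
      ; distinct = distinct-w
      ; norm     = λ x → begin
          (ι x - w) ^ geom q (r ℕ.* D)                 ≡⟨ ≡.cong ((ι x - w) ^_) (geom-* q r D) ⟩
          (ι x - w) ^ (geom Q r ℕ.* g)                 ≈⟨ ^-assocʳ (ι x - w) (geom Q r) g ⟨
          ((ι x - w) ^ geom Q r) ^ g                   ≈⟨ ^-congˡ g (norm-to-w^r x) ⟩
          (ι x ^ r - w ^ r) ^ g                        ≈⟨ ^-congˡ g (lemma x) ⟩
          (ι b * (ι (a K.* x K.^ r K.+ c) - t)) ^ g    ≈⟨ ^-distrib-* _ _ g ⟩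
          ι b ^ g * (ι (a K.* x K.^ r K.+ c) - t) ^ g  ≈⟨ *-cong (trans (sym (ι-^ b g)) (ι-cong (norm-scalar b D))) (norm h _) ⟩
          ι (b K.^ D) * ι (G (a K.* x K.^ r K.+ c))    ≈⟨ ι-* _ _ ⟨
          ι (b K.^ D K.* G (a K.* x K.^ r K.+ c))      ∎
      }
      where
      lemma : ∀ x → ι x ^ r - w ^ r ≈ ι b * (ι (a K.* x K.^ r K.+ c) - t)
      lemma x = sym (begin
        ι b * (ι (a K.* x K.^ r K.+ c) - t)                           ≈⟨ *-congˡ (+-cong (trans (ι-+ _ _) (+-congʳ (trans (ι-* _ _) (*-congˡ (ι-^ x r))))) (-‿cong t≈)) ⟩
        ι b * (ι a * ι x ^ r + ι c - (ι a * w ^ r + ι c))             ≈⟨ solve 5 (λ a b c x w → b :* (a :* x :+ c :- (a :* w :+ c)) := (b :* a) :* (x :- w)) refl (ι a) (ι b) (ι c) (ι x ^ r) (w ^ r) ⟩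
        (ι b * ι a) * (ι x ^ r - w ^ r)                               ≈⟨ *-congʳ ba≈1 ⟩
        1# * (ι x ^ r - w ^ r)                                        ≈⟨ *-identityˡ _ ⟩
        ι x ^ r - w ^ r                                               ∎)

-- Signs and r-th power classes of the norms.

2∣n⊎2∣1+n : ∀ n → 2 ∣ n ⊎ 2 ∣ suc n
2∣n⊎2∣1+n zero    = inj₁ (2 ℕ.∣0)
2∣n⊎2∣1+n (suc n) with 2∣n⊎2∣1+n n
... | inj₁ 2∣n   = inj₂ (ℕ.∣m∣n⇒∣m+n (ℕ.∣-refl {2}) 2∣n)
... | inj₂ 2∣1+n = inj₁ 2∣1+n

module PowerClasses {c ℓ₁ ℓ₂} (F : DiscreteField c ℓ₁ ℓ₂) where

  open FieldTheory F
  open PowerLemmas commutativeRing using (^-≡1)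
  open import Relation.Binary.Reasoning.Setoid setoid

  [-1]^2≈1 : (- 1#) ^ 2 ≈ 1#
  [-1]^2≈1 = trans (*-congˡ (*-identityʳ _)) (trans (-‿square 1#) (*-identityˡ 1#))

  -1-power-even : ∀ {n} → 2 ∣ n → (- 1#) ^ n ≈ 1#
  -1-power-even (divides k ≡.refl) = trans (^-congʳ (- 1#) (ℕ.*-comm k 2)) (^-≡1 {m = 2} k [-1]^2≈1)

  -1-power-odd : ∀ {n} → 2 ∣ suc n → (- 1#) ^ n ≈ - 1#
  -1-power-odd {n} 2∣1+n = begin
    (- 1#) ^ n                        ≈⟨ *-identityˡ _ ⟨
    1# * (- 1#) ^ n                   ≈⟨ *-congʳ [-1]^2≈1 ⟨
    (- 1#) ^ 2 * (- 1#) ^ n           ≈⟨ *-congʳ (*-congˡ (*-identityʳ _)) ⟩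
    (- 1# * - 1#) * (- 1#) ^ n        ≈⟨ *-assoc _ _ _ ⟩
    - 1# * (- 1#) ^ suc n             ≈⟨ *-congˡ (-1-power-even 2∣1+n) ⟩
    - 1# * 1#                         ≈⟨ *-identityʳ _ ⟩
    - 1#                              ∎

  neg-^ : ∀ x n → (- x) ^ n ≈ (- 1#) ^ n * x ^ n
  neg-^ x n = trans (^-congˡ n (sym (-1*x≈-x x))) (^-distrib-* _ _ n)

  -- For odd r′, -1 is its own r′-th power. For r′ = 2 and odd `r` the exponent is even. If both are
  -- even, 4 divides r P, and then -1 is a square up to double negation.
  -1-nonpower : ∀ {r r′ P} → Prime r′ → r′ ∣ P → (4 ∣ r ℕ.* P → ¬ ¬ IsPower 2 (- 1#)) →
                ∀ D → ¬ ¬ IsPower r′ ((- 1#) ^ (D ℕ.* suc r))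
  -1-nonpower {r} {r′} pr′ r′∣P h D with 2∣n⊎2∣1+n r′
  ... | inj₂ 2∣1+r′ = λ k → k ((- 1#) ^ (D ℕ.* suc r) , sym (trans (^-swap (- 1#) (D ℕ.* suc r) r′) (^-congˡ (D ℕ.* suc r) (-1-power-odd 2∣1+r′))))
  ... | inj₁ 2∣r′ with prime⇒irreducible pr′ 2∣r′
  ...   | inj₂ ≡.refl with 2∣n⊎2∣1+n r
  ...     | inj₂ 2∣1+r = λ k → k (1# , trans (-1-power-even (ℕ.∣n⇒∣m*n D 2∣1+r)) (sym (1^n≈1 2)))
  ...     | inj₁ 2∣r = λ k → h (ℕ.*-pres-∣ 2∣r r′∣P) λ (y , -1≈y²) →
    k (y ^ (D ℕ.* suc r) , trans (^-congˡ (D ℕ.* suc r) -1≈y²) (^-swap y 2 (D ℕ.* suc r)))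

  -- Passing from D to D r conjugates changes the sign of the norm by
  -- (-1) ^ (D (r + 1)), which is a power for every remaining prime r′.
  sign-change : ∀ {r r′ P} → Prime r′ → r′ ∣ P → (4 ∣ r ℕ.* P → ¬ ¬ IsPower 2 (- 1#)) → ∀ D {x} →
                ¬ IsPower r′ ((- 1#) ^ D * x) → ¬ IsPower r′ ((- 1#) ^ (r ℕ.* D) * x)
  sign-change {r} {r′} pr′ r′∣P h D {x} nonpower pow = -1-nonpower {r} pr′ r′∣P h D λ sgn →
    nonpower (IsPower-resp {r′} (begin
      (- 1#) ^ (D ℕ.* suc r) * ((- 1#) ^ (r ℕ.* D) * x)            ≡⟨ ≡.cong (λ n → (- 1#) ^ n * ((- 1#) ^ (r ℕ.* D) * x)) (≡.trans (ℕ.*-suc D r) (≡.cong (D ℕ.+_) (ℕ.*-comm D r))) ⟩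
      (- 1#) ^ (D ℕ.+ r ℕ.* D) * ((- 1#) ^ (r ℕ.* D) * x)          ≈⟨ *-congʳ (^-homo-* (- 1#) D (r ℕ.* D)) ⟩
      ((- 1#) ^ D * (- 1#) ^ (r ℕ.* D)) * ((- 1#) ^ (r ℕ.* D) * x) ≈⟨ solve 3 (λ u v x → (u :* v) :* (v :* x) := u :* x :* (v :* v)) refl _ _ x ⟩
      (- 1#) ^ D * x * ((- 1#) ^ (r ℕ.* D) * (- 1#) ^ (r ℕ.* D))   ≈⟨ *-congˡ (^-distrib-* _ _ (r ℕ.* D)) ⟨
      (- 1#) ^ D * x * (- 1# * - 1#) ^ (r ℕ.* D)                   ≈⟨ *-congˡ (trans (^-congˡ (r ℕ.* D) (trans (-‿square 1#) (*-identityˡ 1#))) (1^n≈1 (r ℕ.* D))) ⟩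
      (- 1#) ^ D * x * 1#                                          ≈⟨ *-identityʳ _ ⟩
      (- 1#) ^ D * x                                               ∎) (IsPower-* {r′} sgn pow))

  module Characteristic (d : ℕ) (a b c β : Carrier) where

    hMap : Carrier → Carrier
    hMap x = a * x ^ d + c

    -- The characteristic function of an n-fold preimage of β under a y ^ d + c.
    charFun : ℕ → Carrier → Carrier
    charFun zero    x = x - β
    charFun (suc n) x = b ^ (d ℕ.^ n) * charFun n (hMap x)

    charFun≈ : ∀ n x → charFun n x ≈ b ^ geom d n * (iterate hMap x n - β)
    charFun≈ zero    x = sym (*-identityˡ _)
    charFun≈ (suc n) x = begin
      b ^ (d ℕ.^ n) * charFun n (hMap x)                                    ≈⟨ *-congˡ (charFun≈ n (hMap x)) ⟩
      b ^ (d ℕ.^ n) * (b ^ geom d n * (iterate hMap (hMap x) n - β))        ≈⟨ *-assoc _ _ _ ⟨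
      b ^ (d ℕ.^ n) * b ^ geom d n * (iterate hMap (hMap x) n - β)          ≈⟨ *-congʳ (^-homo-* b (d ℕ.^ n) (geom d n)) ⟨
      b ^ (d ℕ.^ n ℕ.+ geom d n) * (iterate hMap (hMap x) n - β)            ≡⟨ ≡.cong (λ m → b ^ m * (iterate hMap (hMap x) n - β)) eq ⟩
      b ^ geom d (suc n) * (iterate hMap (hMap x) n - β)                    ∎
      where
      -- `geom` splits off its lowest term, whereas the recursion of `charFun` contributes the
      -- highest one.
      eq : d ℕ.^ n ℕ.+ geom d n ≡ geom d (suc n)
      eq = ≡.trans (ℕ.+-comm (d ℕ.^ n) _) (≡.trans (≡.cong (geom d n ℕ.+_) (≡.sym (≡.trans (≡.cong (λ x → d ℕ.^ n ℕ.* suc x) (ℕ.*-zeroʳ d)) (ℕ.*-identityʳ _))))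
             (≡.trans (≡.sym (geom-+ d n 1)) (≡.cong (geom d) (ℕ.+-comm n 1))))

    -- The norm of (y - c) / a for an n-fold preimage y of β.
    normValue : ℕ → Carrier
    normValue n = (- b) ^ (d ℕ.^ n) * charFun n c

    normValue-0 : normValue 0 ≈ - (c - β) * b
    normValue-0 = solve 4 (λ b c β o → (:- b) :* con (+ 1) :* (c :- β) := (:- (c :- β)) :* b) refl b c β 1#

    -- geom d (n + 1) = 1 + d * geom d n: apart from a single `b`, all exponents of `b` and `- b`
    -- are multiples of `d`, so up to d-th powers the norm is (h ^ (n + 1) (c) - β) / a.
    normValue-suc : ∀ n → normValue (suc n) ≈ ((iterate hMap c (suc n) - β) * b) * ((- b) ^ (d ℕ.^ n) * b ^ geom d n) ^ d
    normValue-suc n = begin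
      (- b) ^ (d ℕ.* d ℕ.^ n) * charFun (suc n) c                            ≈⟨ *-cong (trans (^-congʳ (- b) (ℕ.*-comm d (d ℕ.^ n))) (sym (^-assocʳ (- b) (d ℕ.^ n) d))) (charFun≈ (suc n) c) ⟩
      u ^ d * (b * b ^ (d ℕ.* geom d n) * x)                                 ≈⟨ *-congˡ (*-congʳ (*-congˡ (trans (^-congʳ b (ℕ.*-comm d (geom d n))) (sym (^-assocʳ b (geom d n) d))))) ⟩
      u ^ d * (b * v ^ d * x)                                                ≈⟨ solve 4 (λ U b V x → U :* (b :* V :* x) := (x :* b) :* (U :* V)) refl _ b _ x ⟩
      (x * b) * (u ^ d * v ^ d)                                              ≈⟨ *-congˡ (^-distrib-* u v d) ⟨
      (x * b) * (u * v) ^ d                                                  ∎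
      where
      u = (- b) ^ (d ℕ.^ n)
      v = b ^ geom d n
      x = iterate hMap c (suc n) - β

    normValue-power : Unit b → ∀ {r} → r ∣ d → ∀ n →
      (IsPower r (normValue (suc n)) → IsPower r ((iterate hMap c (suc n) - β) * b)) ×
      (IsPower r ((iterate hMap c (suc n) - β) * b) → IsPower r (normValue (suc n)))
    normValue-power b-unit {r} (divides k ≡.refl) n =
      (λ pow → IsPower-cancel {r} (unit-^ k y-unit) (IsPower-resp {r} (trans (normValue-suc n) (*-congˡ (sym (^-assocʳ y k r)))) pow)) ,
      (λ pow → IsPower-resp {r} (trans (*-congˡ (^-assocʳ y k r)) (sym (normValue-suc n))) (IsPower-* {r} pow (y ^ k , refl)))
      where
      y = (- b) ^ (d ℕ.^ n) * b ^ geom d n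
      y-unit = unit-* (unit-^ (d ℕ.^ n) (unit-neg b-unit)) (unit-^ (geom d n) b-unit)

-- Successive radicals: iterated preimages of β.

module Tower
  {c ℓ₁ ℓ₂} (F : DiscreteField c ℓ₁ ℓ₂) {q} (order : DiscreteField.HasOrder F q) (q-pp : IsPrimePower q)
  {c′ ℓ′} (R : CommutativeRing c′ ℓ′) (ι : DiscreteField.Carrier F → CommutativeRing.Carrier R)
  (ι-hom : IsRingHomomorphism (CommutativeRing.rawRing (DiscreteField.commutativeRing F)) (CommutativeRing.rawRing R) ι)
  where

  open Extension F order q-pp R ι ι-hom
  open RingTheory R
  open PowerLemmas R
  open HasConjugates
  open PowerClasses F
  open import Relation.Binary.Reasoning.Setoid setoid

  -- The congruences of q with the cofactor `s` = (q - 1) / r made explicit; it is the exponent in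
  -- Euler's criterion.
  Kummer : ℕ → Set
  Kummer P = ∀ r → Prime r → r ∣ P → ∃[ s ] (1 ≤ s × q ≡ suc (s ℕ.* r))

  -- Each root is extracted with a = 1 and c = 0, where the norm to test is (-1) ^ D G(0). A step
  -- keeps G(0), as 0 ^ r = 0, and changes only the sign, which `sign-change` absorbs.
  power-tower : ∀ {rs} → All Prime rs → Kummer (product rs) → (4 ∣ product rs → ¬ ¬ K.IsPower 2 (K.- K.1#)) →
    ∀ {t w D G} → t ≈ w ^ product rs → HasConjugates t D G →
    (∀ r → Prime r → r ∣ product rs → ¬ K.IsPower r ((K.- K.1#) K.^ D K.* G K.0#)) →
    HasConjugates w (product rs ℕ.* D) (λ x → G (x K.^ product rs))
  power-tower [] kummer sq t≈ h nonpower =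
    conjugates-resp (trans t≈ (*-identityʳ _)) (≡.sym (ℕ.*-identityˡ _)) (λ x → G-cong h (K.sym (K.*-identityʳ x))) h
  power-tower {r ∷ rs} (r-prime ∷ rs-prime) kummer sq {t} {w} {D} {G} t≈ h nonpower =
    conjugates-resp refl (≡.trans (≡.sym (ℕ.*-assoc (product rs) r D)) (≡.cong (ℕ._* D) (ℕ.*-comm (product rs) r)))
      (λ x → G-cong h (K.trans (K.^-assocʳ x (product rs) r) (K.^-congʳ x (ℕ.*-comm (product rs) r))))
      (power-tower rs-prime (λ r′ pr r′∣ → kummer r′ pr (ℕ.∣n⇒∣m*n r r′∣)) (λ 4∣ → sq (ℕ.∣n⇒∣m*n r 4∣)) refl
        (conjugates-resp refl ≡.refl G′≈ step)
        λ r′ pr r′∣ → sign-change {r} pr r′∣ sq D (λ pow → nonpower r′ pr (ℕ.∣n⇒∣m*n r r′∣)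
          (K.IsPower-resp {r′} (K.*-congˡ (G-cong h (K.0^n≈0 r>0))) pow)))
    where
    r>0 : 1 ≤ r
    r>0 = ℕ.<⇒≤ (prime>1 r-prime)
    s = proj₁ (kummer r r-prime (ℕ.m∣m*n (product rs)))
    s>0 = proj₁ (proj₂ (kummer r r-prime (ℕ.m∣m*n (product rs))))
    q≡ = proj₂ (proj₂ (kummer r r-prime (ℕ.m∣m*n (product rs))))
    t≈′ : t ≈ ι K.1# * (w ^ product rs) ^ r + ι K.0#
    t≈′ = begin
      t                                             ≈⟨ t≈ ⟩
      w ^ (r ℕ.* product rs)                        ≡⟨ ≡.cong (w ^_) (ℕ.*-comm r (product rs)) ⟩
      w ^ (product rs ℕ.* r)                        ≈⟨ ^-assocʳ w (product rs) r ⟨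
      (w ^ product rs) ^ r                          ≈⟨ *-identityˡ _ ⟨
      1# * (w ^ product rs) ^ r                     ≈⟨ +-identityʳ _ ⟨
      1# * (w ^ product rs) ^ r + 0#                ≈⟨ +-cong (*-congʳ ι-1) ι-0 ⟨
      ι K.1# * (w ^ product rs) ^ r + ι K.0#        ∎
    step = RadicalStep.conjugates r-prime q≡ s>0 (K.*-identityˡ K.1#) t≈′ h (nonpower r r-prime (ℕ.m∣m*n (product rs)))
    G′≈ : ∀ x → K.1# K.^ D K.* G (K.1# K.* x K.^ r K.+ K.0#) K.≈ G (x K.^ r)
    G′≈ x = K.trans (K.*-cong (K.1^n≈1 D) (G-cong h (K.trans (K.+-identityʳ _) (K.*-identityˡ _)))) (K.*-identityˡ _)

  -- Only the first prime root involves the affine map a y + c; the remaining factor of `d` is a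
  -- pure power, left to `power-tower`.
  radical : ∀ {d} → 2 ≤ d → Kummer d → (4 ∣ d → ¬ ¬ K.IsPower 2 (K.- K.1#)) →
    ∀ {a b c} → a K.* b K.≈ K.1# → ∀ {t w D G} → t ≈ ι a * w ^ d + ι c → HasConjugates t D G →
    (∀ r → Prime r → r ∣ d → ¬ K.IsPower r ((K.- b) K.^ D K.* G c)) →
    HasConjugates w (d ℕ.* D) (λ x → b K.^ D K.* G (a K.* x K.^ d K.+ c))
  radical {d} 2≤d kummer sq {a} {b} {c} ab≈1 {t} {w} {D} {G} t≈ h nonpower
    with factorise d {{ℕ.>-nonZero (ℕ.<⇒≤ 2≤d)}}
  ... | record { factors = []     ; isFactorisation = ≡.refl } = contradiction 2≤d λ { (s≤s ()) }
  ... | record { factors = r ∷ rs ; isFactorisation = ≡.refl ; factorsPrime = r-prime ∷ rs-prime } =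
    conjugates-resp refl (≡.trans (≡.sym (ℕ.*-assoc (product rs) r D)) (≡.cong (ℕ._* D) (ℕ.*-comm (product rs) r)))
      (λ x → K.*-congˡ (G-cong h (K.+-congʳ (K.*-congˡ (K.trans (K.^-assocʳ x (product rs) r) (K.^-congʳ x (ℕ.*-comm (product rs) r)))))))
      (power-tower rs-prime (λ r′ pr r′∣ → kummer r′ pr (ℕ.∣n⇒∣m*n r r′∣)) (λ 4∣ → sq (ℕ.∣n⇒∣m*n r 4∣)) refl
        step λ r′ pr r′∣ → sign-change {r} pr r′∣ sq D (λ pow → nonpower r′ pr (ℕ.∣n⇒∣m*n r r′∣)
          (K.IsPower-resp {r′} norm≈ pow)))
    where
    r>0 : 1 ≤ r
    r>0 = ℕ.<⇒≤ (prime>1 r-prime)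
    s = proj₁ (kummer r r-prime (ℕ.m∣m*n (product rs)))
    s>0 = proj₁ (proj₂ (kummer r r-prime (ℕ.m∣m*n (product rs))))
    q≡ = proj₂ (proj₂ (kummer r r-prime (ℕ.m∣m*n (product rs))))
    t≈′ : t ≈ ι a * (w ^ product rs) ^ r + ι c
    t≈′ = trans t≈ (+-congʳ (*-congˡ (trans (^-congʳ w (ℕ.*-comm r (product rs))) (sym (^-assocʳ w (product rs) r)))))
    step = RadicalStep.conjugates r-prime q≡ s>0 ab≈1 t≈′ h (nonpower r r-prime (ℕ.m∣m*n (product rs)))
    -- Why one norm serves all primes of `d`: (-1) ^ D b ^ D = (- b) ^ D, and the new characteristic
    -- function at 0 involves G(c).
    norm≈ : (K.- K.1#) K.^ D K.* (b K.^ D K.* G (a K.* K.0# K.^ r K.+ c)) K.≈ (K.- b) K.^ D K.* G c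
    norm≈ = K.trans (K.sym (K.*-assoc _ _ _)) (K.*-cong (K.sym (neg-^ b D)) (G-cong h
      (K.trans (K.+-congʳ (K.trans (K.*-congˡ (K.0^n≈0 r>0)) (K.zeroʳ a))) (K.+-identityˡ c))))

  module _ {d} (2≤d : 2 ≤ d) (kummer : Kummer d) (sq : 4 ∣ d → ¬ ¬ K.IsPower 2 (K.- K.1#))
    {a b} (ab≈1 : a K.* b K.≈ K.1#) (c β : K.Carrier) where

    open Characteristic d a b c β

    hMapᴿ : Carrier → Carrier
    hMapᴿ y = ι a * y ^ d + ι c

    -- `iterate` applies the map to its argument first, so `hMapᴿ y` is an n-fold preimage and `y`
    -- arises from it by one d-th root.
    preimage-conjugates : ∀ n → (∀ m → m < n → ∀ r → Prime r → r ∣ d → ¬ K.IsPower r (normValue m)) →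
      ∀ y → iterate hMapᴿ y n ≈ ι β → HasConjugates y (d ℕ.^ n) (charFun n)
    preimage-conjugates zero    nonpower y eq =
      conjugates-resp (sym eq) ≡.refl (λ _ → K.refl) (rational-conjugates β)
    preimage-conjugates (suc n) nonpower y eq =
      radical 2≤d kummer sq ab≈1 refl
        (preimage-conjugates n (λ m m<n → nonpower m (ℕ.m<n⇒m<1+n m<n)) (hMapᴿ y) eq)
        (nonpower n ℕ.≤-refl)

    -- If the m-th norm is an r-th power, an (m + 1)-fold preimage y has y ^ (d / r)
    -- fixed by the same power of Frobenius as the m-fold preimage, and its period
    -- grows by a factor of at most d / r instead of d.
    preimage-period : NoZeroDivisors → ¬ 1# ≈ 0# →
      ∀ {m} → (∀ i → i < m → ∀ r → Prime r → r ∣ d → ¬ K.IsPower r (normValue i)) →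
      ∀ {r e} → Prime r → d ≡ e ℕ.* r → K.IsPower r (normValue m) →
      ∀ y → iterate hMapᴿ y (suc m) ≈ ι β → y ^ (q ℕ.^ (d ℕ.^ m ℕ.* e)) ≈ y
    preimage-period nzd 1≉0 {m} nonpower {r} {e} r-prime d≡er (v , N≈v^r) y eq =
      trans (^-congʳ y (≡.sym (ℕ.^-*-assoc q D e))) (root-fixed nzd 1≉0 y {e = e} Q≡ (proj₂ order-e) w^Q≈w)
      where
      D M : ℕ
      D = d ℕ.^ m

      r∣d : r ∣ d
      r∣d = divides e d≡er
      s = proj₁ (kummer r r-prime r∣d)
      s>0 = proj₁ (proj₂ (kummer r r-prime r∣d))
      q≡ = proj₂ (proj₂ (kummer r r-prime r∣d))
      M = s ℕ.* r ℕ.* geom q D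

      w : Carrier
      w = y ^ e

      t≈ : hMapᴿ y ≈ ι a * w ^ r + ι c
      t≈ = +-congʳ (*-congˡ (trans (^-congʳ y d≡er) (sym (^-assocʳ y e r))))

      open Radical {r} {s} q≡ {a} {b} ab≈1 {c} {hMapᴿ y} {w} {D} {charFun m} t≈
        (preimage-conjugates m nonpower (hMapᴿ y) eq)

      -- With N = v ^ r, a nonzero `v` gives ζ = v ^ (q - 1) = 1. If v = 0, then ζ = 0, so w ^ Q = 0
      -- and w = 0.
      w^Q≈w : w ^ Q ≈ w
      w^Q≈w with v K.≟ K.0#
      ... | no v≉0 = trans w^Q≈ (trans (*-congˡ (trans (ι-cong ζ≈1) ι-1)) (*-identityʳ w))
        where
        ζ≈1 : ζ K.≈ K.1#
        ζ≈1 = K.trans (K.^-congˡ s N≈v^r) (K.trans (K.^-swap v r s) (K.trans (K.^-assocʳ v s r) (K.fermat-unit q≡ (K.≉⇒unit v≉0))))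
      ... | yes v≈0 with power-zero nzd Q w (trans w^Q≈ (trans (*-congˡ (trans (ι-cong ζ≈0) ι-0)) (zeroʳ w)))
        where
        ζ≈0 : ζ K.≈ K.0#
        ζ≈0 = K.trans (K.^-congˡ s (K.trans N≈v^r (K.trans (K.^-congˡ r v≈0) (K.0^n≈0 (ℕ.<⇒≤ (prime>1 r-prime)))))) (K.0^n≈0 s>0)
      ...   | inj₁ w≈0 = trans (^-congˡ Q w≈0) (trans (0^n≈0 (q^n>0 D)) (sym w≈0))
      ...   | inj₂ 1≈0 = contradiction 1≈0 1≉0

      e>0 : 1 ≤ e
      e>0 = ℕ.n≢0⇒n>0 λ e≡0 → ℕ.<⇒≢ (ℕ.<⇒≤ 2≤d) (≡.sym (≡.trans d≡er (≡.cong (ℕ._* r) e≡0)))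

      -- Stated for every factorisation of q - 1, as it is applied to `r` and to each prime of `e`.
      Q≡1+ : ∀ {r s} → q ≡ suc (s ℕ.* r) → Q ≡ suc (s ℕ.* r ℕ.* geom q D)
      Q≡1+ {r} {s} q≡ = ≡.trans (≡.cong (ℕ._^ D) q≡)
        (≡.trans (^≡1+geom (s ℕ.* r) D) (≡.cong (λ x → suc (s ℕ.* r ℕ.* geom x D)) (≡.sym q≡)))

      Q≡ : Q ≡ suc M
      Q≡ = Q≡1+ {r} {s} q≡

      open PrimeFactorisation (factorise e {{ℕ.>-nonZero e>0}}) renaming (factors to rs; isFactorisation to e≡; factorsPrime to rs-prime)

      -- A prime of `e` divides `d`, hence q - 1, which divides Q - 1 = M.
      prime∣M : ∀ {r′} → Prime r′ → r′ ∣ e → r′ ∣ M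
      prime∣M {r′} pr r′∣e with kummer r′ pr (≡.subst (r′ ∣_) (≡.sym d≡er) (ℕ.∣m⇒∣m*n r r′∣e))
      ... | s′ , _ , q≡′ = ≡.subst (r′ ∣_) (ℕ.suc-injective (≡.trans (≡.sym (Q≡1+ {r′} {s′} q≡′)) Q≡))
              (ℕ.∣m⇒∣m*n (geom q D) (ℕ.∣n⇒∣m*n s′ ℕ.∣-refl))

      primes∣M : ∀ {ps} → All Prime ps → product ps ∣ e → All (_∣ M) ps
      primes∣M []                    _    = []
      primes∣M {p ∷ ps} (pr ∷ prs) ps∣e =
        prime∣M pr (ℕ.∣-trans (ℕ.m∣m*n (product ps)) ps∣e) ∷ primes∣M prs (ℕ.∣-trans (ℕ.n∣m*n p) ps∣e)

      order-e : ∃[ k ] Q ℕ.^ e ≡ suc (e ℕ.* M ℕ.* k)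
      order-e = ≡.subst₂ (λ Q e → ∃[ k ] Q ℕ.^ e ≡ suc (e ℕ.* M ℕ.* k)) (≡.sym Q≡) (≡.sym e≡)
        (radical-order (primes∣M rs-prime (ℕ.∣-reflexive (≡.sym e≡))))

-- Quotients by a principal ideal.

module Quotient {c ℓ} (R : CommutativeRing c ℓ) (m : CommutativeRing.Carrier R) where

  open RingTheory R
  open import Relation.Binary.Reasoning.Setoid setoid

  infix 4 _~_
  -- The quotient keeps the carrier and coarsens the equality, so a polynomial is its own residue
  -- class.
  _~_ : Carrier → Carrier → Set (c ⊔ ℓ)
  x ~ y = ∃[ k ] x ≈ y + k * m

  ≈⇒~ : ∀ {x y} → x ≈ y → x ~ y
  ≈⇒~ {x} {y} x≈y = 0# , trans x≈y (sym (trans (+-congˡ (zeroˡ m)) (+-identityʳ y)))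

  ~-isEquivalence : IsEquivalence _~_
  ~-isEquivalence = record
    { refl  = ≈⇒~ refl
    ; sym   = λ {x} {y} (k , x≈) → - k , (begin
        y                    ≈⟨ solve 3 (λ y k m → y := (y :+ k :* m) :+ (:- k) :* m) refl y k m ⟩
        (y + k * m) + - k * m ≈⟨ +-congʳ x≈ ⟨
        x + - k * m           ∎)
    ; trans = λ {x} {y} {z} (k , x≈) (l , y≈) → l + k , (begin
        x                      ≈⟨ x≈ ⟩
        y + k * m              ≈⟨ +-congʳ y≈ ⟩
        (z + l * m) + k * m    ≈⟨ solve 4 (λ z l k m → (z :+ l :* m) :+ k :* m := z :+ (l :+ k) :* m) refl z l k m ⟩
        z + (l + k) * m        ∎)
    }

  quotient : CommutativeRing c (c ⊔ ℓ)
  quotient = record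
    { Carrier = Carrier ; _≈_ = _~_ ; _+_ = _+_ ; _*_ = _*_ ; -_ = -_ ; 0# = 0# ; 1# = 1#
    ; isCommutativeRing = record
      { isRing = record
        { +-isAbelianGroup = record
          { isGroup = record
            { isMonoid = record
              { isSemigroup = record
                { isMagma = record
                  { isEquivalence = ~-isEquivalence
                  ; ∙-cong = λ {x} {y} {u} {v} (k , x≈) (l , u≈) → k + l , trans (+-cong x≈ u≈)
                      (solve 5 (λ y v k l m → (y :+ k :* m) :+ (v :+ l :* m) := (y :+ v) :+ (k :+ l) :* m) refl y v k l m)
                  }
                ; assoc = λ x y z → ≈⇒~ (+-assoc x y z)
                }
              ; identity = (λ x → ≈⇒~ (+-identityˡ x)) , (λ x → ≈⇒~ (+-identityʳ x))
              }
            ; inverse = (λ x → ≈⇒~ (-‿inverseˡ x)) , (λ x → ≈⇒~ (-‿inverseʳ x))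
            ; ⁻¹-cong = λ {x} {y} (k , x≈) → - k , trans (-‿cong x≈)
                (solve 3 (λ y k m → :- (y :+ k :* m) := (:- y) :+ (:- k) :* m) refl y k m)
            }
          ; comm = λ x y → ≈⇒~ (+-comm x y)
          }
        ; *-cong = λ {x} {y} {u} {v} (k , x≈) (l , u≈) → k * v + y * l + k * l * m , trans (*-cong x≈ u≈)
            (solve 5 (λ y v k l m → (y :+ k :* m) :* (v :+ l :* m) := y :* v :+ (k :* v :+ y :* l :+ k :* l :* m) :* m) refl y v k l m)
        ; *-assoc = λ x y z → ≈⇒~ (*-assoc x y z)
        ; *-identity = (λ x → ≈⇒~ (*-identityˡ x)) , (λ x → ≈⇒~ (*-identityʳ x))
        ; distrib = (λ x y z → ≈⇒~ (distribˡ x y z)) , (λ x y z → ≈⇒~ (distribʳ x y z))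
        }
      ; *-comm = λ x y → ≈⇒~ (*-comm x y)
      }
    }

-- The polynomial ring over a field, degrees and evaluation.

module PolynomialRing {c ℓ₁ ℓ₂} (F : DiscreteField c ℓ₁ ℓ₂) where

  open Polynomials F public
  open FieldTheory F
  open import Relation.Binary.Reasoning.Setoid setoid

  -- _≈ₚ_ unfolds to a function type, from which p and q cannot be inferred.
  infix 4 _≋_
  record _≋_ (p q : Poly) : Set ℓ₁ where
    constructor ≋-intro
    field at : p ≈ₚ q
  open _≋_ public

  private
    scale : Carrier → Poly → Poly
    scale a = map (a *_)

    shift : Poly → Poly
    shift p = 0# ∷ p

  coeff-+ : ∀ p q i → coeff (p +ₚ q) i ≈ coeff p i + coeff q i
  coeff-+ []      q       i       = sym (+-identityˡ _)
  coeff-+ (a ∷ p) []      i       = sym (+-identityʳ _)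
  coeff-+ (a ∷ p) (b ∷ q) zero    = refl
  coeff-+ (a ∷ p) (b ∷ q) (suc i) = coeff-+ p q i

  coeff-scale : ∀ a p i → coeff (map (a *_) p) i ≈ a * coeff p i
  coeff-scale a []      i       = sym (zeroʳ a)
  coeff-scale a (b ∷ p) zero    = refl
  coeff-scale a (b ∷ p) (suc i) = coeff-scale a p i

  coeff-neg : ∀ p i → coeff (map -_ p) i ≈ - coeff p i
  coeff-neg []      i       = sym -0#≈0#
  coeff-neg (b ∷ p) zero    = refl
  coeff-neg (b ∷ p) (suc i) = coeff-neg p i

  ∷-cong : ∀ {a b p q} → a ≈ b → p ≋ q → (a ∷ p) ≋ (b ∷ q)
  ∷-cong a≈b p≋q = ≋-intro λ { zero → a≈b ; (suc i) → at p≋q i }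

  private
    ≋-refl : ∀ {p} → p ≋ p
    ≋-refl = ≋-intro λ _ → refl

    ≋-sym : ∀ {p q} → p ≋ q → q ≋ p
    ≋-sym p≋q = ≋-intro λ i → sym (at p≋q i)

    ≋-trans : ∀ {p q r} → p ≋ q → q ≋ r → p ≋ r
    ≋-trans p≋q q≋r = ≋-intro λ i → trans (at p≋q i) (at q≋r i)

    +ₚ-cong : ∀ {p p′ q q′} → p ≋ p′ → q ≋ q′ → p +ₚ q ≋ p′ +ₚ q′
    +ₚ-cong {p} {p′} {q} {q′} p≋ q≋ = ≋-intro λ i →
      trans (coeff-+ p q i) (trans (+-cong (at p≋ i) (at q≋ i)) (sym (coeff-+ p′ q′ i)))

    +ₚ-assoc : ∀ p q r → p +ₚ q +ₚ r ≋ p +ₚ (q +ₚ r)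
    +ₚ-assoc p q r = ≋-intro λ i → begin
      coeff (p +ₚ q +ₚ r) i                  ≈⟨ trans (coeff-+ (p +ₚ q) r i) (+-congʳ (coeff-+ p q i)) ⟩
      (coeff p i + coeff q i) + coeff r i    ≈⟨ +-assoc _ _ _ ⟩
      coeff p i + (coeff q i + coeff r i)    ≈⟨ trans (coeff-+ p (q +ₚ r) i) (+-congˡ (coeff-+ q r i)) ⟨
      coeff (p +ₚ (q +ₚ r)) i                ∎

    +ₚ-comm : ∀ p q → p +ₚ q ≋ q +ₚ p
    +ₚ-comm p q = ≋-intro λ i → trans (coeff-+ p q i) (trans (+-comm _ _) (sym (coeff-+ q p i)))

    +ₚ-identityʳ : ∀ p → p +ₚ [] ≋ p
    +ₚ-identityʳ p = ≋-intro λ i → trans (coeff-+ p [] i) (+-identityʳ _)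

    +ₚ-swap : ∀ p q r → p +ₚ (q +ₚ r) ≋ q +ₚ (p +ₚ r)
    +ₚ-swap p q r = ≋-trans (≋-sym (+ₚ-assoc p q r)) (≋-trans (+ₚ-cong (+ₚ-comm p q) ≋-refl) (+ₚ-assoc q p r))

    0∷[]≋[] : 0# ∷ [] ≋ []
    0∷[]≋[] = ≋-intro λ { zero → refl ; (suc _) → refl }

    *ₚ-zeroʳ : ∀ p → p *ₚ [] ≋ []
    *ₚ-zeroʳ []      = ≋-refl
    *ₚ-zeroʳ (a ∷ p) = ≋-trans (∷-cong refl (*ₚ-zeroʳ p)) 0∷[]≋[]

    -- Multiplication recurses on its left factor; commutativity needs the expansion along the right
    -- one.
    *ₚ-∷ : ∀ p b q → p *ₚ (b ∷ q) ≋ scale b p +ₚ shift (p *ₚ q)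
    *ₚ-∷ []      b q = ≋-sym 0∷[]≋[]
    *ₚ-∷ (a ∷ p) b q = ∷-cong (+-congʳ (*-comm a b))
      (≋-trans (+ₚ-cong ≋-refl (*ₚ-∷ p b q)) (+ₚ-swap (scale a q) (scale b p) (shift (p *ₚ q))))

    *ₚ-comm : ∀ p q → p *ₚ q ≋ q *ₚ p
    *ₚ-comm []      q = ≋-sym (*ₚ-zeroʳ q)
    *ₚ-comm (a ∷ p) q = ≋-trans (+ₚ-cong ≋-refl (∷-cong refl (*ₚ-comm p q))) (≋-sym (*ₚ-∷ q a p))

    scale-cong : ∀ {a b p q} → a ≈ b → p ≋ q → scale a p ≋ scale b q
    scale-cong {a} {b} {p} {q} a≈b p≋q = ≋-intro λ i →
      trans (coeff-scale a p i) (trans (*-cong a≈b (at p≋q i)) (sym (coeff-scale b q i)))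

    *ₚ-congˡ : ∀ p {q q′} → q ≋ q′ → p *ₚ q ≋ p *ₚ q′
    *ₚ-congˡ []      q≋q′ = ≋-refl
    *ₚ-congˡ (a ∷ p) q≋q′ = +ₚ-cong (scale-cong refl q≋q′) (∷-cong refl (*ₚ-congˡ p q≋q′))

    -- Equal polynomials may be lists of different lengths, so the left factor is replaced through
    -- commutativity and not by recursion.
    *ₚ-cong : ∀ {p p′ q q′} → p ≋ p′ → q ≋ q′ → p *ₚ q ≋ p′ *ₚ q′
    *ₚ-cong {p} {p′} {q} {q′} p≋ q≋ = ≋-trans (*ₚ-congˡ p q≋) (≋-trans (*ₚ-comm p q′)
      (≋-trans (*ₚ-congˡ q′ p≋) (*ₚ-comm q′ p′)))

    shift-+ : ∀ p q → shift (p +ₚ q) ≋ shift p +ₚ shift q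
    shift-+ p q = ∷-cong (sym (+-identityʳ 0#)) ≋-refl

    scale-+ : ∀ a b r → scale (a + b) r ≋ scale a r +ₚ scale b r
    scale-+ a b r = ≋-intro λ i → begin
      coeff (scale (a + b) r) i                ≈⟨ coeff-scale (a + b) r i ⟩
      (a + b) * coeff r i                      ≈⟨ distribʳ _ a b ⟩
      a * coeff r i + b * coeff r i            ≈⟨ +-cong (coeff-scale a r i) (coeff-scale b r i) ⟨
      coeff (scale a r) i + coeff (scale b r) i ≈⟨ coeff-+ (scale a r) (scale b r) i ⟨
      coeff (scale a r +ₚ scale b r) i         ∎

    *ₚ-distribʳ : ∀ r p q → (p +ₚ q) *ₚ r ≋ p *ₚ r +ₚ q *ₚ r
    *ₚ-distribʳ r []      q       = ≋-refl
    *ₚ-distribʳ r (a ∷ p) []      = ≋-sym (+ₚ-identityʳ ((a ∷ p) *ₚ r))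
    *ₚ-distribʳ r (a ∷ p) (b ∷ q) = ≋-trans
      (+ₚ-cong (scale-+ a b r) (≋-trans (∷-cong refl (*ₚ-distribʳ r p q)) (shift-+ (p *ₚ r) (q *ₚ r))))
      (≋-trans (+ₚ-assoc (scale a r) (scale b r) _)
        (≋-trans (+ₚ-cong {scale a r} ≋-refl (+ₚ-swap (scale b r) (shift (p *ₚ r)) (shift (q *ₚ r))))
          (≋-sym (+ₚ-assoc (scale a r) (shift (p *ₚ r)) _))))

    scale-*ₚ : ∀ a p q → scale a p *ₚ q ≋ scale a (p *ₚ q)
    scale-*ₚ a []      q = ≋-refl
    scale-*ₚ a (b ∷ p) q = ≋-intro λ i → begin
      coeff (scale (a * b) q +ₚ shift (scale a p *ₚ q)) i         ≈⟨ coeff-+ (scale (a * b) q) _ i ⟩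
      coeff (scale (a * b) q) i + coeff (shift (scale a p *ₚ q)) i ≈⟨ +-cong (coeff-scale (a * b) q i) (shift-scale i) ⟩
      a * b * coeff q i + a * coeff (shift (p *ₚ q)) i            ≈⟨ solve 4 (λ a b x y → a :* b :* x :+ a :* y := a :* (b :* x :+ y)) refl a b (coeff q i) _ ⟩
      a * (b * coeff q i + coeff (shift (p *ₚ q)) i)              ≈⟨ *-congˡ (trans (coeff-+ (scale b q) _ i) (+-congʳ (coeff-scale b q i))) ⟨
      a * coeff ((b ∷ p) *ₚ q) i                                  ≈⟨ coeff-scale a ((b ∷ p) *ₚ q) i ⟨
      coeff (scale a ((b ∷ p) *ₚ q)) i                            ∎
      where
      shift-scale : ∀ i → coeff (shift (scale a p *ₚ q)) i ≈ a * coeff (shift (p *ₚ q)) i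
      shift-scale zero    = sym (zeroʳ a)
      shift-scale (suc i) = trans (at (scale-*ₚ a p q) i) (coeff-scale a (p *ₚ q) i)

    scale-0 : ∀ p → scale 0# p ≋ []
    scale-0 p = ≋-intro λ i → trans (coeff-scale 0# p i) (zeroˡ _)

    scale-1 : ∀ p → scale 1# p ≋ p
    scale-1 p = ≋-intro λ i → trans (coeff-scale 1# p i) (*-identityˡ _)

    shift-*ₚ : ∀ p q → shift p *ₚ q ≋ shift (p *ₚ q)
    shift-*ₚ p q = +ₚ-cong (scale-0 q) ≋-refl

    *ₚ-assoc : ∀ p q r → p *ₚ q *ₚ r ≋ p *ₚ (q *ₚ r)
    *ₚ-assoc []      q r = ≋-refl
    *ₚ-assoc (a ∷ p) q r = ≋-trans (*ₚ-distribʳ r (scale a q) (shift (p *ₚ q)))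
      (+ₚ-cong (scale-*ₚ a q r) (≋-trans (shift-*ₚ (p *ₚ q) r) (∷-cong refl (*ₚ-assoc p q r))))

    *ₚ-identityˡ : ∀ p → const 1# *ₚ p ≋ p
    *ₚ-identityˡ p = ≋-trans (+ₚ-cong (scale-1 p) 0∷[]≋[]) (+ₚ-identityʳ p)

  polyRing : CommutativeRing c ℓ₁
  polyRing = record
    { Carrier = Poly ; _≈_ = _≋_ ; _+_ = _+ₚ_ ; _*_ = _*ₚ_ ; -_ = λ p → map -_ p ; 0# = [] ; 1# = const 1#
    ; isCommutativeRing = record
      { isRing = record
        { +-isAbelianGroup = record
          { isGroup = record
            { isMonoid = record
              { isSemigroup = record
                { isMagma = record
                  { isEquivalence = record { refl = ≋-refl ; sym = ≋-sym ; trans = ≋-trans }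
                  ; ∙-cong = +ₚ-cong
                  }
                ; assoc = +ₚ-assoc
                }
              ; identity = (λ _ → ≋-refl) , +ₚ-identityʳ
              }
            ; inverse = (λ p → ≋-intro λ i → trans (coeff-+ (map -_ p) p i) (trans (+-congʳ (coeff-neg p i)) (-‿inverseˡ _)))
                      , (λ p → ≋-intro λ i → trans (coeff-+ p (map -_ p) i) (trans (+-congˡ (coeff-neg p i)) (-‿inverseʳ _)))
            ; ⁻¹-cong = λ {p} {q} p≋q → ≋-intro λ i → trans (coeff-neg p i) (trans (-‿cong (at p≋q i)) (sym (coeff-neg q i)))
            }
          ; comm = +ₚ-comm
          }
        ; *-cong = *ₚ-cong
        ; *-assoc = *ₚ-assoc
        ; *-identity = *ₚ-identityˡ , λ p → ≋-trans (*ₚ-comm p (const 1#)) (*ₚ-identityˡ p)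
        ; distrib = (λ p q r → ≋-trans (*ₚ-comm p (q +ₚ r)) (≋-trans (*ₚ-distribʳ p q r) (+ₚ-cong (*ₚ-comm q p) (*ₚ-comm r p))))
                  , *ₚ-distribʳ
        }
      ; *-comm = *ₚ-comm
      }
    }

  const-cong : ∀ {a b} → a ≈ b → const a ≋ const b
  const-cong a≈b = ∷-cong a≈b ≋-refl

  const-homomorphism : IsRingHomomorphism (CommutativeRing.rawRing commutativeRing) (CommutativeRing.rawRing polyRing) const
  const-homomorphism = record
    { isSemiringHomomorphism = record
      { isNearSemiringHomomorphism = record
        { +-isMonoidHomomorphism = record
          { isMagmaHomomorphism = record
            { isRelHomomorphism = record { cong = const-cong }
            ; homo = λ _ _ → ≋-refl
            }
          ; ε-homo = 0∷[]≋[]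
          }
        ; *-homo = λ a b → const-cong (sym (+-identityʳ _))
        }
      ; 1#-homo = ≋-refl
      }
    ; -‿homo = λ _ → ≋-refl
    }

  const-*ₚ : ∀ a p i → coeff (const a *ₚ p) i ≈ a * coeff p i
  const-*ₚ a p i = trans (at (≋-trans (+ₚ-cong ≋-refl 0∷[]≋[]) (+ₚ-identityʳ (scale a p))) i) (coeff-scale a p i)

  X-*ₚ : ∀ p → X *ₚ p ≋ 0# ∷ p
  X-*ₚ p = ≋-trans (shift-*ₚ (const 1#) p) (∷-cong refl (*ₚ-identityˡ p))

  -- `l` may be zero; exact degree is expressed by adding `¬ l ≈ 0#`.
  Lead : Poly → ℕ → Carrier → Set ℓ₁
  Lead p n l = coeff p n ≈ l × (∀ i → n < i → coeff p i ≈ 0#)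

  lead-resp : ∀ {p q n l} → p ≋ q → Lead p n l → Lead q n l
  lead-resp p≋q (≈l , ≈0) = trans (sym (at p≋q _)) ≈l , λ i n<i → trans (sym (at p≋q i)) (≈0 i n<i)

  lead-const : ∀ a → Lead (const a) 0 a
  lead-const a = refl , λ { (suc i) _ → refl }

  degree : ∀ p → p ≋ [] ⊎ ∃[ n ] ∃[ l ] (¬ l ≈ 0# × Lead p n l)
  degree []      = inj₁ ≋-refl
  degree (a ∷ p) with degree p | a ≟ 0#
  ... | inj₂ (n , l , l≉0 , ≈l , ≈0) | _ = inj₂ (suc n , l , l≉0 , ≈l , λ { (suc i) (s≤s n<i) → ≈0 i n<i })
  ... | inj₁ p≋[] | no  a≉0 = inj₂ (0 , a , a≉0 , refl , λ { (suc i) _ → at p≋[] i })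
  ... | inj₁ p≋[] | yes a≈0 = inj₁ (≋-trans (∷-cong a≈0 p≋[]) 0∷[]≋[])

  lead-* : ∀ p q {m n l l′} → Lead p m l → Lead q n l′ → Lead (p *ₚ q) (m ℕ.+ n) (l * l′)
  lead-* [] _ (≈l , _) _ = trans (sym (zeroˡ _)) (*-congʳ ≈l) , λ _ _ → refl
  lead-* (a ∷ p) q {zero} {n} (a≈l , p≈0) (≈l′ , q≈0) = lead-resp a*q≋
      (trans (const-*ₚ a q n) (*-cong a≈l ≈l′) ,
       λ i n<i → trans (const-*ₚ a q i) (trans (*-congˡ (q≈0 i n<i)) (zeroʳ a)))
    where
    a*q≋ : const a *ₚ q ≋ (a ∷ p) *ₚ q
    a*q≋ = *ₚ-cong {const a} {a ∷ p} (∷-cong {p = []} {p} refl (≋-intro λ i → sym (p≈0 (suc i) (s≤s z≤n)))) ≋-refl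
  lead-* (a ∷ p) q {suc m} {n} (≈l , p≈0) lq@(≈l′ , q≈0) =
    trans (coeff-+ (scale a q) _ (suc (m ℕ.+ n))) (trans (+-cong (aq≈0 _ (s≤s (ℕ.m≤n+m n m))) (proj₁ rec)) (+-identityˡ _)) ,
    λ { (suc i) (s≤s lt) → trans (coeff-+ (scale a q) _ (suc i)) (trans (+-cong (aq≈0 _ (s≤s (ℕ.≤-trans (ℕ.m≤n+m n m) (ℕ.<⇒≤ lt)))) (proj₂ rec i lt)) (+-identityˡ _)) }
    where
    rec = lead-* p q (≈l , λ i m<i → p≈0 (suc i) (s≤s m<i)) lq
    aq≈0 : ∀ i → n < i → coeff (scale a q) i ≈ 0#
    aq≈0 i n<i = trans (coeff-scale a q i) (trans (*-congˡ (q≈0 i n<i)) (zeroʳ a))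

  lead-^ : ∀ p {m l} k → Lead p m l → Lead (p ^ₚ k) (k ℕ.* m) (l ^ k)
  lead-^ p zero    lp = lead-const 1#
  lead-^ p (suc k) lp = lead-* p (p ^ₚ k) lp (lead-^ p k lp)

  lead-X : Lead X 1 1#
  lead-X = refl , λ { (suc (suc i)) _ → refl ; (suc zero) (s≤s ()) }

  lead-+const : ∀ p {n l} a → 1 ≤ n → Lead p n l → Lead (p +ₚ const a) n l
  lead-+const p {n} a 1≤n (≈l , ≈0) = trans (lemma n 1≤n) ≈l , λ i n<i → trans (lemma i (ℕ.≤-trans 1≤n (ℕ.<⇒≤ n<i))) (≈0 i n<i)
    where
    lemma : ∀ i → 1 ≤ i → coeff (p +ₚ const a) i ≈ coeff p i
    lemma (suc i) _ = trans (coeff-+ p (const a) (suc i)) (+-identityʳ _)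

module Evaluation
  {c ℓ₁ ℓ₂} (F : DiscreteField c ℓ₁ ℓ₂)
  {c′ ℓ′} (R : CommutativeRing c′ ℓ′) (ι : DiscreteField.Carrier F → CommutativeRing.Carrier R)
  (ι-hom : IsRingHomomorphism (CommutativeRing.rawRing (DiscreteField.commutativeRing F)) (CommutativeRing.rawRing R) ι)
  where

  private module K = FieldTheory F
  open PolynomialRing F
  open RingTheory R
  open import Relation.Binary.Reasoning.Setoid setoid
  open IsRingHomomorphism ι-hom
    using () renaming (⟦⟧-cong to ι-cong; +-homo to ι-+; *-homo to ι-*; 0#-homo to ι-0; 1#-homo to ι-1)

  ev : Poly → Carrier → Carrier
  ev []      t = 0#
  ev (a ∷ p) t = ι a + t * ev p t

  ev-0 : ∀ p t → p ≋ [] → ev p t ≈ 0#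
  ev-0 []      t p≈0 = refl
  ev-0 (a ∷ p) t p≈0 = trans (+-cong (trans (ι-cong (at p≈0 0)) ι-0) (trans (*-congˡ (ev-0 p t (≋-intro λ i → at p≈0 (suc i)))) (zeroʳ t))) (+-identityˡ 0#)

  ev-congˡ : ∀ p {t s} → t ≈ s → ev p t ≈ ev p s
  ev-congˡ []      t≈s = refl
  ev-congˡ (a ∷ p) t≈s = +-congˡ (*-cong t≈s (ev-congˡ p t≈s))

  ev-+ : ∀ p q t → ev (p +ₚ q) t ≈ ev p t + ev q t
  ev-+ []      q       t = sym (+-identityˡ _)
  ev-+ (a ∷ p) []      t = sym (+-identityʳ _)
  ev-+ (a ∷ p) (b ∷ q) t = trans (+-cong (ι-+ a b) (*-congˡ (ev-+ p q t)))
    (solve 5 (λ a b t x y → (a :+ b) :+ t :* (x :+ y) := (a :+ t :* x) :+ (b :+ t :* y)) refl (ι a) (ι b) t (ev p t) (ev q t))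

  ev-scale : ∀ a p t → ev (map (a K.*_) p) t ≈ ι a * ev p t
  ev-scale a []      t = sym (zeroʳ _)
  ev-scale a (b ∷ p) t = trans (+-cong (ι-* a b) (*-congˡ (ev-scale a p t)))
    (solve 4 (λ a b t x → a :* b :+ t :* (a :* x) := a :* (b :+ t :* x)) refl (ι a) (ι b) t (ev p t))

  ev-* : ∀ p q t → ev (p *ₚ q) t ≈ ev p t * ev q t
  ev-* []      q t = sym (zeroˡ _)
  ev-* (a ∷ p) q t = begin
    ev (map (a K.*_) q +ₚ (K.0# ∷ (p *ₚ q))) t       ≈⟨ ev-+ (map (a K.*_) q) _ t ⟩
    ev (map (a K.*_) q) t + (ι K.0# + t * ev (p *ₚ q) t) ≈⟨ +-cong (ev-scale a q t) (trans (+-cong ι-0 (*-congˡ (ev-* p q t))) (+-identityˡ _)) ⟩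
    ι a * ev q t + t * (ev p t * ev q t)             ≈⟨ solve 4 (λ a t x y → a :* y :+ t :* (x :* y) := (a :+ t :* x) :* y) refl (ι a) t (ev p t) (ev q t) ⟩
    (ι a + t * ev p t) * ev q t                      ∎

  ev-const : ∀ a t → ev (const a) t ≈ ι a
  ev-const a t = trans (+-congˡ (zeroʳ t)) (+-identityʳ _)

  ev-X : ∀ t → ev X t ≈ t
  ev-X t = trans (+-cong ι-0 (*-congˡ (trans (ev-const K.1# t) ι-1))) (trans (+-identityˡ _) (*-identityʳ t))

  ev-^ : ∀ p k t → ev (p ^ₚ k) t ≈ ev p t ^ k
  ev-^ p zero    t = trans (ev-const K.1# t) ι-1
  ev-^ p (suc k) t = trans (ev-* p (p ^ₚ k) t) (*-congˡ (ev-^ p k t))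

  ev-degree : ∀ p {n l} → Lead p n l → HasDegree n (ι l) (ev p)
  ev-degree []      {zero}  (0≈l , _)    = constant (λ _ → sym (trans (ι-cong (K.sym 0≈l)) ι-0))
  ev-degree []      {suc n} (0≈l , _)    = horner 0# (ev-degree [] {n} (0≈l , λ _ _ → K.refl)) (λ y → sym (trans (+-identityˡ _) (zeroʳ y)))
  ev-degree (a ∷ p) {zero}  (a≈l , p≈0) = constant (λ y → trans (+-cong (ι-cong a≈l) (trans (*-congˡ (ev-0 p y (≋-intro λ i → p≈0 (suc i) (s≤s z≤n)))) (zeroʳ y))) (+-identityʳ _))
  ev-degree (a ∷ p) {suc n} (≈l , p≈0)  = horner (ι a) (ev-degree p (≈l , λ i n<i → p≈0 (suc i) (s≤s n<i))) (λ _ → refl)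

-- Division with remainder; irreducible polynomials are prime.

module Euclid {c ℓ₁ ℓ₂} (F : DiscreteField c ℓ₁ ℓ₂) where

  private module K = FieldTheory F
  open PolynomialRing F
  open RingTheory polyRing
  open import Relation.Binary.Reasoning.Setoid setoid

  ∷≋ : ∀ a p → (a ∷ p) ≋ const a + X * p
  ∷≋ a p = sym (trans (+-congˡ {const a} (X-*ₚ p)) (∷-cong (K.+-identityʳ a) refl))

  -- Degree below `n`, a bound that also covers the zero polynomial and can drive an induction.
  VanishesFrom : ℕ → Poly → Set ℓ₁
  VanishesFrom n p = ∀ i → n ≤ i → coeff p i K.≈ K.0#

  vanishes-length : ∀ p → VanishesFrom (length p) p
  vanishes-length []      i       _         = K.refl
  vanishes-length (a ∷ p) (suc i) (s≤s n≤i) = vanishes-length p i n≤i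

  -- From p = k u + r follows a + X p = X k u + (a + X r), whose last part has degree at most `n`;
  -- one multiple of `u` removes its coefficient at `n`.
  division : ∀ {u n l} → ¬ l K.≈ K.0# → Lead u n l → ∀ p →
             ∃[ k ] ∃[ r ] p ≋ k * u + r × VanishesFrom n r
  division l≉0 lu [] = [] , [] , refl , λ _ _ → K.refl
  division {u} {n} {l} l≉0 lu@(≈l , u≈0) (a ∷ p) with division l≉0 lu p
  ... | k , r , p≋ , r≈0 = X * k + const e , (a ∷ r) - const e * u , p′≋ , remainder
    where
    l⁻¹ = proj₁ (K.≉⇒unit l≉0)
    e = coeff (a ∷ r) n K.* l⁻¹
    p′≋ : a ∷ p ≋ (X * k + const e) * u + ((a ∷ r) - const e * u)
    p′≋ = begin
      a ∷ p                                                     ≈⟨ ∷≋ a p ⟩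
      const a + X * p                                           ≈⟨ +-congˡ {const a} (*-congˡ {X} p≋) ⟩
      const a + X * (k * u + r)                                 ≈⟨ solve 6 (λ a x k u r e → a :+ x :* (k :* u :+ r) := (x :* k :+ e) :* u :+ ((a :+ x :* r) :- e :* u)) refl (const a) X k u r (const e) ⟩
      (X * k + const e) * u + ((const a + X * r) - const e * u) ≈⟨ +-congˡ {(X * k + const e) * u} (+-congʳ {map K.-_ (const e * u)} (∷≋ a r)) ⟨
      (X * k + const e) * u + ((a ∷ r) - const e * u)           ∎
    coeff≈ : ∀ i → coeff ((a ∷ r) - const e * u) i K.≈ coeff (a ∷ r) i K.- e K.* coeff u i
    coeff≈ i = K.trans (coeff-+ (a ∷ r) (map K.-_ (const e * u)) i)
      (K.+-congˡ (K.trans (coeff-neg (const e * u) i) (K.-‿cong (const-*ₚ e u i))))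
    el≈ : e K.* l K.≈ coeff (a ∷ r) n
    el≈ = K.trans (K.*-assoc _ _ _) (K.trans (K.*-congˡ (K.trans (K.*-comm _ _) (proj₂ (K.≉⇒unit l≉0)))) (K.*-identityʳ _))
    remainder : VanishesFrom n ((a ∷ r) - const e * u)
    remainder i n≤i with ℕ.m≤n⇒m<n∨m≡n n≤i
    ... | inj₂ ≡.refl = K.trans (coeff≈ n) (K.trans (K.+-congˡ (K.-‿cong (K.trans (K.*-congˡ ≈l) el≈))) (K.-‿inverseʳ _))
    remainder (suc i) n≤i | inj₁ (s≤s n≤i′) = K.trans (coeff≈ (suc i))
      (K.trans (K.+-cong (r≈0 i n≤i′) (K.trans (K.-‿cong (K.trans (K.*-congˡ (u≈0 (suc i) (s≤s n≤i′))) (K.zeroʳ e))) K.-0#≈0#)) (K.+-identityˡ _))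

  -- The induction is on a bound for the degree of `u`: a zero coefficient just below the bound
  -- lowers it, a nonzero one permits division, and the remainder has a smaller bound.
  bezout : ∀ n p u → VanishesFrom n u →
    ∃[ g ] ∃[ s ] ∃[ t ] g ≋ s * p + t * u × (∃[ k ] p ≋ k * g) × (∃[ k ] u ≋ k * g)
  bezout zero    p u u≈0 = p , 1# , [] , sym (trans (+-identityʳ (1# * p)) (*-identityˡ p)) ,
    (1# , sym (*-identityˡ p)) , ([] , ≋-intro λ i → u≈0 i z≤n)
  bezout (suc n) p u u≈0 with coeff u n K.≟ K.0#
  ... | yes uₙ≈0 = bezout n p u λ i n≤i → lemma i (ℕ.m≤n⇒m<n∨m≡n n≤i)
    where
    lemma : ∀ i → n < i ⊎ n ≡ i → coeff u i K.≈ K.0#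
    lemma i (inj₁ n<i)    = u≈0 i n<i
    lemma i (inj₂ ≡.refl) = uₙ≈0
  ... | no  uₙ≉0 with division {u} uₙ≉0 (K.refl , u≈0) p
  ...   | k , r , p≋ , r≈0 with bezout n u r r≈0
  ...     | g , s , t , g≋ , (i , u≋) , (j , r≋) =
    g , t , s - t * k , g≋′ , (k * i + j , p≋′) , (i , u≋)
    where
    g≋′ : g ≋ t * p + (s - t * k) * u
    g≋′ = begin
      g                                     ≈⟨ g≋ ⟩
      s * u + t * r                         ≈⟨ solve 5 (λ s u t r k → s :* u :+ t :* r := t :* (k :* u :+ r) :+ (s :- t :* k) :* u) refl s u t r k ⟩
      t * (k * u + r) + (s - t * k) * u     ≈⟨ +-congʳ {(s - t * k) * u} (*-congˡ {t} p≋) ⟨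
      t * p + (s - t * k) * u               ∎
    p≋′ : p ≋ (k * i + j) * g
    p≋′ = begin
      p                      ≈⟨ p≋ ⟩
      k * u + r              ≈⟨ +-cong (*-congˡ {k} u≋) r≋ ⟩
      k * (i * g) + j * g    ≈⟨ solve 4 (λ k i j g → k :* (i :* g) :+ j :* g := (k :* i :+ j) :* g) refl k i j g ⟩
      (k * i + j) * g        ∎

  -- Let g be the gcd of `f` and `u`, with f = i g. If i is a unit, `f` divides `u`; if g is one, a
  -- Bezout identity multiplied by `v` shows that `f` divides `v`.
  irreducible⇒prime : ∀ {f} → Irreducible f → ∀ u v → (∃[ k ] u * v ≋ k * f) → (∃[ k ] u ≋ k * f) ⊎ (∃[ k ] v ≋ k * f)
  irreducible⇒prime {f} irr u v (m , uv≋) with bezout (length u) f u (vanishes-length u)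
  ... | g , s , t , g≋ , (i , f≋) , (j , u≋) with Irreducible.split-∣1 irr {i} {g} (at f≋)
  ...   | inj₁ (w RawMagmaDefinitions., wi≈1) = inj₁ (j * w , (begin
      u                ≈⟨ u≋ ⟩
      j * g            ≈⟨ *-congˡ {j} (*-identityˡ g) ⟨
      j * (1# * g)     ≈⟨ *-congˡ {j} (*-congʳ {g} {w * i} (≋-intro wi≈1)) ⟨
      j * (w * i * g)  ≈⟨ solve 4 (λ j w i g → j :* (w :* i :* g) := j :* w :* (i :* g)) refl j w i g ⟩
      j * w * (i * g)  ≈⟨ *-congˡ {j * w} f≋ ⟨
      j * w * f        ∎))
  ...   | inj₂ (w RawMagmaDefinitions., wg≈1) = inj₂ (w * (s * v + t * m) , (begin
      v                              ≈⟨ *-identityˡ v ⟨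
      1# * v                         ≈⟨ *-congʳ {v} {w * g} (≋-intro wg≈1) ⟨
      w * g * v                      ≈⟨ *-congʳ {v} (*-congˡ {w} g≋) ⟩
      w * (s * f + t * u) * v        ≈⟨ solve 6 (λ w s f t u v → w :* (s :* f :+ t :* u) :* v := w :* (s :* v :* f :+ t :* (u :* v))) refl w s f t u v ⟩
      w * (s * v * f + t * (u * v))  ≈⟨ *-congˡ {w} (+-congˡ {s * v * f} (*-congˡ {t} uv≋)) ⟩
      w * (s * v * f + t * (m * f))  ≈⟨ solve 6 (λ w s f t m v → w :* (s :* v :* f :+ t :* (m :* f)) := w :* (s :* v :+ t :* m) :* f) refl w s f t m v ⟩
      w * (s * v + t * m) * f        ∎))

funToFin-cong : ∀ {m n} {f g : Fin m → Fin n} → f ≗ g → funToFin f ≡ funToFin g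
funToFin-cong {zero}  f≗g = ≡.refl
funToFin-cong {suc m} f≗g = ≡.cong₂ combine (f≗g zero) (funToFin-cong (f≗g ∘ suc))

finToFun-injective : ∀ {m n} (i j : Fin (m ℕ.^ n)) → finToFun {m} {n} i ≗ finToFun j → i ≡ j
finToFun-injective {m} {n} i j eq =
  ≡.trans (≡.sym (funToFin-finToFin {n} {m} i)) (≡.trans (funToFin-cong eq) (funToFin-finToFin {n} {m} j))

module PolynomialDegree {c ℓ₁ ℓ₂} (F : DiscreteField c ℓ₁ ℓ₂) where

  open PolynomialRing F
  open Euclid F using (VanishesFrom)
  open FieldTheory F
  private module P = RingTheory polyRing

  no-zero-divisors : ∀ {x y} → ¬ x ≈ 0# → ¬ y ≈ 0# → ¬ x * y ≈ 0#
  no-zero-divisors x≉0 y≉0 xy≈0 = y≉0 (unit⇒regular (≉⇒unit x≉0) _ xy≈0)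

  -- A nonzero multiple of `f` has at least the degree of `f`, as leading coefficients multiply to a
  -- nonzero one.
  short-multiple : ∀ {f n l} → ¬ l ≈ 0# → Lead f n l → ∀ k → VanishesFrom n (k *ₚ f) → k *ₚ f ≋ []
  short-multiple {f} {n} l≉0 lf k kf≈0 with degree k
  ... | inj₁ k≋[] = P.trans (P.*-congʳ {f} {k} {[]} k≋[]) P.refl
  ... | inj₂ (m , l′ , l′≉0 , lk) =
    contradiction (trans (sym (proj₁ (lead-* k f lk lf))) (kf≈0 (m ℕ.+ n) (ℕ.m≤n+m n m))) (no-zero-divisors l′≉0 l≉0)

  -- This keeps nonzero scalars, in particular 1, nonzero modulo `f`.
  constant-multiple : ∀ {f n l} → ¬ l ≈ 0# → Lead f n l → 1 ≤ n → ∀ {a} k → const a ≋ k *ₚ f → a ≈ 0#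
  constant-multiple l≉0 lf 1≤n k a≋kf = trans (at a≋kf 0) (at (short-multiple l≉0 lf k
    λ i n≤i → trans (sym (at a≋kf i)) (vanishes i (ℕ.≤-trans 1≤n n≤i))) 0)
    where
    vanishes : ∀ {a} i → 1 ≤ i → coeff (const a) i ≈ 0#
    vanishes (suc i) _ = refl

  degree-0 : ∀ {p l} → Lead p 0 l → p ≋ const l
  degree-0 (≈l , ≈0) = ≋-intro λ { zero → ≈l ; (suc i) → ≈0 (suc i) (s≤s z≤n) }

  lead-unique : ∀ {p m n l l′} → ¬ l ≈ 0# → ¬ l′ ≈ 0# → Lead p m l → Lead p n l′ → m ≡ n
  lead-unique {m = m} {n} l≉0 l′≉0 (≈l , l-top) (≈l′ , l′-top) with ℕ.<-cmp m n
  ... | tri< m<n _ _ = contradiction (trans (sym ≈l′) (l-top n m<n)) l′≉0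
  ... | tri≈ _ m≡n _ = m≡n
  ... | tri> _ _ n<m = contradiction (trans (sym ≈l) (l′-top m n<m)) l≉0

  coeff-tabulate : ∀ {n} (g : Fin n → Carrier) i → coeff (tabulate g) (toℕ i) ≡ g i
  coeff-tabulate g zero    = ≡.refl
  coeff-tabulate g (suc i) = coeff-tabulate (g ∘ suc) i

  tabulate-vanishes : ∀ {n} (g : Fin n → Carrier) → VanishesFrom n (tabulate g)
  tabulate-vanishes {zero}  g i       _         = refl
  tabulate-vanishes {suc n} g (suc i) (s≤s n≤i) = tabulate-vanishes (g ∘ suc) i n≤i

-- Evaluation of iterates, and conjugates in the residue ring.

module IterateEvaluation
  {c ℓ₁ ℓ₂} (F : DiscreteField c ℓ₁ ℓ₂)
  {c′ ℓ′} (R : CommutativeRing c′ ℓ′) (ι : DiscreteField.Carrier F → CommutativeRing.Carrier R)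
  (ι-hom : IsRingHomomorphism (CommutativeRing.rawRing (DiscreteField.commutativeRing F)) (CommutativeRing.rawRing R) ι)
  where

  open PolynomialRing F
  open RingTheory R
  open Evaluation F R ι ι-hom
  open import Relation.Binary.Reasoning.Setoid setoid

  ev-∘ : ∀ p r t → ev (p ∘ₚ r) t ≈ ev p (ev r t)
  ev-∘ []      r t = refl
  ev-∘ (a ∷ p) r t = begin
    ev (const a +ₚ r *ₚ (p ∘ₚ r)) t              ≈⟨ ev-+ (const a) (r *ₚ (p ∘ₚ r)) t ⟩
    ev (const a) t + ev (r *ₚ (p ∘ₚ r)) t        ≈⟨ +-cong (ev-const a t) (trans (ev-* r (p ∘ₚ r) t) (*-congˡ (ev-∘ p r t))) ⟩
    ι a + ev r t * ev p (ev r t)                 ∎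

  module _ (d : ℕ) (a c : DiscreteField.Carrier F) where

    private
      h : Poly
      h = const a *ₚ X ^ₚ d +ₚ const c

      hMap : Carrier → Carrier
      hMap t = ι a * t ^ d + ι c

    ev-h : ∀ t → ev h t ≈ hMap t
    ev-h t = begin
      ev (const a *ₚ X ^ₚ d +ₚ const c) t         ≈⟨ ev-+ (const a *ₚ X ^ₚ d) (const c) t ⟩
      ev (const a *ₚ X ^ₚ d) t + ev (const c) t   ≈⟨ +-cong (ev-* (const a) (X ^ₚ d) t) (ev-const c t) ⟩
      ev (const a) t * ev (X ^ₚ d) t + ι c        ≈⟨ +-congʳ (*-cong (ev-const a t) (trans (ev-^ X d t) (^-congˡ d (ev-X t)))) ⟩
      hMap t                                      ∎

    ev-iterate : ∀ n t → ev (h ^∘ n) t ≈ iterate hMap t n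
    ev-iterate zero    t = ev-X t
    ev-iterate (suc n) t = begin
      ev (h ∘ₚ (h ^∘ n)) t       ≈⟨ ev-∘ h (h ^∘ n) t ⟩
      ev h (ev (h ^∘ n) t)       ≈⟨ ev-congˡ h (ev-iterate n t) ⟩
      ev h (iterate hMap t n)    ≈⟨ ev-h _ ⟩
      -- `_^∘_` adds a map on the outside and `iterate` on the inside; `fold` also adds it outside
      -- and mediates.
      hMap (iterate hMap t n)    ≡⟨ ≡.cong hMap (iterate-is-fold t hMap n) ⟨
      fold t hMap (suc n)        ≡⟨ iterate-is-fold t hMap (suc n) ⟩
      iterate hMap t (suc n)     ∎

module Conjugates
  {c ℓ₁ ℓ₂} (F : DiscreteField c ℓ₁ ℓ₂) {q} (order : DiscreteField.HasOrder F q) (q-pp : IsPrimePower q)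
  {c′ ℓ′} (R : CommutativeRing c′ ℓ′) (ι : DiscreteField.Carrier F → CommutativeRing.Carrier R)
  (ι-hom : IsRingHomomorphism (CommutativeRing.rawRing (DiscreteField.commutativeRing F)) (CommutativeRing.rawRing R) ι)
  where

  open Extension F order q-pp R ι ι-hom
  open HasConjugates
  open RingTheory R
  open Evaluation F R ι ι-hom
  open import Relation.Binary.Reasoning.Setoid setoid

  -- Frobenius is additive and fixes the coefficients, so it carries roots of `p` to roots of `p`.
  ev-frobenius : ∀ n p t → ev p (t ^ (q ℕ.^ n)) ≈ ev p t ^ (q ℕ.^ n)
  ev-frobenius n []      t = sym (0^n≈0 (q^n>0 n))
  ev-frobenius n (a ∷ p) t = begin
    ι a + t ^ Q * ev p (t ^ Q)       ≈⟨ +-cong (sym (frobenius-ι n a)) (*-congˡ (ev-frobenius n p t)) ⟩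
    ι a ^ Q + t ^ Q * ev p t ^ Q     ≈⟨ +-congˡ (^-distrib-* t (ev p t) Q) ⟨
    ι a ^ Q + (t * ev p t) ^ Q       ≈⟨ frobenius-+ n _ _ ⟨
    (ι a + t * ev p t) ^ Q           ∎
    where Q = q ℕ.^ n

  -- The difference is the q ^ i-th power of t ^ (q ^ (j - i)) - t, and 0 < j - i < D.
  conjugates-difference : ∀ {t D G} → HasConjugates t D G → ∀ {i j} → i < j → j < D →
                          Unit (t ^ (q ℕ.^ j) - t ^ (q ℕ.^ i))
  conjugates-difference {t} conj {i} {j} i<j j<D = unit-resp (begin
    (t ^ (q ℕ.^ (j ∸ i)) - t) ^ (q ℕ.^ i)                     ≈⟨ frobenius-sub i _ _ ⟩
    (t ^ (q ℕ.^ (j ∸ i))) ^ (q ℕ.^ i) - t ^ (q ℕ.^ i)         ≈⟨ +-congʳ (^-assocʳ t (q ℕ.^ (j ∸ i)) (q ℕ.^ i)) ⟩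
    t ^ (q ℕ.^ (j ∸ i) ℕ.* q ℕ.^ i) - t ^ (q ℕ.^ i)           ≡⟨ ≡.cong (λ n → t ^ n - t ^ (q ℕ.^ i)) (≡.trans (≡.sym (ℕ.^-distribˡ-+-* q (j ∸ i) i)) (≡.cong (q ℕ.^_) (ℕ.m∸n+n≡m (ℕ.<⇒≤ i<j)))) ⟩
    t ^ (q ℕ.^ j) - t ^ (q ℕ.^ i)                             ∎)
    (unit-^ (q ℕ.^ i) (distinct conj (j ∸ i) λ D∣j-i →
      ℕ.<⇒≱ (ℕ.≤-<-trans (ℕ.m∸n≤m j i) j<D) (ℕ.∣⇒≤ {{ℕ.>-nonZero (ℕ.m<n⇒0<n∸m i<j)}} D∣j-i)))

  conjugates-separated : ∀ {t D G} → HasConjugates t D G → Separated {D} (λ i → t ^ (q ℕ.^ toℕ i))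
  conjugates-separated {t} {D} conj i j i≢j with ℕ.<-cmp (toℕ i) (toℕ j)
  ... | tri< i<j _ _ = unit⇒regular (unit-resp (solve 2 (λ u v → :- (v :- u) := u :- v) refl _ _)
                         (unit-neg (conjugates-difference conj i<j (toℕ<n j))))
  ... | tri≈ _ i≡j _ = contradiction (toℕ-injective i≡j) i≢j
  ... | tri> _ _ j<i = unit⇒regular (conjugates-difference conj j<i (toℕ<n i))

module Residues
  {c ℓ₁ ℓ₂} (F : DiscreteField c ℓ₁ ℓ₂) {q} (order : DiscreteField.HasOrder F q) (q-pp : IsPrimePower q)
  (f : Polynomials.Poly F)
  where

  private module K = FiniteField F order
  open PolynomialRing F
  open PolynomialDegree F
  open Euclid F using (∷≋; irreducible⇒prime)
  private module P = RingTheory polyRing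
  open Quotient polyRing f public using (quotient; ≈⇒~)

  residue-homomorphism : IsRingHomomorphism (CommutativeRing.rawRing K.commutativeRing) (CommutativeRing.rawRing quotient) const
  residue-homomorphism = record
    { isSemiringHomomorphism = record
      { isNearSemiringHomomorphism = record
        { +-isMonoidHomomorphism = record
          { isMagmaHomomorphism = record
            { isRelHomomorphism = record { cong = λ a≈b → ≈⇒~ (⟦⟧-cong a≈b) }
            ; homo = λ a b → ≈⇒~ (+-homo a b)
            }
          ; ε-homo = ≈⇒~ 0#-homo
          }
        ; *-homo = λ a b → ≈⇒~ (*-homo a b)
        }
      ; 1#-homo = ≈⇒~ 1#-homo
      }
    ; -‿homo = λ a → ≈⇒~ (-‿homo a)
    }
    where open IsRingHomomorphism const-homomorphism

  open RingTheory quotient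
  open PowerLemmas quotient
  open Evaluation F quotient const residue-homomorphism
  open Extension F order q-pp quotient const residue-homomorphism using (HasConjugates; q^n>0)
  open Conjugates F order q-pp quotient const residue-homomorphism
  open import Relation.Binary.Reasoning.Setoid setoid

  f≈0 : f ≈ 0#
  f≈0 = const K.1# , P.sym (P.*-identityˡ f)

  -- The class θ of `X` generates the residue ring: `f` vanishes at it, and whatever iterate of
  -- Frobenius fixes it fixes every residue.
  ev-X≈ : ∀ p → ev p X ≈ p
  ev-X≈ []      = refl
  ev-X≈ (a ∷ p) = trans (+-congˡ {const a} (*-congˡ {X} (ev-X≈ p))) (≈⇒~ (P.sym (∷≋ a p)))

  -- The conjugates of `X` are separated roots of `f`, so an excess of them kills the leading
  -- coefficient modulo `f`.
  conjugates≤degree : ∀ {m l D G} → Lead f m l → HasConjugates X D G → m < D → const l ≈ 0#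
  conjugates≤degree {D = D} lf conj m<D = too-many-roots (ev-degree f lf) m<D (λ i → X ^ (q ℕ.^ toℕ i))
    (conjugates-separated conj) λ i → begin
      ev f (X ^ (q ℕ.^ toℕ i))    ≈⟨ ev-frobenius (toℕ i) f X ⟩
      ev f X ^ (q ℕ.^ toℕ i)      ≈⟨ ^-congˡ (q ℕ.^ toℕ i) (trans (ev-X≈ f) f≈0) ⟩
      0# ^ (q ℕ.^ toℕ i)          ≈⟨ 0^n≈0 (q^n>0 (toℕ i)) ⟩
      0#                          ∎

  -- `[] +ₚ q` reduces to `q`, so congruence to zero unfolds to the divisibility used in
  -- `irreducible⇒prime`.
  irreducible⇒no-zero-divisors : Irreducible f → NoZeroDivisors
  irreducible⇒no-zero-divisors irr = irreducible⇒prime irr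

  -- If X were fixed by the M-th power of Frobenius, all q ^ D residues would be
  -- roots of y ^ (q ^ M) - y.
  degree≤period : NoZeroDivisors → ∀ {D l} → ¬ l K.≈ K.0# → Lead f D l → 2 ≤ q → ∀ {M} → 1 ≤ M → M < D →
                  X ^ (q ℕ.^ M) ≈ X → 1# ≈ 0#
  degree≤period nzd {D} l≉0 lf 2≤q {M} 1≤M M<D X-fixed =
    too-many-roots (artin-schreier 2≤q^M) (ℕ.^-monoʳ-< q 2≤q M<D) residue separated-residues λ i →
      trans (+-congʳ { - residue i } (fixed (residue i))) (-‿inverseʳ (residue i))
    where
    2≤q^M : 2 ≤ q ℕ.^ M
    2≤q^M = ℕ.≤-trans 2≤q (≡.subst (_≤ q ℕ.^ M) (ℕ.*-identityʳ q) (ℕ.^-monoʳ-≤ q {{ℕ.>-nonZero (ℕ.<⇒≤ 2≤q)}} 1≤M))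

    fixed : ∀ p → p ^ (q ℕ.^ M) ≈ p
    fixed p = begin
      p ^ (q ℕ.^ M)             ≈⟨ ^-congˡ (q ℕ.^ M) (ev-X≈ p) ⟨
      ev p X ^ (q ℕ.^ M)        ≈⟨ ev-frobenius M p X ⟨
      ev p (X ^ (q ℕ.^ M))      ≈⟨ ev-congˡ p X-fixed ⟩
      ev p X                    ≈⟨ ev-X≈ p ⟩
      p                         ∎

    -- Base-q digits enumerate the coefficient vectors of the polynomials of degree below `D`.
    digits : Fin (q ℕ.^ D) → Fin D → K.Carrier
    digits i j = K.elem (finToFun {q} {D} i j)

    residue : Fin (q ℕ.^ D) → Poly
    residue i = tabulate (digits i)

    -- The difference of two such polynomials is a multiple of `f` of degree below `D`, hence zero.
    residue-injective : ∀ i j → residue i ≈ residue j → i ≡ j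
    residue-injective i j (k , eq) = finToFun-injective i j λ m → K.elem-injective _ _
      (K.trans (K.reflexive (≡.sym (coeff-tabulate (digits i) m))) (K.trans (same (toℕ m)) (K.reflexive (coeff-tabulate (digits j) m))))
      where
      coeff-eq : ∀ n → coeff (residue i) n K.≈ coeff (residue j) n K.+ coeff (k *ₚ f) n
      coeff-eq n = K.trans (at eq n) (coeff-+ (residue j) (k *ₚ f) n)
      kf≋[] : k *ₚ f ≋ []
      kf≋[] = short-multiple l≉0 lf k λ n D≤n → K.trans (K.sym (K.+-identityˡ _))
        (K.trans (K.+-congʳ (K.sym (tabulate-vanishes (digits j) n D≤n))) (K.trans (K.sym (coeff-eq n)) (tabulate-vanishes (digits i) n D≤n)))
      same : ∀ n → coeff (residue i) n K.≈ coeff (residue j) n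
      same n = K.trans (coeff-eq n) (K.trans (K.+-congˡ (at kf≋[] n)) (K.+-identityʳ _))

    separated-residues : Separated residue
    separated-residues i j i≢j y eq with nzd (residue i - residue j) y eq
    ... | inj₁ i-j≈0 = contradiction (residue-injective i j (x∙y⁻¹≈ε⇒x≈y _ _ i-j≈0)) i≢j
    ... | inj₂ y≈0   = y≈0

-- Irreducibility of all iterates in terms of the norms.

prime-power>1 : ∀ {q} → IsPrimePower q → 2 ≤ q
prime-power>1 (p , suc k , p-prime , _ , ≡.refl) =
  ℕ.≤-trans (prime>1 p-prime) (ℕ.m≤m*n p (p ℕ.^ k) {{ℕ.>-nonZero (ℕ.m^n>0 p {{ℕ.>-nonZero (ℕ.<⇒≤ (prime>1 p-prime))}} k)}})

≡1-mod : ∀ {q r} → 2 ≤ q → q ≡ 1 [mod r ] → ∃[ s ] (1 ≤ s × q ≡ suc (s ℕ.* r))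
≡1-mod {suc zero}    (s≤s ()) _
≡1-mod {suc (suc q)} _ (divides zero ())
≡1-mod {suc (suc q)} _ (divides (suc s) eq) = suc s , s≤s z≤n , ≡.cong suc eq

module Main
  {ℓ ℓ₁ ℓ₂} (F : DiscreteField ℓ ℓ₁ ℓ₂) {q} (order : DiscreteField.HasOrder F q) (q-pp : IsPrimePower q)
  {d} (2≤d : 2 ≤ d) (kummer : ∀ r → Prime r → r ∣ d → ∃[ s ] (1 ≤ s × q ≡ suc (s ℕ.* r)))
  (-1-square : 4 ∣ d → ¬ ¬ FieldTheory.IsPower F 2 (FieldTheory.-_ F (FieldTheory.1# F)))
  (a c β : DiscreteField.Carrier F) (a≉0 : ¬ FieldTheory._≈_ F a (FieldTheory.0# F))
  where

  private module K = FiniteField F order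
  open PolynomialRing F
  open PolynomialDegree F
  private module P = RingTheory polyRing
  open PowerClasses F

  b : K.Carrier
  b = a K.⁻¹

  ab≈1 : a K.* b K.≈ K.1#
  ab≈1 = K.⁻¹-inverseʳ a≉0

  open Characteristic d a b c β public

  h : Poly
  h = const a *ₚ X ^ₚ d +ₚ const c

  f : ℕ → Poly
  f n = (h ^∘ n) -ₚ const β

  module InPoly where
    open Evaluation F polyRing const const-homomorphism
    open IterateEvaluation F polyRing const const-homomorphism

    -- Composition is evaluation in the polynomial ring itself, so `ev-h` also computes h ∘ p.
    ∘ₚ≡ev : ∀ p r → p ∘ₚ r ≡ ev p r
    ∘ₚ≡ev []      r = ≡.refl
    ∘ₚ≡ev (a ∷ p) r = ≡.cong (λ x → const a +ₚ r *ₚ x) (∘ₚ≡ev p r)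

    h∘ₚ : ∀ p → h ∘ₚ p ≋ const a *ₚ p ^ₚ d +ₚ const c
    h∘ₚ p = P.trans (P.reflexive (∘ₚ≡ev h p)) (P.trans (ev-h d a c p)
      (P.reflexive (≡.cong (λ x → const a *ₚ x +ₚ const c) (^≡^ₚ d))))
      where
      ^≡^ₚ : ∀ n → p P.^ n ≡ p ^ₚ n
      ^≡^ₚ zero    = ≡.refl
      ^≡^ₚ (suc n) = ≡.cong (p *ₚ_) (^≡^ₚ n)

  lead-h∘ : ∀ {p m l} → 1 ≤ m → Lead p m l → Lead (h ∘ₚ p) (d ℕ.* m) (a K.* l K.^ d)
  lead-h∘ {p} 1≤m lp = lead-resp (P.sym (InPoly.h∘ₚ p))
    (lead-+const (const a *ₚ p ^ₚ d) c (ℕ.*-mono-≤ (ℕ.<⇒≤ 2≤d) 1≤m) (lead-* (const a) (p ^ₚ d) (lead-const a) (lead-^ p d lp)))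

  d^n>0 : ∀ n → 1 ≤ d ℕ.^ n
  d^n>0 n = ℕ.m^n>0 d {{ℕ.>-nonZero (ℕ.<⇒≤ 2≤d)}} n

  lead-iterate : ∀ n → ∃[ l ] (¬ l K.≈ K.0# × Lead (h ^∘ n) (d ℕ.^ n) l)
  lead-iterate zero    = K.1# , K.1≉0 , lead-X
  lead-iterate (suc n) with lead-iterate n
  ... | l , l≉0 , lp = a K.* l K.^ d ,
    K.unit⇒≉ (K.unit-* (K.≉⇒unit a≉0) (K.unit-^ d (K.≉⇒unit l≉0))) , lead-h∘ {h ^∘ n} (d^n>0 n) lp

  lead-f : ∀ n → ∃[ l ] (¬ l K.≈ K.0# × Lead (f n) (d ℕ.^ n) l)
  lead-f n with lead-iterate n
  ... | l , l≉0 , lp = l , l≉0 , lead-+const (h ^∘ n) (K.- β) (d^n>0 n) lp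

  Nonpower : ℕ → Set (ℓ ⊔ ℓ₁)
  Nonpower m = ∀ r → Prime r → r ∣ d → ¬ K.IsPower r (normValue m)

  module InResidues (u : Poly) where
    open Residues F order q-pp u public
    open RingTheory quotient public
    open Evaluation F quotient const residue-homomorphism public
    open IterateEvaluation F quotient const residue-homomorphism public
    open Extension F order q-pp quotient const residue-homomorphism public
      using (HasConjugates)
    open Tower F order q-pp quotient const residue-homomorphism public

    hMapᴿ′ : Poly → Poly
    hMapᴿ′ y = const a * y ^ d + const c

    -- The assumption says that `u` divides `f n`. It is used with a proper factor to exclude
    -- splittings, and with `f n` itself in the converse.
    preimage : ∀ n → f n ≈ 0# → iterate hMapᴿ′ X n ≈ const β
    preimage n fn≈0 = trans (sym (ev-iterate d a c n X)) (trans (ev-X≈ (h ^∘ n))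
      (x∙y⁻¹≈ε⇒x≈y (h ^∘ n) (const β) fn≈0))

  nonpower⇒irreducible : (∀ m → Nonpower m) → ∀ n → 1 ≤ n → Irreducible (f n)
  nonpower⇒irreducible nonpower n 1≤n with lead-f n
  ... | l , l≉0 , lf = record
    { p∤1      = λ (k RawMagmaDefinitions., kf≈1) → K.1≉0 (constant-multiple l≉0 lf (d^n>0 n) k (P.sym (≋-intro kf≈1)))
    ; split-∣1 = λ {x} {y} fn≈xy → split x y (≋-intro fn≈xy)
    }
    where
    open RawMagmaDefinitions (RawSemiring.*-rawMagma polyRawSemiring) using () renaming (_∣_ to _∣ₚ_)

    unit-divides-1 : ∀ p {l} → ¬ l K.≈ K.0# → Lead p 0 l → ∃[ k ] (k *ₚ p) ≈ₚ const K.1#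
    unit-divides-1 p {l} l≉0 lp = const l⁻¹ , at (P.trans (P.*-congˡ {const l⁻¹} (degree-0 {p} lp))
      (P.trans (P.sym (IsRingHomomorphism.*-homo const-homomorphism l⁻¹ l))
        (const-cong (K.trans (K.*-comm _ _) (proj₂ (K.≉⇒unit l≉0))))))
      where l⁻¹ = proj₁ (K.≉⇒unit l≉0)

    fn≉[] : ¬ f n ≋ []
    fn≉[] fn≋[] = l≉0 (K.trans (K.sym (proj₁ lf)) (at fn≋[] (d ℕ.^ n)))

    split : ∀ x y → f n ≋ x *ₚ y → (x ∣ₚ const K.1#) ⊎ (y ∣ₚ const K.1#)
    split x y fn≋ with degree x | degree y
    ... | inj₁ x≋[] | _         = contradiction (P.trans fn≋ (P.*-congʳ {y} {x} {[]} x≋[])) fn≉[]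
    ... | inj₂ _    | inj₁ y≋[] = contradiction (P.trans fn≋ (P.trans (P.*-congˡ {x} y≋[]) (P.zeroʳ x))) fn≉[]
    ... | inj₂ (zero , _ , lx≉0 , lx) | inj₂ _ = inj₁ (let (k , eq) = unit-divides-1 x lx≉0 lx in k RawMagmaDefinitions., eq)
    ... | inj₂ _ | inj₂ (zero , _ , ly≉0 , ly) = inj₂ (let (k , eq) = unit-divides-1 y ly≉0 ly in k RawMagmaDefinitions., eq)
    ... | inj₂ (suc i , m , m≉0 , lx) | inj₂ (suc j , m′ , m′≉0 , ly) = contradiction m≈0 m≉0
      where
      open InResidues x
      i+j≡ : suc i ℕ.+ suc j ≡ d ℕ.^ n
      i+j≡ = lead-unique {f n} (no-zero-divisors m≉0 m′≉0) l≉0 (lead-resp (P.sym fn≋) (lead-* x y lx ly)) lf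
      conj : HasConjugates X (d ℕ.^ n) (charFun n)
      conj = preimage-conjugates 2≤d kummer -1-square ab≈1 c β n (λ m _ → nonpower m) X
        (preimage n (y , P.trans fn≋ (P.*-comm x y)))
      -- Modulo `x` there are d ^ n conjugates of `X`, more than the degree of `x`. So the leading
      -- coefficient `m` vanishes modulo the nonconstant `x`, hence in the field.
      m≈0 : m K.≈ K.0#
      m≈0 = let (k , eq) = conjugates≤degree lx conj (≡.subst (suc i <_) i+j≡ (ℕ.m<m+n (suc i) (s≤s z≤n))) in
        constant-multiple m≉0 lx (s≤s z≤n) k eq

  irreducible⇒nonpower : (∀ n → 1 ≤ n → Irreducible (f n)) → ∀ m → Nonpower m
  irreducible⇒nonpower irr m = below (suc m) m ℕ.≤-refl
    where
    -- The smaller norms being nonpowers gives the m-fold preimage its d ^ m conjugates, so the norm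
    -- `normValue m` is available. The period then found, d ^ m * e, is less than the degree.
    step : ∀ m → (∀ i → i < m → Nonpower i) → Nonpower m
    step m nonpower r r-prime (divides e d≡er) pow = 1≉0′
      (degree≤period nzd l≉0 lf (prime-power>1 q-pp) (ℕ.*-mono-≤ (d^n>0 m) e>0) De<dD
        (preimage-period 2≤d kummer -1-square ab≈1 c β nzd 1≉0′ nonpower r-prime d≡er pow X (preimage (suc m) f≈0)))
      where
      open InResidues (f (suc m))
      l≉0 = proj₁ (proj₂ (lead-f (suc m)))
      lf = proj₂ (proj₂ (lead-f (suc m)))

      1≉0′ : ¬ 1# ≈ 0#
      1≉0′ (k , eq) = K.1≉0 (constant-multiple l≉0 lf (d^n>0 (suc m)) k eq)

      nzd = irreducible⇒no-zero-divisors (irr (suc m) (s≤s z≤n))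

      e>0 : 1 ≤ e
      e>0 = ℕ.n≢0⇒n>0 λ e≡0 → ℕ.<⇒≢ (ℕ.<⇒≤ 2≤d) (≡.sym (≡.trans d≡er (≡.cong (ℕ._* r) e≡0)))

      De<dD : d ℕ.^ m ℕ.* e < d ℕ.^ suc m
      De<dD = ≡.subst (d ℕ.^ m ℕ.* e <_) (≡.trans (ℕ.*-assoc (d ℕ.^ m) e r) (≡.trans (ℕ.*-comm (d ℕ.^ m) (e ℕ.* r)) (≡.cong (ℕ._* d ℕ.^ m) (≡.sym d≡er))))
        (ℕ.m<m*n (d ℕ.^ m ℕ.* e) r {{ℕ.>-nonZero (ℕ.*-mono-≤ (d^n>0 m) e>0)}} (prime>1 r-prime))

    below : ∀ n m → m < n → Nonpower m
    below (suc n) m (s≤s m≤n) = step m λ i i<m → below n i (ℕ.<-≤-trans i<m m≤n)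

-- From the norms to the conditions of the theorem.

module PolynomialFunctions {c ℓ₁ ℓ₂} (F : DiscreteField c ℓ₁ ℓ₂) where

  open FieldTheory F
  open PolynomialRing F

  id-homomorphism : IsRingHomomorphism (CommutativeRing.rawRing commutativeRing) (CommutativeRing.rawRing commutativeRing) id
  id-homomorphism = Identity.isRingHomomorphism (CommutativeRing.rawRing commutativeRing) refl

  open Evaluation F commutativeRing id id-homomorphism
  open IterateEvaluation F commutativeRing id id-homomorphism

  eval≡ev : ∀ p x → eval p x ≡ ev p x
  eval≡ev []      x = ≡.refl
  eval≡ev (a ∷ p) x = ≡.cong (λ y → a + x * y) (eval≡ev p x)

  eval-iterate : ∀ d a c n x → eval ((const a *ₚ X ^ₚ d +ₚ const c) ^∘ n) x ≈ iterate (λ y → a * y ^ d + c) x n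
  eval-iterate d a c n x = trans (reflexive (eval≡ev ((const a *ₚ X ^ₚ d +ₚ const c) ^∘ n) x)) (ev-iterate d a c n x)

module QuarticCondition {c ℓ₁ ℓ₂} (F : DiscreteField c ℓ₁ ℓ₂) {q} (order : DiscreteField.HasOrder F q)
  {s} (s>0 : 1 ≤ s) (q≡1+4s : q ≡ suc (s ℕ.* 4)) where

  open FiniteField F order
  open PowerClasses F
  open Frobenius commutativeRing using (multiple-of-char)
  open import Algebra.Properties.Semiring.Mult semiring using (×-assoc-*; ×-congʳ) renaming (_×_ to infixr 8 _·_)
  open import Relation.Binary.Reasoning.Setoid setoid

  -- Euler's criterion: (q - 1) / 2 = 2 s is even.
  -1-is-square : ¬ ¬ IsPower 2 (- 1#)
  -1-is-square = euler-criterion {2} {s ℕ.* 2} (s≤s z≤n) (ℕ.*-mono-≤ s>0 (s≤s {n = 1} z≤n))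
    (≡.trans q≡1+4s (≡.cong suc (≡.sym (ℕ.*-assoc s 2 2)))) (-1-power-even (divides s ≡.refl))

  -- q = 1 + 4 s and q · 1 = 0, so 4 · 1 = 0 would give 1 = 0.
  4·1≉0 : ¬ 4 · 1# ≈ 0#
  4·1≉0 4·1≈0 = 1≉0 (begin
    1#                       ≈⟨ +-identityʳ 1# ⟨
    1# + 0#                  ≈⟨ +-congˡ (multiple-of-char 4·1≈0 (divides s ≡.refl) 1#) ⟨
    suc (s ℕ.* 4) · 1#       ≡⟨ ≡.cong (_· 1#) q≡1+4s ⟨
    q · 1#                   ≈⟨ q·1≈0 ⟩
    0#                       ∎)

  4·a≉0 : ∀ {a} → ¬ a ≈ 0# → ¬ 4 · a ≈ 0#
  4·a≉0 {a} a≉0 4·a≈0 = a≉0 (unit⇒regular (≉⇒unit 4·1≉0) a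
    (trans (×-assoc-* 4 1# a) (trans (×-congʳ 4 (*-identityˡ a)) 4·a≈0)))

  -- If x / 4 a = y ^ 4 then - x / a = - (2 y ^ 2) ^ 2, and - 1 is a square.
  quartic⇒square : ∀ {a x} → ¬ a ≈ 0# → IsPower 4 (x / (4 · a)) → ¬ ¬ IsPower 2 (- x / a)
  quartic⇒square {a} {x} a≉0 (y , x/4a≈y⁴) k = -1-is-square λ sq → k (IsPower-resp {2} (sym -x/a≈)
    (IsPower-* {2} sq (y * y + y * y , refl)))
    where
    4a≉0 = 4·a≉0 a≉0
    x≈ : x ≈ y ^ 4 * (4 · a)
    x≈ = begin
      x                                  ≈⟨ *-identityʳ x ⟨
      x * 1#                             ≈⟨ *-congˡ (trans (*-comm _ _) (⁻¹-inverseʳ 4a≉0)) ⟨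
      x * ((4 · a) ⁻¹ * (4 · a))         ≈⟨ *-assoc _ _ _ ⟨
      x * (4 · a) ⁻¹ * (4 · a)           ≈⟨ *-congʳ x/4a≈y⁴ ⟩
      y ^ 4 * (4 · a)                    ∎
    -x/a≈ : - x / a ≈ - 1# * (y * y + y * y) ^ 2
    -x/a≈ = begin
      - x * a ⁻¹                                         ≈⟨ *-congʳ (-‿cong x≈) ⟩
      - (y ^ 4 * (4 · a)) * a ⁻¹                         ≈⟨ solve 3 (λ y a b → (:- ((y :* (y :* (y :* (y :* con (+ 1))))) :* (a :+ (a :+ (a :+ (a :+ con (+ 0))))))) :* b
                                                                      := (:- con (+ 1)) :* ((y :* y :+ y :* y) :* ((y :* y :+ y :* y) :* con (+ 1))) :* (a :* b)) refl y a (a ⁻¹) ⟩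
      - 1# * (y * y + y * y) ^ 2 * (a * a ⁻¹)            ≈⟨ *-congˡ (⁻¹-inverseʳ a≉0) ⟩
      - 1# * (y * y + y * y) ^ 2 * 1#                    ≈⟨ *-identityʳ _ ⟩
      - 1# * (y * y + y * y) ^ 2                         ∎

theorem13 :
    ∀ {ℓ ℓ₁ ℓ₂} (d q : ℕ) → 2 ≤ d → IsPrimePower q →
    (F : DiscreteField ℓ ℓ₁ ℓ₂) → DiscreteField.HasOrder F q →
    let open DiscreteField F
        open Polynomials F
    in
    (a c β : Carrier) → a # 0# →
    (∀ r → Prime r → r ∣ d → q ≡ 1 [mod r ]) →
    (4 ∣ d → q ≡ 1 [mod 4 ]) →
    let h = const a *ₚ X ^ₚ d +ₚ const c in
    DynamicallyIrreducible h β
      ⇔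
    ( (∀ r → Prime r → r ∣ d →
         ¬ IsPower r ((- (c - β)) / a)
         × (∀ n → 1 < n → ¬ IsPower r ((eval (h ^∘ (n ∸ 1)) c - β) / a)))
    × (4 ∣ d →
         ¬ IsPower 4 ((c - β) / (4 · a))
         × (∀ n → 1 < n → ¬ IsPower 4 ((eval (h ^∘ (n ∸ 1)) c - β) / a))))
theorem13 d q 2≤d q-pp F order a c β a#0 q≡1-mod-r q≡1-mod-4 = mk⇔
  (λ (_ , irreducible) → conditions (irreducible⇒nonpower irreducible))
  (λ (conds , _) → (d , 2≤d , K.≉⇒# (λ eq → a≉0 (K.trans (K.sym lead-h) eq))) , nonpower⇒irreducible (nonpower conds))
  where
  module K = FiniteField F order
  open PolynomialRing F
  open PolynomialFunctions F

  a≉0 : ¬ a K.≈ K.0#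
  a≉0 = K.#⇒≉ a#0

  q>1 : 2 ≤ q
  q>1 = prime-power>1 q-pp

  module Quartic (4∣d : 4 ∣ d) = QuarticCondition F order
    (proj₁ (proj₂ (≡1-mod q>1 (q≡1-mod-4 4∣d)))) (proj₂ (proj₂ (≡1-mod q>1 (q≡1-mod-4 4∣d))))

  open Main F order q-pp 2≤d (λ r r-prime r∣d → ≡1-mod q>1 (q≡1-mod-r r r-prime r∣d))
    (λ 4∣d → Quartic.-1-is-square 4∣d) a c β a≉0 using
    (b; ab≈1; normValue; normValue-0; normValue-power; Nonpower; nonpower⇒irreducible; irreducible⇒nonpower)

  h : Poly
  h = const a *ₚ X ^ₚ d +ₚ const c

  lead-h : coeff h d K.≈ a
  lead-h = K.trans (≡.subst (λ n → coeff h n K.≈ a K.* K.1# K.^ d) (ℕ.*-identityʳ d)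
      (proj₁ (lead-+const (const a *ₚ X ^ₚ d) c (ℕ.*-mono-≤ (ℕ.<⇒≤ 2≤d) (s≤s {n = 0} z≤n)) (lead-* (const a) (X ^ₚ d) (lead-const a) (lead-^ X d lead-X)))))
    (K.trans (K.*-congˡ (K.1^n≈1 d)) (K.*-identityʳ a))

  value≈ : ∀ n → (iterate (λ y → a K.* y K.^ d K.+ c) c n K.- β) K.* b K.≈ (eval (h ^∘ n) c K.- β) K.* b
  value≈ n = K.*-congʳ (K.+-congʳ (K.sym (eval-iterate d a c n c)))

  b-unit : K.Unit b
  b-unit = a , K.trans (K.*-comm b a) ab≈1

  conditions : (∀ m → Nonpower m) → _
  conditions np =
    (λ r r-prime r∣d → np 0 r r-prime r∣d ∘ K.IsPower-resp {r} (K.sym normValue-0) , later r r-prime r∣d) ,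
    λ 4∣d → let 2∣d = ℕ.∣-trans (divides 2 ≡.refl) 4∣d in
      (λ pow → Quartic.quartic⇒square 4∣d a≉0 pow (np 0 2 prime[2] 2∣d ∘ K.IsPower-resp {2} (K.sym normValue-0))) ,
      λ n 1<n → later 2 prime[2] 2∣d n 1<n ∘ K.IsPower-∣ {2} 2
    where
    later : ∀ r → Prime r → r ∣ d → ∀ n → 1 < n → ¬ K.IsPower r ((eval (h ^∘ (n ∸ 1)) c K.- β) K.* b)
    -- The conditions are indexed one above the norms: the value at h ^ (n + 1) (c) belongs to
    -- `normValue (suc n)` and to the index n + 2.
    later r r-prime r∣d (suc (suc n)) _ = np (suc n) r r-prime r∣d ∘ proj₂ (normValue-power b-unit r∣d n) ∘ K.IsPower-resp {r} (K.sym (value≈ (suc n)))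
    later r r-prime r∣d (suc zero) (s≤s ())

  nonpower : (∀ r → Prime r → r ∣ d → ¬ K.IsPower r (K.- (c K.- β) K.* b)
               × (∀ n → 1 < n → ¬ K.IsPower r ((eval (h ^∘ (n ∸ 1)) c K.- β) K.* b))) → ∀ m → Nonpower m
  nonpower conds zero    r r-prime r∣d = proj₁ (conds r r-prime r∣d) ∘ K.IsPower-resp {r} normValue-0
  nonpower conds (suc m) r r-prime r∣d = proj₂ (conds r r-prime r∣d) (suc (suc m)) (s≤s (s≤s z≤n))
    ∘ K.IsPower-resp {r} (value≈ (suc m)) ∘ proj₁ (normValue-power b-unit r∣d m)
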